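{- Let $d\ge1$ be an integer and let $\mathcal{F}$ be a uniform subdivision of $(d-1)$-dimensional simplicial complexes, with transformation matrix $H_{\mathcal F}=[p_d(i,j)]_{0\le i,j\le d}$. If $\mathcal{F}$ has the interlacing property, i.e. if the sequence of column generating polynomials $\big(P_{d,0}(x),P_{d,1}(x),\dots,P_{d,d}(x)\big)$, $P_{d,k}(x)=\sum_{i=0}^d p_d(i,k)x^i$, is an interlacing sequence, then $H_{\mathcal F}$ is TP$_2$, i.e. all entries and all $2\times 2$ minors of $H_{\mathcal F}$ are non-negative.
   Context: Rows and columns of matrices are indexed starting from $0$. All simplicial complexes are finite. Uniform subdivisions. A triangulation $\Delta'$ of a simplicial complex $\Delta$ is a simplicial complex having a geometric realization that subdivides a geometric realization of $\Delta$; for a face $F\in\Delta$, the restriction $\Delta'_F$ is the subcomplex of $\Delta'$ triangulating $F$. Let $\mathcal{F}=(f_{\mathcal F}(i,j))_{0\le i\le j\le d}$ be a triangular array of non-negative integers. A triangulation $\Delta'$ of a $(d-1)$-dimensional complex $\Delta$ is $\mathcal{F}$-uniform if, for all $0\le i\le j\le d$ and every $(j-1)$-dimensional face $F$ of $\Delta$, the restriction $\Delta'_F$ has exactly $f_{\mathcal F}(i,j)$ faces of dimension $i-1$ (so the face numbers of the restriction depend only on $\dim F$). One calls $\mathcal{F}$ a uniform subdivision (uniform triangulation) of $(d-1)$-dimensional complexes when it is the array of an $\mathcal F$-uniform triangulation of some $(d-1)$-dimensional simplicial complex. Transformation matrix. For a $(d-1)$-dimensional complex $\Delta$ with $f_{i-1}$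 faces of dimension $i-1$ ($f_{ -1}=1$), the $h$-vector $(h_0,\dots,h_d)$ is defined by $\sum_{i=0}^d h_i x^i=\sum_{i=0}^d f_{i-1}x^i(1-x)^{d-i}$. If $\Delta'$ is an $\mathcal{F}$-uniform triangulation of $\Delta$ then the face numbers $f'_{i-1}$ of $\Delta'$ satisfy $f'_{i-1}=\sum_{j=0}^d g(i,j)f_{j-1}$ with $g(i,j)=\sum_{k=0}^{j}(-1)^{j-k}\binom{j}{k}f_{\mathcal F}(i,k)$ (where $f_{\mathcal F}(i,k)=0$ for $i>k$). The transformation matrix $H_{\mathcal F}=[p_d(i,j)]_{0\le i,j\le d}$ is the matrix of this linear map $\mathbb{R}^{d+1}\to\mathbb{R}^{d+1}$ expressed in the $h$-coordinates (via the displayed invertible linear relation between $f$- and $h$-vectors, for source and target); thus $h^{\Delta'}=H_{\mathcal F}\,h^{\Delta}$ (column vectors) for every $(d-1)$-dimensional $\Delta$ and every $\mathcal{F}$-uniform triangulation $\Delta'$ of $\Delta$. Interlacing. For real-rooted $f,g\in\mathbb{R}[x]$ with positive leading coefficients, write $f\preceq g$ if $\cdots\le r_2(f)\le r_2(g)\le r_1(f)\le r_1(g)$, where $r_1\ge r_2\ge\cdots$ denote the zeros (with multiplicity) in non-increasing order; in particular $\deg g\in\{\deg f,\deg f+1\}$. By convention $0\preceq 0$, $0\preceq h$ and $h\preceq 0$ for every real-rooted $h$ with positive leading coefficient. A sequence $(f_0,\dots,f_n)$ of real-rooted polynomials is interlacing if $f_i\preceq f_j$ for all $0\le i<j\le n$.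 -}

module Defs where

open import Algebra.Bundles.Raw using (RawMonoid)
import Algebra.Definitions.RawMonoid as RawMonoidDefinitions
import Algebra.Properties.CommutativeMonoid.Sum as CommutativeMonoidSum
open import Data.Bool.Base using (if_then_else_)
open import Data.Fin.Base using (Fin; zero; suc; toℕ)
open import Data.Fin.Subset using (Subset; _∈_; _∉_; _⊆_; _∩_; ⊥) renaming (∣_∣ to card)
open import Data.Integer.Base using (ℤ; +_; 0ℤ; -1ℤ)
  renaming (_+_ to _+ᶻ_; _*_ to _*ᶻ_; _-_ to _-ᶻ_; _^_ to _^ᶻ_; _≤_ to _≤ᶻ_)
open import Data.Integer.Properties using () renaming (+-0-commutativeMonoid to ℤ-+-0-commutativeMonoid)
open import Data.List.Base using (length)
import Data.List.Membership.Propositional as List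
open import Data.List.Relation.Unary.Unique.Propositional using (Unique)
open import Data.Nat.Base as ℕ using (ℕ; zero; suc; _∸_; _≤ᵇ_)
open import Data.Nat.Combinatorics using (_C_)
import Data.Nat.Properties as ℕ
open import Data.Product.Base using (Σ-syntax; ∃-syntax; _×_; _,_)
open import Data.Rational.Base as ℚ using (ℚ; 0ℚ; 1ℚ; ½; ∣_∣; 1/_)
import Data.Rational.Properties as ℚ
import Data.Rational.Solver as ℚSolver
open import Data.Sum.Base using (_⊎_)
open import Data.Vec.Functional using (Vector; tail)
open import Function.Bundles using (_⇔_)
open import Level using (0ℓ)
open import Relation.Binary.PropositionalEquality using (_≡_; refl; sym; trans; cong; cong₂; subst)
open import Relation.Nullary using (¬_)
open import Relation.Unary using (Pred; Decidable) renaming (_⊆_ to _⊆ᵖ_)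

------------------------------------------------------------------------
-- Real numbers, as Cauchy sequences of rationals.  Real numbers are
-- compared with _≈_, not with _≡_.

IsCauchy : (ℕ → ℚ) → Set
IsCauchy x = ∀ ε → 0ℚ ℚ.< ε →
  ∃[ N ] ∀ m n → N ℕ.≤ m → N ℕ.≤ n → ∣ x m ℚ.- x n ∣ ℚ.≤ ε

record ℝ : Set where
  constructor mkℝ
  field
    approx   : ℕ → ℚ
    isCauchy : IsCauchy approx

open ℝ public

private open module ℚ-Solver = ℚSolver.+-*-Solver

-- These proofs are abstract because unfolding them makes type checking of the
-- definitions below intractable.
private abstract
  sum-difference : ∀ a b c d → (a ℚ.+ b) ℚ.- (c ℚ.+ d) ≡ (a ℚ.- c) ℚ.+ (b ℚ.- d)
  sum-difference = solve 4 (λ a b c d → (a :+ b) :- (c :+ d) := (a :- c) :+ (b :- d)) refl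

  neg-difference : ∀ a b → (ℚ.- a) ℚ.- (ℚ.- b) ≡ ℚ.- (a ℚ.- b)
  neg-difference = solve 2 (λ a b → (:- a) :- (:- b) := :- (a :- b)) refl

  add-difference : ∀ a b → a ≡ b ℚ.+ (a ℚ.- b)
  add-difference = solve 2 (λ a b → a := b :+ (a :- b)) refl

  product-difference : ∀ a b c d →
    a ℚ.* b ℚ.- c ℚ.* d ≡ a ℚ.* (b ℚ.- d) ℚ.+ d ℚ.* (a ℚ.- c)
  product-difference =
    solve 4 (λ a b c d → a :* b :- c :* d := a :* (b :- d) :+ d :* (a :- c)) refl

  +-isCauchy : ∀ {x y} → IsCauchy x → IsCauchy y → IsCauchy (λ n → x n ℚ.+ y n)
  +-isCauchy {x} {y} cx cy ε 0<ε =
    let (M , hM) = cx (½ ℚ.* ε) 0<½ε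
        (N , hN) = cy (½ ℚ.* ε) 0<½ε
    in M ℕ.⊔ N , λ m n p q → begin
      ∣ (x m ℚ.+ y m) ℚ.- (x n ℚ.+ y n) ∣
        ≡⟨ cong ∣_∣ (sum-difference (x m) (y m) (x n) (y n)) ⟩
      ∣ (x m ℚ.- x n) ℚ.+ (y m ℚ.- y n) ∣
        ≤⟨ ℚ.∣p+q∣≤∣p∣+∣q∣ (x m ℚ.- x n) (y m ℚ.- y n) ⟩
      ∣ x m ℚ.- x n ∣ ℚ.+ ∣ y m ℚ.- y n ∣
        ≤⟨ ℚ.+-mono-≤ (hM m n (ℕ.m⊔n≤o⇒m≤o M N p) (ℕ.m⊔n≤o⇒m≤o M N q))
                      (hN m n (ℕ.m⊔n≤o⇒n≤o M N p) (ℕ.m⊔n≤o⇒n≤o M N q)) ⟩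
      ½ ℚ.* ε ℚ.+ ½ ℚ.* ε
        ≡⟨ ℚ.*-distribʳ-+ ε ½ ½ ⟨
      1ℚ ℚ.* ε
        ≡⟨ ℚ.*-identityˡ ε ⟩
      ε ∎
    where
    open ℚ.≤-Reasoning
    0<½ε : 0ℚ ℚ.< ½ ℚ.* ε
    0<½ε = ℚ.*-monoʳ-<-pos ½ 0<ε

  neg-isCauchy : ∀ {x} → IsCauchy x → IsCauchy (λ n → ℚ.- x n)
  neg-isCauchy {x} cx ε 0<ε =
    let (N , h) = cx ε 0<ε
    in N , λ m n p q → begin
      ∣ (ℚ.- x m) ℚ.- (ℚ.- x n) ∣
        ≡⟨ cong ∣_∣ (neg-difference (x m) (x n)) ⟩
      ∣ ℚ.- (x m ℚ.- x n) ∣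
        ≡⟨ ℚ.∣-p∣≡∣p∣ (x m ℚ.- x n) ⟩
      ∣ x m ℚ.- x n ∣
        ≤⟨ h m n p q ⟩
      ε ∎
    where open ℚ.≤-Reasoning

  eventually-bounded : ∀ {x} → IsCauchy x →
    ∃[ B ] (0ℚ ℚ.< B) × (∃[ N ] ∀ n → N ℕ.≤ n → ∣ x n ∣ ℚ.≤ B)
  eventually-bounded {x} cx =
    let (N , h) = cx 1ℚ (ℚ.positive⁻¹ 1ℚ)
    in ∣ x N ∣ ℚ.+ 1ℚ
     , ℚ.+-mono-≤-< (ℚ.0≤∣p∣ (x N)) (ℚ.positive⁻¹ 1ℚ)
     , N , λ n p → begin
      ∣ x n ∣
        ≡⟨ cong ∣_∣ (add-difference (x n) (x N)) ⟩
      ∣ x N ℚ.+ (x n ℚ.- x N) ∣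
        ≤⟨ ℚ.∣p+q∣≤∣p∣+∣q∣ (x N) (x n ℚ.- x N) ⟩
      ∣ x N ∣ ℚ.+ ∣ x n ℚ.- x N ∣
        ≤⟨ ℚ.+-monoʳ-≤ ∣ x N ∣ (h n N p ℕ.≤-refl) ⟩
      ∣ x N ∣ ℚ.+ 1ℚ ∎
    where open ℚ.≤-Reasoning

  *-bound : ∀ a b {c d} → ∣ a ∣ ℚ.≤ c → ∣ b ∣ ℚ.≤ d → ∣ a ∣ ℚ.* ∣ b ∣ ℚ.≤ c ℚ.* d
  *-bound a b {c} {d} a≤c b≤d = ℚ.≤-trans
    (ℚ.*-monoʳ-≤-nonNeg ∣ b ∣ {{ℚ.∣-∣-nonNeg b}} a≤c)
    (ℚ.*-monoˡ-≤-nonNeg c {{ℚ.nonNegative (ℚ.≤-trans (ℚ.0≤∣p∣ a) a≤c)}} b≤d)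

  product-bound : ∀ a b c d {A B δ} →
    ∣ a ∣ ℚ.≤ A → ∣ d ∣ ℚ.≤ B → ∣ b ℚ.- d ∣ ℚ.≤ δ → ∣ a ℚ.- c ∣ ℚ.≤ δ →
    ∣ a ℚ.* b ℚ.- c ℚ.* d ∣ ℚ.≤ (A ℚ.+ B) ℚ.* δ
  product-bound a b c d {A} {B} {δ} a≤A d≤B b-d≤δ a-c≤δ = begin
    ∣ a ℚ.* b ℚ.- c ℚ.* d ∣
      ≡⟨ cong ∣_∣ (product-difference a b c d) ⟩
    ∣ a ℚ.* (b ℚ.- d) ℚ.+ d ℚ.* (a ℚ.- c) ∣
      ≤⟨ ℚ.∣p+q∣≤∣p∣+∣q∣ (a ℚ.* (b ℚ.- d)) (d ℚ.* (a ℚ.- c)) ⟩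
    ∣ a ℚ.* (b ℚ.- d) ∣ ℚ.+ ∣ d ℚ.* (a ℚ.- c) ∣
      ≡⟨ cong₂ ℚ._+_ (ℚ.∣p*q∣≡∣p∣*∣q∣ a (b ℚ.- d)) (ℚ.∣p*q∣≡∣p∣*∣q∣ d (a ℚ.- c)) ⟩
    ∣ a ∣ ℚ.* ∣ b ℚ.- d ∣ ℚ.+ ∣ d ∣ ℚ.* ∣ a ℚ.- c ∣
      ≤⟨ ℚ.+-mono-≤ (*-bound a (b ℚ.- d) a≤A b-d≤δ) (*-bound d (a ℚ.- c) d≤B a-c≤δ) ⟩
    A ℚ.* δ ℚ.+ B ℚ.* δ
      ≡⟨ ℚ.*-distribʳ-+ δ A B ⟨
    (A ℚ.+ B) ℚ.* δ ∎
    where open ℚ.≤-Reasoning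

  divide : ∀ S → 0ℚ ℚ.< S → ∀ ε → 0ℚ ℚ.< ε → ∃[ δ ] (0ℚ ℚ.< δ) × (S ℚ.* δ ≡ ε)
  divide S 0<S ε 0<ε =
    1/ S ℚ.* ε ,
    subst (ℚ._< 1/ S ℚ.* ε) (ℚ.*-zeroʳ (1/ S)) (ℚ.*-monoʳ-<-pos (1/ S) 0<ε) ,
    trans (sym (ℚ.*-assoc S (1/ S) ε))
          (trans (cong (ℚ._* ε) (ℚ.*-inverseʳ S)) (ℚ.*-identityˡ ε))
    where
    instance
      S-pos : ℚ.Positive S
      S-pos = ℚ.positive 0<S
      S-nonZero : ℚ.NonZero S
      S-nonZero = ℚ.pos⇒nonZero S
      1/S-pos : ℚ.Positive (1/ S)
      1/S-pos = ℚ.1/pos⇒pos S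

  *-isCauchy : ∀ {x y} → IsCauchy x → IsCauchy y → IsCauchy (λ n → x n ℚ.* y n)
  *-isCauchy {x} {y} cx cy ε 0<ε =
    let (A , 0<A , L , hA) = eventually-bounded {x} cx
        (B , 0<B , M , hB) = eventually-bounded {y} cy
        (δ , 0<δ , Sδ≡ε)   = divide (A ℚ.+ B) (ℚ.+-mono-< 0<A 0<B) ε 0<ε
        (J , hJ) = cx δ 0<δ
        (K , hK) = cy δ 0<δ
    in (L ℕ.⊔ M) ℕ.⊔ (J ℕ.⊔ K) , λ m n p q →
      let LM≤m = ℕ.m⊔n≤o⇒m≤o (L ℕ.⊔ M) (J ℕ.⊔ K) p
          LM≤n = ℕ.m⊔n≤o⇒m≤o (L ℕ.⊔ M) (J ℕ.⊔ K) q
          JK≤m = ℕ.m⊔n≤o⇒n≤o (L ℕ.⊔ M) (J ℕ.⊔ K) p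
          JK≤n = ℕ.m⊔n≤o⇒n≤o (L ℕ.⊔ M) (J ℕ.⊔ K) q
      in ℚ.≤-trans
        (product-bound (x m) (y m) (x n) (y n) {A} {B} {δ}
          (hA m (ℕ.m⊔n≤o⇒m≤o L M LM≤m))
          (hB n (ℕ.m⊔n≤o⇒n≤o L M LM≤n))
          (hK m n (ℕ.m⊔n≤o⇒n≤o J K JK≤m) (ℕ.m⊔n≤o⇒n≤o J K JK≤n))
          (hJ m n (ℕ.m⊔n≤o⇒m≤o J K JK≤m) (ℕ.m⊔n≤o⇒m≤o J K JK≤n)))
        (ℚ.≤-reflexive Sδ≡ε)

  constant-isCauchy : ∀ q → IsCauchy (λ _ → q)
  constant-isCauchy q ε 0<ε = 0 , λ _ _ _ _ →
    ℚ.≤-trans (ℚ.≤-reflexive (cong ∣_∣ (ℚ.+-inverseʳ q))) (ℚ.<⇒≤ 0<ε)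

infix  4 _≈_ _≤_ _<_
infixl 6 _+_
infixl 7 _*_
infix  8 -_

fromℚ : ℚ → ℝ
fromℚ q = mkℝ (λ _ → q) (constant-isCauchy q)

fromℤ : ℤ → ℝ
fromℤ z = fromℚ (z ℚ./ 1)

0ℝ 1ℝ : ℝ
0ℝ = fromℚ 0ℚ
1ℝ = fromℚ 1ℚ

_+_ _*_ : ℝ → ℝ → ℝ
mkℝ x cx + mkℝ y cy = mkℝ (λ n → x n ℚ.+ y n) (+-isCauchy {x} {y} cx cy)
mkℝ x cx * mkℝ y cy = mkℝ (λ n → x n ℚ.* y n) (*-isCauchy {x} {y} cx cy)

-_ : ℝ → ℝ
- mkℝ x cx = mkℝ (λ n → ℚ.- x n) (neg-isCauchy {x} cx)

_≤_ _<_ _≈_ : ℝ → ℝ → Set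
x ≤ y = ∀ ε → 0ℚ ℚ.< ε → ∃[ N ] ∀ n → N ℕ.≤ n → approx x n ℚ.≤ approx y n ℚ.+ ε
x < y = ∃[ ε ] (0ℚ ℚ.< ε) × (∃[ N ] ∀ n → N ℕ.≤ n → approx x n ℚ.+ ε ℚ.≤ approx y n)
x ≈ y = (x ≤ y) × (y ≤ x)

+-rawMonoid : RawMonoid 0ℓ 0ℓ
+-rawMonoid = record { Carrier = ℝ ; _≈_ = _≈_ ; _∙_ = _+_ ; ε = 0ℝ }

open RawMonoidDefinitions +-rawMonoid public using () renaming (sum to sumℝ)

------------------------------------------------------------------------
-- Finite simplicial complexes

-- The empty face is always present; not every index in Fin n need be a
-- vertex.
record SimplicialComplex (n : ℕ) : Set₁ where
  field
    Face        : Pred (Subset n) 0ℓ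
    face?       : Decidable Face
    ∅-face      : Face ⊥
    down-closed : ∀ {G F} → G ⊆ F → Face F → Face G

open SimplicialComplex public using (Face)

-- A face with k vertices has dimension k - 1.
HasDimensionPred : ∀ {n} → SimplicialComplex n → ℕ → Set
HasDimensionPred Δ d =
  (∃[ F ] Face Δ F × card F ≡ d) × (∀ F → Face Δ F → card F ℕ.≤ d)

HasSize : ∀ {n} → Pred (Subset n) 0ℓ → ℕ → Set
HasSize P m =
  ∃[ Fs ] Unique Fs × length Fs ≡ m × (∀ F → (F List.∈ Fs) ⇔ P F)

------------------------------------------------------------------------
-- Geometric realizations and triangulations

Point : ℕ → Set
Point N = Vector ℝ N

combination : ∀ {n N} → Vector ℝ n → (Fin n → Point N) → Point N
combination w v c = sumℝ (λ i → w i * v i c)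

SupportedOn : ∀ {n} → Vector ℝ n → Subset n → Set
SupportedOn w F = ∀ i → i ∉ F → w i ≈ 0ℝ

-- The convex hull of the points v i, i ∈ F.
conv : ∀ {n N} → (Fin n → Point N) → Subset n → Pred (Point N) 0ℓ
conv {n} v F x = Σ[ w ∈ Vector ℝ n ]
  (∀ i → 0ℝ ≤ w i) ×
  SupportedOn w F ×
  sumℝ w ≈ 1ℝ ×
  (∀ c → x c ≈ combination w v c)

AffinelyIndependent : ∀ {n N} → (Fin n → Point N) → Subset n → Set
AffinelyIndependent {n} v F = ∀ (w : Vector ℝ n) →
  SupportedOn w F → sumℝ w ≈ 0ℝ → (∀ c → combination w v c ≈ 0ℝ) → ∀ i → w i ≈ 0ℝ

record IsRealization {n N} (Δ : SimplicialComplex n) (v : Fin n → Point N) : Set where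
  field
    independent  : ∀ F → Face Δ F → AffinelyIndependent v F
    intersection : ∀ F G → Face Δ F → Face Δ G →
                   ∀ x → conv v F x → conv v G x → conv v (F ∩ G) x

-- The existential in `covers` is classical: constructively, a point of a
-- simplex cannot be assigned to a cell of a subdivision by a function.
record Subdivides {n′ n N} (Δ′ : SimplicialComplex n′) (v′ : Fin n′ → Point N)
                  (Δ : SimplicialComplex n) (v : Fin n → Point N) : Set where
  field
    refines : ∀ G → Face Δ′ G → ∃[ F ] Face Δ F × conv v′ G ⊆ᵖ conv v F
    covers  : ∀ F → Face Δ F → ∀ x → conv v F x →
              ¬ ¬ (∃[ G ] Face Δ′ G × conv v′ G x)

record Triangulation {n} (Δ : SimplicialComplex n) : Set₁ where
  field
    {vertices′} : ℕ
    Δ′          : SimplicialComplex vertices′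
    {N}         : ℕ
    position    : Fin n → Point N
    position′   : Fin vertices′ → Point N
    realizes    : IsRealization Δ position
    realizes′   : IsRealization Δ′ position′
    subdivides  : Subdivides Δ′ position′ Δ position

  Restriction : Subset n → Pred (Subset vertices′) 0ℓ
  Restriction F G = Face Δ′ G × conv position′ G ⊆ᵖ conv position F

------------------------------------------------------------------------
-- Uniform subdivisions

-- An array 𝓕 i j of which only the entries with i ≤ j ≤ d are relevant.
IsUniform : ∀ {n} {Δ : SimplicialComplex n} →
            (d : ℕ) → (ℕ → ℕ → ℕ) → Triangulation Δ → Set
IsUniform {Δ = Δ} d 𝓕 T = ∀ i j → i ℕ.≤ j → j ℕ.≤ d →
  ∀ F → Face Δ F → card F ≡ j →
  HasSize (λ G → Triangulation.Restriction T F G × card G ≡ i) (𝓕 i j)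

IsUniformSubdivision : (d : ℕ) → (ℕ → ℕ → ℕ) → Set₁
IsUniformSubdivision d 𝓕 =
  ∃[ n ] Σ[ Δ ∈ SimplicialComplex n ] HasDimensionPred Δ d ×
  Σ[ T ∈ Triangulation Δ ] IsUniform d 𝓕 T

------------------------------------------------------------------------
-- The transformation matrix

open CommutativeMonoidSum ℤ-+-0-commutativeMonoid public using (sum⁺-syntax)

Matrix : ℕ → Set
Matrix d = Fin (suc d) → Fin (suc d) → ℤ

infixl 7 _·_

_·_ : ∀ {d} → Matrix d → Matrix d → Matrix d
_·_ {d} A B i j = ∑[ k ≤ d ] (A i k *ᶻ B k j)

extend : (ℕ → ℕ → ℕ) → ℕ → ℕ → ℕ
extend 𝓕 i k = if i ≤ᵇ k then 𝓕 i k else 0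

-- Entry (i , j) counts, by inclusion-exclusion, the faces with i vertices that
-- subdivide a face with j vertices and lie in none of its proper faces; so this
-- matrix sends the face numbers of Δ to those of a uniform triangulation of Δ.
fMatrix : ∀ d → (ℕ → ℕ → ℕ) → Matrix d
fMatrix d 𝓕 i j = ∑[ k ≤ toℕ j ]
  (-1ℤ ^ᶻ (toℕ j ∸ toℕ k) *ᶻ + (toℕ j C toℕ k) *ᶻ + extend 𝓕 (toℕ i) (toℕ k))

-- Column j holds the coefficients of x ^ j * (1 - x) ^ (d - j), so this
-- matrix sends (f₋₁, …, f_{d-1}) to (h₀, …, h_d).
f→h : ∀ d → Matrix d
f→h d i j = if toℕ j ≤ᵇ toℕ i
  then -1ℤ ^ᶻ (toℕ i ∸ toℕ j) *ᶻ + ((d ∸ toℕ j) C (toℕ i ∸ toℕ j))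
  else 0ℤ

-- The inverse of f→h: substituting x / (1 + x) for x in the relation that
-- defines the h-vector gives
--   ∑ f_{i-1} * x ^ i = ∑ h_j * x ^ j * (1 + x) ^ (d - j).
h→f : ∀ d → Matrix d
h→f d i j = if toℕ j ≤ᵇ toℕ i
  then + ((d ∸ toℕ j) C (toℕ i ∸ toℕ j))
  else 0ℤ

transformationMatrix : ∀ d → (ℕ → ℕ → ℕ) → Matrix d
transformationMatrix d 𝓕 = f→h d · fMatrix d 𝓕 · h→f d

IsTP₂ : ∀ {d} → Matrix d → Set
IsTP₂ H =
  (∀ i j → 0ℤ ≤ᶻ H i j) ×
  (∀ i i′ j j′ → toℕ i ℕ.< toℕ i′ → toℕ j ℕ.< toℕ j′ →
     0ℤ ≤ᶻ H i j *ᶻ H i′ j′ -ᶻ H i j′ *ᶻ H i′ j)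

------------------------------------------------------------------------
-- Real-rooted polynomials and interlacing

-- A polynomial is given by its sequence of coefficients.
Coefficients : Set
Coefficients = ℕ → ℝ

infix 4 _≋_ _⪯_

_≋_ : Coefficients → Coefficients → Set
p ≋ q = ∀ k → p k ≈ q k

polynomial : ∀ {n} → Vector ℝ n → Coefficients
polynomial {zero}  a k       = 0ℝ
polynomial {suc n} a zero    = a zero
polynomial {suc n} a (suc k) = polynomial (tail a) k

[X-_]*_ : ℝ → Coefficients → Coefficients
([X- r ]* p) zero    = - (r * p zero)
([X- r ]* p) (suc k) = p k + - (r * p (suc k))

∏[X-_] : ∀ {m} → Vector ℝ m → Coefficients
∏[X-_] {zero}  r zero    = 1ℝ
∏[X-_] {zero}  r (suc k) = 0ℝ
∏[X-_] {suc m} r         = [X- r zero ]* ∏[X- tail r ]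

IsZero : Coefficients → Set
IsZero p = ∀ k → p k ≈ 0ℝ

-- A non-zero real-rooted polynomial with positive leading coefficient,
-- its zeros listed with multiplicity in non-increasing order.
record RealRooted⁺ (p : Coefficients) : Set where
  field
    degree         : ℕ
    leading        : ℝ
    leading>0      : 0ℝ < leading
    zeros          : Vector ℝ degree
    non-increasing : ∀ i j → toℕ i ℕ.≤ toℕ j → zeros j ≤ zeros i
    factorization  : p ≋ (λ k → leading * ∏[X- zeros ] k)

open RealRooted⁺ public using (degree; zeros)

-- … ≤ r₂ ≤ s₂ ≤ r₁ ≤ s₁, where r has as many terms as s or one fewer.
Alternate : ∀ {m n} → Vector ℝ m → Vector ℝ n → Set
Alternate {m} {n} r s =
  (n ≡ m ⊎ n ≡ suc m) ×
  (∀ i j → toℕ i ≡ toℕ j → r i ≤ s j) ×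
  (∀ i j → toℕ j ≡ suc (toℕ i) → s j ≤ r i)

data _⪯_ (f g : Coefficients) : Set where
  zeroˡ     : IsZero f → IsZero g ⊎ RealRooted⁺ g → f ⪯ g
  zeroʳ     : IsZero f ⊎ RealRooted⁺ f → IsZero g → f ⪯ g
  interlace : (F : RealRooted⁺ f) (G : RealRooted⁺ g) →
              Alternate (zeros F) (zeros G) → f ⪯ g

IsInterlacing : ∀ {n} → Vector Coefficients n → Set
IsInterlacing f =
  (∀ i → IsZero (f i) ⊎ RealRooted⁺ (f i)) ×
  (∀ i j → toℕ i ℕ.< toℕ j → f i ⪯ f j)

columnPolynomial : ∀ {d} → Matrix d → Fin (suc d) → Coefficients
columnPolynomial H k = polynomial (λ i → fromℤ (H i k))

HasInterlacingProperty : ∀ d → (ℕ → ℕ → ℕ) → Set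
HasInterlacingProperty d 𝓕 = IsInterlacing (columnPolynomial (transformationMatrix d 𝓕))

-- The entries of H are non-negative for every uniform subdivision. Let F be a
-- face with d vertices, S ⊆ F with |S| = k, and let q be a generic vector with
-- negative coordinates on S and positive ones on F ∖ S. The cells τ of the
-- subdivision of F that lie in no facet F ∖ s with s ∈ S have h-polynomial
-- P_{d,k}. Moving from the interior of τ slightly towards q enters a unique cell
-- σ with d vertices, and τ is assigned to σ iff R(σ) ⊆ τ ⊆ σ, where R(σ) consists
-- of the vertices of σ at which q has a negative coordinate. Each interval
-- [R(σ), σ] contributes x^|R(σ)|, so p_d(i,k) = #{σ : |R(σ)| = i}.
--
-- Hence real-rooted columns have no positive zeros, and f ⪯ g are, up to positive
-- factors, products of X + ρᵢ and X + σᵢ with ρᵢ ≥ σᵢ ≥ 0. The minors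
-- fᵢ gⱼ - fⱼ gᵢ are then non-negative by induction on the number of zeros.
--
-- Real numbers are used constructively; this costs nothing, as the entries of H
-- are integers, so that the argument may take place under a double negation.
module Submission where

open import Defs using (extend; fMatrix; f→h; h→f; transformationMatrix; HasSize)
import Algebra.Properties.CommutativeMonoid.Sum as CommutativeMonoidSum
import Algebra.Properties.Group as GroupProperties
import Algebra.Properties.Ring as RingProperties
import Algebra.Properties.Semiring.Sum as SemiringSum
import Algebra.Solver.Ring as RingSolver
open import Algebra.Bundles using (CommutativeRing)
open import Algebra.Solver.Ring.AlmostCommutativeRing using (fromCommutativeRing; _-Raw-AlmostCommutative⟶_)
open import Data.Bool.Base using (if_then_else_; true; false)
import Data.Bool.Properties as Bool
open import Data.Empty using (⊥; ⊥-elim)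
open import Data.Fin.Base using (Fin; zero; suc; toℕ; splitAt; _↑ˡ_; _↑ʳ_)
open import Data.Fin.Properties using (_≟_; all?; splitAt-↑ˡ; splitAt-↑ʳ; toℕ<n)
open import Data.Fin.Subset using (Subset; inside; outside; _∈_; _∉_; _⊆_; _∩_; ⁅_⁆)
  renaming (∣_∣ to card; _-_ to _∖_)
open import Data.Fin.Subset.Properties using
  (_∈?_; _⊆?_; ⊆-refl; ⊆-antisym; drop-∷-⊆; out⊆; in⊆in; p⊆q⇒∣p∣≤∣q∣; p⊂q⇒∣p∣<∣q∣; p∩q⊆p; p∩q⊆q;
   x∈p∩q⁺; x∈p∩q⁻; x∈⁅x⁆; x∈⁅y⁆⇒x≡y; p─⊥≡p; p─q⊆p; x∈p∧x≢y⇒x∈p-y; x∈p⇒∣p-x∣<∣p∣)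
open import Data.Integer.Base as ℤ using (ℤ; +_; 0ℤ; 1ℤ; -1ℤ)
import Data.Integer.Properties as ℤ
open import Data.Integer.Tactic.RingSolver using (solve-∀)
open import Data.List.Base using (_∷_; length)
import Data.List.Membership.DecPropositional as DecMembership
import Data.List.Membership.Propositional as List
open import Data.List.Relation.Unary.All as All using ()
open import Data.List.Relation.Unary.Any using (here; there)
open import Data.List.Relation.Unary.AllPairs using ([]; _∷_)
open import Data.List.Relation.Unary.Unique.Propositional using (Unique)
import Data.Maybe.Base as Maybe
open import Data.Nat.Base as ℕ using (ℕ; zero; suc; _∸_; _≤ᵇ_)
open import Data.Nat.Combinatorics using (_C_; nCn≡1; nCk≡nC[n∸k]; nCk+nC[k+1]≡[n+1]C[k+1]; k>n⇒nCk≡0)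
import Data.Nat.Coprimality as Coprimality
import Data.Nat.Properties as ℕ
open import Data.Product.Base using (∃-syntax; Σ-syntax; _×_; _,_; proj₁; proj₂)
open import Data.Rational.Base as ℚ using (ℚ; 0ℚ; 1ℚ; ½)
import Data.Rational.Properties as ℚ
import Data.Rational.Solver as ℚSolver
open import Data.Sum.Base using (_⊎_; inj₁; inj₂; [_,_]′)
open import Data.Vec.Base using ([]; _∷_; here; there)
import Data.Vec.Properties as Vec
open import Function.Base using (_∘_; case_of_; id)
open import Function.Bundles using (Equivalence)
open import Level using (0ℓ)
open import Relation.Binary.Definitions using (DecidableEquality; WeaklyDecidable)
open import Relation.Binary.PropositionalEquality as ≡
  using (_≡_; _≢_; refl; sym; trans; cong; cong₂; subst; subst₂; module ≡-Reasoning)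
import Relation.Binary.Reasoning.Setoid as SetoidReasoning
open import Relation.Nullary using (¬_; Dec; yes; no)
open import Relation.Nullary.Decidable using (_×-dec_; _→-dec_; ¬?)
open import Relation.Nullary.Decidable.Core using (dec⇒maybe; decidable-stable; ¬¬-excluded-middle)
open import Relation.Unary using () renaming (_⊆_ to _⊆ᵖ_)

-- The double negation monad

-- Matrix and geometry meet in a difference operator. Multiplying the inclusion-exclusion matrix by
-- column `k` of `h→f` turns row `l` into the `k`-th forward difference of `j ↦ extend 𝓕 l j` at
-- `d - k`; removing `k` facets of `F` one after the other takes the same difference of the number
-- of cells with `l` vertices. Uniformity is used for one face `F` and its subfaces.
--
-- The geometry takes place in barycentric coordinates of `F`, in the cone over the triangulation.
-- There affine independence becomes linear independence, and `q` can be any vector, with no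
-- condition on its coordinate sum. "Slightly towards `q`" is a limit; since there are finitely many
-- cells, some cell is met at arbitrarily small steps, and two such steps already determine the
-- coordinates of `q` in it.
--
-- No real number is ever inverted: elimination is fraction-free, and a point of the cone is
-- rescaled to the simplex only when its coordinate sum is rational. This is why `q` is rational and
-- why the sums `ι r` appear in the axioms of the cone.

infixl 1 _>>=_ _>>_

return : ∀ {a} {A : Set a} → A → ¬ ¬ A
return a ¬a = ¬a a

_>>=_ : ∀ {a b} {A : Set a} {B : Set b} → ¬ ¬ A → (A → ¬ ¬ B) → ¬ ¬ B
(¬¬a >>= f) ¬b = ¬¬a (λ a → f a ¬b)

_>>_ : ∀ {a b} {A : Set a} {B : Set b} → ¬ ¬ A → ¬ ¬ B → ¬ ¬ B
¬¬a >> ¬¬b = ¬¬a >>= λ _ → ¬¬b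

¬¬⊥-elim : ¬ ¬ ⊥ → ⊥
¬¬⊥-elim ¬¬⊥ = ¬¬⊥ λ ()

-- Double-negation shift holds over a finite index set. Through it, undecidable properties of all
-- vertices or all faces are settled at once under a single double negation.
¬¬-Fin : ∀ {n p} {P : Fin n → Set p} → (∀ i → ¬ ¬ P i) → ¬ ¬ (∀ i → P i)
¬¬-Fin {zero}  h = return λ ()
¬¬-Fin {suc n} h = do
  p₀ ← h zero
  pₛ ← ¬¬-Fin (λ i → h (suc i))
  return λ { zero → p₀ ; (suc i) → pₛ i }

subsets : ∀ n → ∃[ k ] Σ[ e ∈ (Fin k → Subset n) ] (∀ S → ∃[ i ] e i ≡ S)
subsets zero = 1 , (λ _ → []) , λ { [] → zero , refl }
subsets (suc n) =
  let k , e , e-surjective = subsets n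
      f : Fin k ⊎ Fin k → Subset (suc n)
      f = [ (λ i → inside ∷ e i) , (λ i → outside ∷ e i) ]′
  in k ℕ.+ k , f ∘ splitAt k , λ
    { (inside ∷ S)  → let i , eq = e-surjective S
                      in i ↑ˡ k , trans (cong f (splitAt-↑ˡ k i k)) (cong (inside ∷_) eq)
    ; (outside ∷ S) → let i , eq = e-surjective S
                      in k ↑ʳ i , trans (cong f (splitAt-↑ʳ k k i)) (cong (outside ∷_) eq) }

¬¬-Subset : ∀ {n p} {P : Subset n → Set p} → (∀ S → ¬ ¬ P S) → ¬ ¬ (∀ S → P S)
¬¬-Subset {n} {P = P} h = do
  let _ , e , e-surjective = subsets n
  p ← ¬¬-Fin (λ i → h (e i))
  return λ S → let i , eq = e-surjective S in subst P eq (p i)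

-- The real numbers enter the geometry only through this structure; its order
-- is opaque to unification, unlike the one on ℝ.
record ArchimedeanRing : Set₁ where
  field
    commutativeRing : CommutativeRing 0ℓ 0ℓ
  module R = CommutativeRing commutativeRing
  infix 4 _≲_
  field
    _≲_        : R.Carrier → R.Carrier → Set
    antisym    : ∀ {x y} → x ≲ y → y ≲ x → x R.≈ y
    reflexive  : ∀ {x y} → x R.≈ y → x ≲ y
    transitive : ∀ {x y z} → x ≲ y → y ≲ z → x ≲ z
    +-mono     : ∀ {x y u v} → x ≲ y → u ≲ v → x R.+ u ≲ y R.+ v
    *-mono     : ∀ {x y} → R.0# ≲ x → R.0# ≲ y → R.0# ≲ x R.* y
    -- Here and below, `¬ x ≲ 0` stands for strict positivity of `x`.
    *-strict   : ∀ {x y} → ¬ x ≲ R.0# → ¬ y ≲ R.0# → ¬ x R.* y ≲ R.0#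
    total      : ∀ {x y} → ¬ x ≲ y → y ≲ x
    stable     : ∀ {x y} → ¬ ¬ x ≲ y → x ≲ y
    ι          : ℚ → R.Carrier
    ι-+        : ∀ p q → ι (p ℚ.+ q) R.≈ ι p R.+ ι q
    ι-*        : ∀ p q → ι (p ℚ.* q) R.≈ ι p R.* ι q
    ι-neg      : ∀ p → ι (ℚ.- p) R.≈ R.- ι p
    ι-0        : ι 0ℚ R.≈ R.0#
    ι-1        : ι 1ℚ R.≈ R.1#
    ι-mono     : ∀ {p q} → p ℚ.≤ q → ι p ≲ ι q
    ι-reflect  : ∀ {p q} → ι p ≲ ι q → p ℚ.≤ q
    -- `bound` is the Archimedean property, and `limit` says that the half-line of non-negative
    -- elements is closed under rational approximation.
    bound      : ∀ x → ∃[ B ] 0ℚ ℚ.< B × (x ≲ ι B) × (R.- ι B ≲ x)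
    limit      : ∀ {x} → (∀ ε → 0ℚ ℚ.< ε → R.- ι ε ≲ x) → R.0# ≲ x

-- Subsets

x∉p∖x : ∀ {n} (p : Subset n) x → x ∉ p ∖ x
x∉p∖x (inside  ∷ p) zero    ()
x∉p∖x (outside ∷ p) zero    ()
x∉p∖x (_ ∷ p)       (suc x) (there x∈) = x∉p∖x p x x∈

∖-⊆ : ∀ {n} (p : Subset n) x → p ∖ x ⊆ p
∖-⊆ p x = p─q⊆p p ⁅ x ⁆

card-∖ : ∀ {n} (p : Subset n) {x} → x ∈ p → suc (card (p ∖ x)) ≡ card p
card-∖ (inside ∷ p)  here       = cong (suc ∘ card) (p─⊥≡p p)
card-∖ (inside ∷ p)  (there x∈) = cong suc (card-∖ p x∈)
card-∖ (outside ∷ p) (there x∈) = card-∖ p x∈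

element : ∀ {n} (p : Subset n) → Fin (card p) → Fin n
element (inside ∷ p)  zero    = zero
element (inside ∷ p)  (suc i) = suc (element p i)
element (outside ∷ p) i       = suc (element p i)

element-∈ : ∀ {n} (p : Subset n) i → element p i ∈ p
element-∈ (inside ∷ p)  zero    = here
element-∈ (inside ∷ p)  (suc i) = there (element-∈ p i)
element-∈ (outside ∷ p) i       = there (element-∈ p i)

element-surjective : ∀ {n} (p : Subset n) {x} → x ∈ p → ∃[ i ] element p i ≡ x
element-surjective (inside ∷ p)  here       = zero , refl
element-surjective (inside ∷ p)  (there x∈) = let i , eq = element-surjective p x∈ in suc i , cong suc eq
element-surjective (outside ∷ p) (there x∈) = let i , eq = element-surjective p x∈ in i , cong suc eq

card>0⇒∃∈ : ∀ {n} (p : Subset n) → 0 ℕ.< card p → ∃[ x ] x ∈ p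
card>0⇒∃∈ (inside ∷ p)  _ = zero , here
card>0⇒∃∈ (outside ∷ p) h = let x , x∈ = card>0⇒∃∈ p h in suc x , there x∈

-- Signs, sums and linear algebra over an Archimedean ring

module OrderedAlgebra (K : ArchimedeanRing) where

  open ArchimedeanRing K public using (commutativeRing; _≲_; antisym; reflexive; transitive; +-mono;
    *-mono; *-strict; total; stable; ι; ι-+; ι-*; ι-neg; ι-0; ι-1; ι-mono; ι-reflect; bound; limit)
  open CommutativeRing commutativeRing public
    using (Carrier; _≈_; _+_; _*_; -_; 0#; 1#; +-cong; +-congˡ; +-congʳ; *-cong; *-congˡ; *-congʳ; -‿cong; setoid;
           +-identityˡ; +-identityʳ; *-identityˡ; *-identityʳ; zeroˡ; zeroʳ; *-comm; *-assoc; distribˡ; distribʳ)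
    renaming (refl to ≈-refl; sym to ≈-sym; trans to ≈-trans)
  private module R = CommutativeRing commutativeRing
  open SemiringSum R.semiring public using (sum; *-distribˡ-sum; *-distribʳ-sum; sum-cong-≋; sum-replicate-zero)
  open CommutativeMonoidSum R.+-commutativeMonoid public using (∑-distrib-+; ∑-comm)
  module ≈-Reasoning = SetoidReasoning setoid

  private
    ι-morphism : ℚ.+-*-rawRing -Raw-AlmostCommutative⟶ fromCommutativeRing commutativeRing
    ι-morphism = record { ⟦_⟧ = ι ; +-homo = ι-+ ; *-homo = ι-* ; -‿homo = ι-neg ; 0-homo = ι-0 ; 1-homo = ι-1 }

    ι-≟ : WeaklyDecidable (λ p q → ι p ≈ ι q)
    ι-≟ p q = Maybe.map (R.reflexive ∘ cong ι) (dec⇒maybe (p ℚ.≟ q))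

  open RingSolver ℚ.+-*-rawRing (fromCommutativeRing commutativeRing) ι-morphism ι-≟
    public using (solve; _:+_; _:*_; _:-_; :-_; _:=_; con)

  ≲-refl : ∀ {x} → x ≲ x
  ≲-refl = reflexive ≈-refl

  ≲-resp : ∀ {x x′ y y′} → x ≈ x′ → y ≈ y′ → x ≲ y → x′ ≲ y′
  ≲-resp x≈x′ y≈y′ x≲y = transitive (reflexive (≈-sym x≈x′)) (transitive x≲y (reflexive y≈y′))

  0≲-resp : ∀ {x y} → x ≈ y → 0# ≲ x → 0# ≲ y
  0≲-resp = ≲-resp ≈-refl

  ≈-stable : ∀ {x y} → ¬ ¬ x ≈ y → x ≈ y
  ≈-stable h = antisym (stable (λ k → h (k ∘ reflexive))) (stable (λ k → h (k ∘ reflexive ∘ ≈-sym)))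

  x≲y⇒0≲y-x : ∀ {x y} → x ≲ y → 0# ≲ y + - x
  x≲y⇒0≲y-x {x} x≲y = transitive (reflexive (≈-sym (R.-‿inverseʳ x))) (+-mono x≲y ≲-refl)

  0≲y-x⇒x≲y : ∀ {x y} → 0# ≲ y + - x → x ≲ y
  0≲y-x⇒x≲y {x} {y} h = ≲-resp (+-identityˡ x)
    (solve 2 (λ x y → (y :+ :- x) :+ x := y) ≈-refl x y) (+-mono h (≲-refl {x}))

  -‿anti : ∀ {x y} → x ≲ y → - y ≲ - x
  -‿anti {x} {y} x≲y = 0≲y-x⇒x≲y
    (0≲-resp (solve 2 (λ x y → y :+ :- x := :- x :+ :- :- y) ≈-refl x y) (x≲y⇒0≲y-x x≲y))

  -0≈0 : - 0# ≈ 0#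
  -0≈0 = RingProperties.-0#≈0# R.ring

  x≲0⇒0≲-x : ∀ {x} → x ≲ 0# → 0# ≲ - x
  x≲0⇒0≲-x = ≲-resp -0≈0 ≈-refl ∘ -‿anti

  0≲-x⇒x≲0 : ∀ {x} → 0# ≲ - x → x ≲ 0#
  0≲-x⇒x≲0 {x} h = 0≲y-x⇒x≲y (0≲-resp (≈-sym (+-identityˡ (- x))) h)

  x-y≈0⇒x≈y : ∀ {x y} → x + - y ≈ 0# → x ≈ y
  x-y≈0⇒x≈y {x} {y} = RingProperties.x∙y⁻¹≈ε⇒x≈y R.ring x y

  x≈y⇒x-y≈0 : ∀ {x y} → x ≈ y → x + - y ≈ 0#
  x≈y⇒x-y≈0 = RingProperties.x≈y⇒x∙y⁻¹≈ε R.ring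

  x≉0⇒0<x⊎0<-x : ∀ {x} → ¬ x ≈ 0# → ¬ ¬ (¬ x ≲ 0# ⊎ ¬ - x ≲ 0#)
  x≉0⇒0<x⊎0<-x {x} x≉0 k = k (inj₁ λ x≲0 → k (inj₂ λ -x≲0 →
    x≉0 (antisym x≲0 (≲-resp -0≈0 (solve 1 (λ x → :- :- x := x) ≈-refl x) (-‿anti -x≲0)))))

  -- Under a double negation each non-zero factor has a sign, and `*-strict` settles each of the
  -- four sign patterns.
  *-nonzero : ∀ {x y} → ¬ x ≈ 0# → ¬ y ≈ 0# → ¬ x * y ≈ 0#
  *-nonzero {x} {y} x≉0 y≉0 xy≈0 = ¬¬⊥-elim do
    sx ← x≉0⇒0<x⊎0<-x x≉0
    sy ← x≉0⇒0<x⊎0<-x y≉0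
    return (by-signs sx sy)
    where
    -xy≈0 : - (x * y) ≈ 0#
    -xy≈0 = ≈-trans (-‿cong xy≈0) -0≈0
    by-signs : ¬ x ≲ 0# ⊎ ¬ - x ≲ 0# → ¬ y ≲ 0# ⊎ ¬ - y ≲ 0# → ⊥
    by-signs (inj₁ p) (inj₁ q) = *-strict p q (reflexive xy≈0)
    by-signs (inj₁ p) (inj₂ q) = *-strict p q (reflexive (≈-trans
      (solve 2 (λ x y → x :* :- y := :- (x :* y)) ≈-refl x y) -xy≈0))
    by-signs (inj₂ p) (inj₁ q) = *-strict p q (reflexive (≈-trans
      (solve 2 (λ x y → :- x :* y := :- (x :* y)) ≈-refl x y) -xy≈0))
    by-signs (inj₂ p) (inj₂ q) = *-strict p q (reflexive (≈-trans
      (solve 2 (λ x y → :- x :* :- y := x :* y) ≈-refl x y) xy≈0))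

  *-cancel-0 : ∀ {x y} → ¬ x ≈ 0# → x * y ≈ 0# → y ≈ 0#
  *-cancel-0 x≉0 xy≈0 = ≈-stable λ y≉0 → *-nonzero x≉0 y≉0 xy≈0

  *-cancel-nonneg : ∀ {x y} → ¬ x ≲ 0# → 0# ≲ x * y → 0# ≲ y
  *-cancel-nonneg {x} {y} x≰0 0≲xy = stable λ 0≴y → *-strict x≰0
    (λ -y≲0 → 0≴y (0≲-resp (solve 1 (λ y → :- :- y := y) ≈-refl y) (x≲0⇒0≲-x -y≲0)))
    (≲-resp (solve 2 (λ x y → :- (x :* y) := x :* :- y) ≈-refl x y) -0≈0 (-‿anti 0≲xy))

  ι-positive : ∀ {p} → 0ℚ ℚ.< p → ¬ ι p ≲ 0#
  ι-positive 0<p ιp≲0 = ℚ.<-irrefl refl (ℚ.<-≤-trans 0<p (ι-reflect (transitive ιp≲0 (reflexive (≈-sym ι-0)))))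

  1≰0 : ¬ 1# ≲ 0#
  1≰0 h = ι-positive (ℚ.positive⁻¹ 1ℚ) (≲-resp (≈-sym ι-1) ≈-refl h)

  +-nonneg : ∀ {x y} → 0# ≲ x → 0# ≲ y → 0# ≲ x + y
  +-nonneg p q = ≲-resp (+-identityˡ 0#) ≈-refl (+-mono p q)

  ι-nonneg : ∀ {p} → 0ℚ ℚ.≤ p → 0# ≲ ι p
  ι-nonneg 0≤p = ≲-resp ι-0 ≈-refl (ι-mono 0≤p)

  ι-nonzero : ∀ {p} → p ≢ 0ℚ → ¬ ι p ≈ 0#
  ι-nonzero p≢0 ιp≈0 = p≢0 (ℚ.≤-antisym (ι-reflect (reflexive (≈-trans ιp≈0 (≈-sym ι-0))))
                                         (ι-reflect (reflexive (≈-trans ι-0 (≈-sym ιp≈0)))))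

  -- Finite sums

  infix 8 _∙_

  _∙_ : ∀ {n} → (Fin n → Carrier) → (Fin n → Carrier) → Carrier
  w ∙ f = sum (λ u → w u * f u)

  ∙-cong : ∀ {n} {w w′ f f′ : Fin n → Carrier} → (∀ u → w u ≈ w′ u) → (∀ u → f u ≈ f′ u) → w ∙ f ≈ w′ ∙ f′
  ∙-cong p q = sum-cong-≋ (λ u → *-cong (p u) (q u))

  ∙-congʳ : ∀ {n} {w w′ f : Fin n → Carrier} → (∀ u → w u ≈ w′ u) → w ∙ f ≈ w′ ∙ f
  ∙-congʳ p = ∙-cong p (λ _ → ≈-refl)

  ∙-comm : ∀ {n} (w f : Fin n → Carrier) → w ∙ f ≈ f ∙ w
  ∙-comm w f = sum-cong-≋ (λ u → *-comm (w u) (f u))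

  ∙-+ˡ : ∀ {n} (v w f : Fin n → Carrier) → (λ u → v u + w u) ∙ f ≈ v ∙ f + w ∙ f
  ∙-+ˡ v w f = ≈-trans (sum-cong-≋ (λ u → distribʳ (f u) (v u) (w u)))
    (∑-distrib-+ (λ u → v u * f u) (λ u → w u * f u))

  ∙-*ˡ : ∀ {n} c (w f : Fin n → Carrier) → (λ u → c * w u) ∙ f ≈ c * w ∙ f
  ∙-*ˡ c w f = ≈-trans (sum-cong-≋ (λ u → *-assoc c (w u) (f u)))
    (≈-sym (*-distribˡ-sum c (λ u → w u * f u)))

  ∙-+ʳ : ∀ {n} (w f g : Fin n → Carrier) → w ∙ (λ u → f u + g u) ≈ w ∙ f + w ∙ g
  ∙-+ʳ w f g = ≈-trans (∙-comm w _) (≈-trans (∙-+ˡ f g w) (+-cong (∙-comm f w) (∙-comm g w)))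

  ∙-*ʳ : ∀ {n} c (w f : Fin n → Carrier) → w ∙ (λ u → c * f u) ≈ c * w ∙ f
  ∙-*ʳ c w f = ≈-trans (∙-comm w _) (≈-trans (∙-*ˡ c f w) (*-congˡ (∙-comm f w)))

  ∙-negˡ : ∀ {n} (w f : Fin n → Carrier) → (λ u → - w u) ∙ f ≈ - (w ∙ f)
  ∙-negˡ w f = begin
    (λ u → - w u) ∙ f             ≈⟨ ∙-congʳ (λ u → ≈-sym (RingProperties.-1*x≈-x R.ring (w u))) ⟩
    (λ u → - 1# * w u) ∙ f        ≈⟨ ∙-*ˡ (- 1#) w f ⟩
    - 1# * w ∙ f                  ≈⟨ RingProperties.-1*x≈-x R.ring (w ∙ f) ⟩
    - (w ∙ f)                     ∎
    where open ≈-Reasoning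

  ∙-minusˡ : ∀ {n} (v w f : Fin n → Carrier) → (λ u → v u + - w u) ∙ f ≈ v ∙ f + - (w ∙ f)
  ∙-minusˡ v w f = ≈-trans (∙-+ˡ v (λ u → - w u) f) (+-congˡ (∙-negˡ w f))

  sum-zero : ∀ {n} {f : Fin n → Carrier} → (∀ u → f u ≈ 0#) → sum f ≈ 0#
  sum-zero {n} h = ≈-trans (sum-cong-≋ h) (sum-replicate-zero n)

  ∙-swap : ∀ {m n} (w : Fin m → Carrier) (b : Fin m → Fin n → Carrier) (z : Fin n → Carrier) →
           w ∙ (λ u → b u ∙ z) ≈ (λ j → w ∙ (λ u → b u j)) ∙ z
  ∙-swap {m} {n} w b z = begin
    sum (λ u → w u * sum (λ j → b u j * z j))    ≈⟨ sum-cong-≋ (λ u → *-distribˡ-sum (w u) (λ j → b u j * z j)) ⟩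
    sum (λ u → sum (λ j → w u * (b u j * z j)))  ≈⟨ ∑-comm (λ u j → w u * (b u j * z j)) ⟩
    sum (λ j → sum (λ u → w u * (b u j * z j)))  ≈⟨ sum-cong-≋ (λ j → sum-cong-≋ (λ u → ≈-sym (*-assoc (w u) (b u j) (z j)))) ⟩
    sum (λ j → sum (λ u → w u * b u j * z j))    ≈⟨ sum-cong-≋ (λ j → ≈-sym (*-distribʳ-sum (z j) (λ u → w u * b u j))) ⟩
    sum (λ j → sum (λ u → w u * b u j) * z j)    ∎
    where open ≈-Reasoning

  δ : ∀ {n} → Fin n → Fin n → Carrier
  δ zero    zero    = 1#
  δ zero    (suc _) = 0#
  δ (suc _) zero    = 0#
  δ (suc p) (suc u) = δ p u

  δ-diagonal : ∀ {n} (p : Fin n) → δ p p ≈ 1#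
  δ-diagonal zero    = ≈-refl
  δ-diagonal (suc p) = δ-diagonal p

  δ-off-diagonal : ∀ {n} (p u : Fin n) → p ≢ u → δ p u ≈ 0#
  δ-off-diagonal zero    zero    p≢u = ⊥-elim (p≢u refl)
  δ-off-diagonal zero    (suc u) p≢u = ≈-refl
  δ-off-diagonal (suc p) zero    p≢u = ≈-refl
  δ-off-diagonal (suc p) (suc u) p≢u = δ-off-diagonal p u (p≢u ∘ cong suc)

  δ-∙ : ∀ {n} (p : Fin n) f → δ p ∙ f ≈ f p
  δ-∙ zero f = ≈-trans (+-cong (*-identityˡ (f zero)) (sum-zero (λ u → zeroˡ (f (suc u))))) (+-identityʳ (f zero))
  δ-∙ (suc p) f = ≈-trans (+-cong (zeroˡ (f zero)) (δ-∙ p (f ∘ suc))) (+-identityˡ (f (suc p)))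

  δ-nonneg : ∀ {n} (p u : Fin n) → 0# ≲ δ p u
  δ-nonneg zero    zero    = total 1≰0
  δ-nonneg zero    (suc _) = ≲-refl
  δ-nonneg (suc _) zero    = ≲-refl
  δ-nonneg (suc p) (suc u) = δ-nonneg p u

  sum-nonneg : ∀ {n} {f : Fin n → Carrier} → (∀ u → 0# ≲ f u) → 0# ≲ sum f
  sum-nonneg {zero}  h = ≲-refl
  sum-nonneg {suc n} h = +-nonneg (h zero) (sum-nonneg (h ∘ suc))

  sum-nonneg-zero : ∀ {n} {f : Fin n → Carrier} → (∀ u → 0# ≲ f u) → sum f ≈ 0# → ∀ u → f u ≈ 0#
  sum-nonneg-zero {suc n} {f} h f₀+∑≈0 = λ { zero → f₀≈0 ; (suc u) → sum-nonneg-zero (h ∘ suc) ∑≈0 u }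
    where
    f₀≈0 : f zero ≈ 0#
    f₀≈0 = antisym (≲-resp (+-identityʳ _) f₀+∑≈0 (+-mono (≲-refl {f zero}) (sum-nonneg (h ∘ suc)))) (h zero)
    ∑≈0 : sum (f ∘ suc) ≈ 0#
    ∑≈0 = ≈-trans (≈-trans (≈-sym (+-identityˡ _)) (+-congʳ (≈-sym f₀≈0))) f₀+∑≈0

  SupportedOn : ∀ {n} → (Fin n → Carrier) → Subset n → Set
  SupportedOn w G = ∀ u → u ∉ G → w u ≈ 0#

  ∙-supported : ∀ {n} {w : Fin n → Carrier} {G} → SupportedOn w G → ∀ f g → (∀ u → u ∈ G → f u ≈ g u) → w ∙ f ≈ w ∙ g
  ∙-supported {w = w} {G} supp f g h = sum-cong-≋ λ u → case u ∈? G of λ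
    { (yes u∈G) → *-congˡ (h u u∈G)
    ; (no  u∉G) → ≈-trans (*-congʳ (supp u u∉G)) (≈-trans (zeroˡ (f u))
                    (≈-sym (≈-trans (*-congʳ (supp u u∉G)) (zeroˡ (g u))))) }

  -- Linear algebra

  pivot : ∀ {n} (G : Subset n) (ℓ : Fin n → Carrier) →
          ¬ (∀ u → u ∈ G → ℓ u ≈ 0#) → ¬ ¬ (∃[ p ] p ∈ G × ¬ ℓ p ≈ 0#)
  pivot G ℓ h k = h λ u u∈G → ≈-stable λ ℓu≉0 → k (u , u∈G , ℓu≉0)

  -- Gaussian elimination by induction on the number of equations. An equation vanishing on `G` is
  -- dropped; otherwise a pivot `p` eliminates it from the others at the cost of one element of `G`,
  -- which preserves the strict inequality between equations and unknowns.
  homogeneous-solution : ∀ {k m} (L : Fin k → Fin m → Carrier) (G : Subset m) → k ℕ.< card G →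
    ¬ ¬ (Σ[ w ∈ (Fin m → Carrier) ] SupportedOn w G × ¬ (∀ u → w u ≈ 0#) × (∀ i → w ∙ L i ≈ 0#))
  homogeneous-solution {zero} L G 0<∣G∣ = return
    (δ p , (λ u u∉G → δ-off-diagonal p u λ { refl → u∉G p∈G })
         , (λ h → 1≰0 (reflexive (≈-trans (≈-sym (δ-diagonal p)) (h p))))
         , λ ())
    where
    p = proj₁ (card>0⇒∃∈ G 0<∣G∣)
    p∈G = proj₂ (card>0⇒∃∈ G 0<∣G∣)
  homogeneous-solution {suc k} {m} L G k<∣G∣ = do
    no ℓ≉0 ← ¬¬-excluded-middle {A = ∀ u → u ∈ G → ℓ u ≈ 0#}
      where
      yes ℓ≈0 → do
        w , supp , w≉0 , w∙L ← homogeneous-solution (L ∘ suc) G (ℕ.<-trans (ℕ.n<1+n k) k<∣G∣)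
        return (w , supp , w≉0 , λ { zero → ≈-trans (∙-supported supp ℓ (λ _ → 0#) ℓ≈0) (sum-zero (λ u → zeroʳ (w u)))
                                   ; (suc i) → w∙L i })
    p , p∈G , ℓp≉0 ← pivot G ℓ ℓ≉0
    w , supp , w≉0 , w∙L ← homogeneous-solution (reduce p ∘ L ∘ suc) (G ∖ p)
      (ℕ.s≤s⁻¹ (subst (suc (suc k) ℕ.≤_) (≡.sym (card-∖ G p∈G)) k<∣G∣))
    return (lift p w
      , (λ u u∉G → lift-zero p w u (λ { refl → u∉G p∈G }) (supp u (u∉G ∘ ∖-⊆ G p)))
      , (λ h → w≉0 λ u → case p ≟ u of λ
          { (yes refl) → supp u (x∉p∖x G u)
          ; (no p≢u)   → *-cancel-0 ℓp≉0 (≈-trans (≈-sym (lift-off p w u p≢u)) (h u)) })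
      , λ { zero → lift-ℓ p w ; (suc i) → lift-L p w (L (suc i)) (w∙L i) })
    where
    ℓ = L zero
    -- Cross-multiplication replaces division by the pivot value `ℓ p`. Correspondingly `lift`
    -- scales the reduced solution by `ℓ p` and chooses its coordinate at `p` so that `ℓ` is
    -- annihilated.
    reduce : Fin m → (Fin m → Carrier) → Fin m → Carrier
    reduce p f u = ℓ p * f u + - f p * ℓ u
    lift : Fin m → (Fin m → Carrier) → Fin m → Carrier
    lift p w u = ℓ p * w u + - (w ∙ ℓ) * δ p u
    lift-off : ∀ p w u → p ≢ u → lift p w u ≈ ℓ p * w u
    lift-off p w u p≢u = ≈-trans (+-congˡ (≈-trans (*-congˡ (δ-off-diagonal p u p≢u)) (zeroʳ _))) (+-identityʳ _)
    lift-zero : ∀ p w u → p ≢ u → w u ≈ 0# → lift p w u ≈ 0#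
    lift-zero p w u p≢u wu≈0 = ≈-trans (lift-off p w u p≢u) (≈-trans (*-congˡ wu≈0) (zeroʳ _))
    lift-∙ : ∀ p w f → lift p w ∙ f ≈ ℓ p * w ∙ f + - (w ∙ ℓ) * f p
    lift-∙ p w f = ≈-trans (∙-+ˡ (λ u → ℓ p * w u) (λ u → - (w ∙ ℓ) * δ p u) f)
      (+-cong (∙-*ˡ (ℓ p) w f) (≈-trans (∙-*ˡ (- (w ∙ ℓ)) (δ p) f) (*-congˡ (δ-∙ p f))))
    lift-ℓ : ∀ p w → lift p w ∙ ℓ ≈ 0#
    lift-ℓ p w = ≈-trans (lift-∙ p w ℓ)
      (≈-trans (solve 2 (λ a b → a :* b :+ :- b :* a := con 0ℚ) ≈-refl (ℓ p) (w ∙ ℓ)) ι-0)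
    lift-L : ∀ p w f → w ∙ reduce p f ≈ 0# → lift p w ∙ f ≈ 0#
    lift-L p w f h = begin
      lift p w ∙ f                                               ≈⟨ lift-∙ p w f ⟩
      ℓ p * w ∙ f + - (w ∙ ℓ) * f p                              ≈⟨ +-congˡ (solve 2 (λ a b → :- a :* b := :- b :* a) ≈-refl (w ∙ ℓ) (f p)) ⟩
      ℓ p * w ∙ f + - f p * w ∙ ℓ                                ≈⟨ +-cong (≈-sym (∙-*ʳ (ℓ p) w f)) (≈-sym (∙-*ʳ (- f p) w ℓ)) ⟩
      w ∙ (λ u → ℓ p * f u) + w ∙ (λ u → - f p * ℓ u)            ≈⟨ ≈-sym (∙-+ʳ w (λ u → ℓ p * f u) (λ u → - f p * ℓ u)) ⟩
      w ∙ reduce p f                                             ≈⟨ h ⟩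
      0#                                                         ∎
      where open ≈-Reasoning

  -- At most one N ∈ ℚ has a + N b = 0.
  avoid-root : ∀ a b → ¬ (a ≈ 0# × b ≈ 0#) →
    ¬ ¬ (∃[ N₀ ] 0ℚ ℚ.≤ N₀ × (∀ N → N₀ ℚ.≤ N → ¬ a + ι N * b ≈ 0#))
  avoid-root a b h = do
    yes (M , 0≤M , root) ← ¬¬-excluded-middle {A = ∃[ M ] 0ℚ ℚ.≤ M × a + ι M * b ≈ 0#}
      where no ¬root → return (0ℚ , ℚ.≤-refl , λ N 0≤N root → ¬root (N , 0≤N , root))
    -- A second root beyond `M` would force `b ≈ 0#` and then `a ≈ 0#`.
    return (M ℚ.+ 1ℚ , ℚ.≤-trans 0≤M (ℚ.<⇒≤ (M<M+1 M)) , λ N M+1≤N root′ →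
      let M<N = ℚ.<-≤-trans (M<M+1 M) M+1≤N
          b≈0 = *-cancel-0 (ι-nonzero (λ eq → ℚ.<-irrefl (N-M≡0⇒M≡N M N eq) M<N)) (≈-trans
            (≈-trans (*-congʳ (≈-trans (ι-+ N (ℚ.- M)) (+-congˡ (ι-neg M))))
              (solve 4 (λ a b x y → (x :+ :- y) :* b := (a :+ x :* b) :+ :- (a :+ y :* b)) ≈-refl a b (ι N) (ι M)))
            (x≈y⇒x-y≈0 (≈-trans root′ (≈-sym root))))
      in h (≈-trans (≈-trans (≈-sym (+-identityʳ a)) (+-congˡ (≈-sym (≈-trans (*-congˡ b≈0) (zeroʳ (ι M)))))) root , b≈0))
    where
    M<M+1 : ∀ M → M ℚ.< M ℚ.+ 1ℚ
    M<M+1 M = subst (ℚ._< M ℚ.+ 1ℚ) (ℚ.+-identityʳ M) (ℚ.+-monoʳ-< M (ℚ.positive⁻¹ 1ℚ))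
    N-M≡0⇒M≡N : ∀ M N → N ℚ.- M ≡ 0ℚ → M ≡ N
    N-M≡0⇒M≡N M N eq = ≡.sym (GroupProperties.x∙y⁻¹≈ε⇒x≈y ℚ.+-0-group N M eq)

  -- The vectors m c * s c with m ≥ 1 have prescribed signs; scaling up one
  -- coordinate at a time moves such a vector off each hyperplane in turn.
  generic-vector : ∀ {k n} (s : Fin n → ℚ) (F : Subset n) (ℓ : Fin k → Fin n → Carrier) →
    (∀ c → c ∈ F → s c ≢ 0ℚ) → (∀ i → ¬ (∀ c → c ∈ F → ℓ i c ≈ 0#)) →
    ¬ ¬ (Σ[ m ∈ (Fin n → ℚ) ] (∀ c → 1ℚ ℚ.≤ m c) × (∀ i → ¬ (λ c → ι (m c ℚ.* s c)) ∙ ℓ i ≈ 0#))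
  generic-vector {zero} s F ℓ s≢0 ℓ≉0 = return ((λ _ → 1ℚ) , (λ _ → ℚ.≤-refl) , λ ())
  generic-vector {suc k} {n} s F ℓ s≢0 ℓ≉0 = do
    m , 1≤m , m∙ℓ≉0 ← generic-vector s F (ℓ ∘ suc) s≢0 (ℓ≉0 ∘ suc)
    p , p∈F , ℓp≉0 ← pivot F (ℓ zero) (ℓ≉0 zero)
    -- As a function of `N`, the value on the new functional has non-zero slope, and the value on
    -- each earlier one has non-zero constant term; so each has at most one bad `N`.
    bounds ← ¬¬-Fin {P = λ i → ∃[ N₀ ] 0ℚ ℚ.≤ N₀ × (∀ N → N₀ ℚ.≤ N →
        ¬ (λ c → ι (m c ℚ.* s c)) ∙ ℓ i + ι N * (ι (s p) * ℓ i p) ≈ 0#)}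
      λ { zero    → avoid-root _ _ (λ h → *-nonzero (ι-nonzero (s≢0 p p∈F)) ℓp≉0 (proj₂ h))
        ; (suc i) → avoid-root _ _ (λ h → m∙ℓ≉0 i (proj₁ h)) }
    let N , 0≤N , N-max = maximum (λ i → proj₁ (bounds i))
    return (raise m p N
      , (λ c → ℚ.≤-trans (1≤m c) (raise-≥ m p N 0≤N c))
      , λ i eq → proj₂ (proj₂ (bounds i)) N (N-max i) (≈-trans (≈-sym (raise-∙ m p N (ℓ i))) eq))
    where
    maximum : ∀ {k} (f : Fin k → ℚ) → ∃[ N ] 0ℚ ℚ.≤ N × (∀ i → f i ℚ.≤ N)
    maximum {zero}  f = 0ℚ , ℚ.≤-refl , λ ()
    maximum {suc k} f =
      let N , 0≤N , h = maximum (f ∘ suc)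
      in f zero ℚ.⊔ N , ℚ.≤-trans 0≤N (ℚ.p≤q⊔p (f zero) N)
       , λ { zero → ℚ.p≤p⊔q (f zero) N ; (suc i) → ℚ.≤-trans (h i) (ℚ.p≤q⊔p (f zero) N) }
    raise : (Fin n → ℚ) → Fin n → ℚ → Fin n → ℚ
    raise m p N c with p ≟ c
    ... | yes _ = m c ℚ.+ N
    ... | no  _ = m c
    raise-≥ : ∀ m p N → 0ℚ ℚ.≤ N → ∀ c → m c ℚ.≤ raise m p N c
    raise-≥ m p N 0≤N c with p ≟ c
    ... | yes _ = subst (ℚ._≤ m c ℚ.+ N) (ℚ.+-identityʳ (m c)) (ℚ.+-monoʳ-≤ (m c) 0≤N)
    ... | no  _ = ℚ.≤-refl
    raise-δ : ∀ m p N c → ι (raise m p N c ℚ.* s c) ≈ ι (m c ℚ.* s c) + (ι N * ι (s p)) * δ p c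
    raise-δ m p N c with p ≟ c
    ... | yes refl = begin
      ι ((m c ℚ.+ N) ℚ.* s c)                            ≈⟨ ≈-trans (ι-* _ _) (*-congʳ (ι-+ (m c) N)) ⟩
      (ι (m c) + ι N) * ι (s c)                          ≈⟨ distribʳ (ι (s c)) (ι (m c)) (ι N) ⟩
      ι (m c) * ι (s c) + ι N * ι (s c)                  ≈⟨ +-cong (≈-sym (ι-* _ _))
                                                             (≈-trans (≈-sym (*-identityʳ _)) (*-congˡ (≈-sym (δ-diagonal c)))) ⟩
      ι (m c ℚ.* s c) + (ι N * ι (s c)) * δ c c          ∎
      where open ≈-Reasoning
    ... | no p≢c = ≈-sym (≈-trans (+-congˡ (≈-trans (*-congˡ (δ-off-diagonal p c p≢c)) (zeroʳ _))) (+-identityʳ _))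
    raise-∙ : ∀ m p N f → (λ c → ι (raise m p N c ℚ.* s c)) ∙ f ≈ (λ c → ι (m c ℚ.* s c)) ∙ f + ι N * (ι (s p) * f p)
    raise-∙ m p N f = begin
      (λ c → ι (raise m p N c ℚ.* s c)) ∙ f                                   ≈⟨ ∙-congʳ (raise-δ m p N) ⟩
      (λ c → ι (m c ℚ.* s c) + (ι N * ι (s p)) * δ p c) ∙ f                   ≈⟨ ∙-+ˡ (λ c → ι (m c ℚ.* s c)) _ f ⟩
      (λ c → ι (m c ℚ.* s c)) ∙ f + (λ c → (ι N * ι (s p)) * δ p c) ∙ f       ≈⟨ +-congˡ (≈-trans (∙-*ˡ _ (δ p) f) (*-congˡ (δ-∙ p f))) ⟩
      (λ c → ι (m c ℚ.* s c)) ∙ f + ι N * ι (s p) * f p                       ≈⟨ +-congˡ (*-assoc (ι N) (ι (s p)) (f p)) ⟩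
      (λ c → ι (m c ℚ.* s c)) ∙ f + ι N * (ι (s p) * f p)                     ∎
      where open ≈-Reasoning

-- Half-open decompositions

⊆∧card≥⇒≡ : ∀ {n} {p q : Subset n} → p ⊆ q → card q ℕ.≤ card p → p ≡ q
⊆∧card≥⇒≡ {p = p} {q} p⊆q ∣q∣≤∣p∣ = ⊆-antisym p⊆q λ {x} x∈q → case x ∈? p of λ
  { (yes x∈p) → x∈p
  ; (no  x∉p) → ⊥-elim (ℕ.<⇒≱ (p⊂q⇒∣p∣<∣q∣ (p⊆q , x , x∈q , x∉p)) ∣q∣≤∣p∣) }

comprehension : ∀ {n p} {P : Fin n → Set p} → (∀ i → Dec (P i)) →
  Σ[ S ∈ Subset n ] (∀ i → i ∈ S → P i) × (∀ i → P i → i ∈ S)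
comprehension {zero}  P? = [] , (λ ()) , λ ()
comprehension {suc n} P? with comprehension (P? ∘ suc) | P? zero
... | S , S⇒P , P⇒S | yes p = inside ∷ S , (λ { zero _ → p ; (suc i) (there i∈) → S⇒P i i∈ })
                                         , λ { zero _ → here ; (suc i) pi → there (P⇒S i pi) }
... | S , S⇒P , P⇒S | no ¬p = outside ∷ S , (λ { (suc i) (there i∈) → S⇒P i i∈ })
                                          , λ { zero p → ⊥-elim (¬p p) ; (suc i) pi → there (P⇒S i pi) }

-- Properties of all sufficiently small positive rationals

Eventually : (ℚ → Set) → Set
Eventually P = ∃[ t₀ ] 0ℚ ℚ.< t₀ × (∀ t → 0ℚ ℚ.< t → t ℚ.≤ t₀ → P t)

Eventually-map : ∀ {P Q : ℚ → Set} → (∀ t → 0ℚ ℚ.< t → P t → Q t) → Eventually P → Eventually Q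
Eventually-map f (t₀ , 0<t₀ , h) = t₀ , 0<t₀ , λ t 0<t t≤t₀ → f t 0<t (h t 0<t t≤t₀)

Eventually-× : ∀ {P Q : ℚ → Set} → Eventually P → Eventually Q → Eventually (λ t → P t × Q t)
Eventually-× (s , 0<s , h) (t , 0<t , k) with ℚ.⊓-sel s t
... | inj₁ eq = s , 0<s , λ r 0<r r≤s → h r 0<r r≤s , k r 0<r (ℚ.≤-trans r≤s (subst (ℚ._≤ t) eq (ℚ.p⊓q≤q s t)))
... | inj₂ eq = t , 0<t , λ r 0<r r≤t → h r 0<r (ℚ.≤-trans r≤t (subst (ℚ._≤ s) eq (ℚ.p⊓q≤p s t))) , k r 0<r r≤t

Eventually-Fin : ∀ {n} {P : Fin n → ℚ → Set} → (∀ i → Eventually (P i)) → Eventually (λ t → ∀ i → P i t)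
Eventually-Fin {zero}  h = 1ℚ , ℚ.positive⁻¹ 1ℚ , λ _ _ _ ()
Eventually-Fin {suc n} h =
  Eventually-map (λ { _ _ (p , q) zero → p ; _ _ (p , q) (suc i) → q i })
    (Eventually-× (h zero) (Eventually-Fin (h ∘ suc)))

Eventually-Subset : ∀ {n} {P : Subset n → ℚ → Set} → (∀ S → Eventually (P S)) → Eventually (λ t → ∀ S → P S t)
Eventually-Subset {n} {P} h =
  let _ , e , e-surjective = subsets n
  in Eventually-map (λ t _ p S → let i , eq = e-surjective S in subst (λ S → P S t) eq (p i))
       (Eventually-Fin (h ∘ e))

Eventually⇒∃ : ∀ {P : ℚ → Set} → Eventually P → ∃[ t ] 0ℚ ℚ.< t × P t
Eventually⇒∃ (t , 0<t , h) = t , 0<t , h t 0<t ℚ.≤-refl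

inverse : ∀ q → 0ℚ ℚ.< q → ∃[ r ] 0ℚ ℚ.< r × r ℚ.* q ≡ 1ℚ
inverse q 0<q = ℚ.1/ q , ℚ.positive⁻¹ (ℚ.1/ q) {{ℚ.1/pos⇒pos q}} , ℚ.*-inverseˡ q
  where
  instance
    q-positive : ℚ.Positive q
    q-positive = ℚ.positive 0<q
    q-nonZero : ℚ.NonZero q
    q-nonZero = ℚ.pos⇒nonZero q

*-positive : ∀ {p q} → 0ℚ ℚ.< p → 0ℚ ℚ.< q → 0ℚ ℚ.< p ℚ.* q
*-positive {p} {q} 0<p 0<q =
  subst (ℚ._< p ℚ.* q) (ℚ.*-zeroʳ p) (ℚ.*-monoʳ-<-pos p {{ℚ.positive 0<p}} 0<q)

fromℕ : ℕ → ℚ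
fromℕ zero    = 0ℚ
fromℕ (suc n) = 1ℚ ℚ.+ fromℕ n

fromℕ-nonneg : ∀ n → 0ℚ ℚ.≤ fromℕ n
fromℕ-nonneg zero    = ℚ.≤-refl
fromℕ-nonneg (suc n) = ℚ.+-mono-≤ (ℚ.<⇒≤ (ℚ.positive⁻¹ 1ℚ)) (fromℕ-nonneg n)

fromℕ-positive : ∀ {n} → 0 ℕ.< n → 0ℚ ℚ.< fromℕ n
fromℕ-positive {suc n} _ = ℚ.+-mono-<-≤ (ℚ.positive⁻¹ 1ℚ) (fromℕ-nonneg n)

∈⇒card>0 : ∀ {n} {p : Subset n} {x} → x ∈ p → 0 ℕ.< card p
∈⇒card>0 {p = p} x∈p = ℕ.≤-<-trans ℕ.z≤n (x∈p⇒∣p-x∣<∣p∣ x∈p)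

-- Cones over a triangulated simplex and rays in them

module ConeGeometry (K : ArchimedeanRing) where

  open OrderedAlgebra K

  -- The contrapositive of `limit`, applied to `- x`.
  ¬≲⇒rational : ∀ {x} → ¬ x ≲ 0# → ¬ ¬ (∃[ ε ] 0ℚ ℚ.< ε × ι ε ≲ x)
  ¬≲⇒rational {x} x≰0 k = x≰0 (0≲-x⇒x≲0 (limit λ ε 0<ε → -‿anti (total λ ε≲x → k (ε , 0<ε , ε≲x))))

  *-monoˡ : ∀ {x y z} → 0# ≲ x → y ≲ z → x * y ≲ x * z
  *-monoˡ {x} {y} {z} 0≲x y≲z = 0≲y-x⇒x≲y (0≲-resp
    (solve 3 (λ x y z → x :* (z :+ :- y) := x :* z :+ :- (x :* y)) ≈-refl x y z) (*-mono 0≲x (x≲y⇒0≲y-x y≲z)))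

  -- With rational bounds `ε` below `x` and `- B` below `y`, a step `t` of at most `½ε / B` costs at
  -- most `½ε` and leaves at least `½ε`.
  perturbation : ∀ {x} y → ¬ x ≲ 0# → ¬ ¬ Eventually (λ t → ¬ x + ι t * y ≲ 0#)
  perturbation {x} y x≰0 = do
    ε , 0<ε , ε≲x ← ¬≲⇒rational x≰0
    let B , 0<B , _ , -B≲y = bound y
        r , 0<r , rB≡1 = inverse B 0<B
        ½ε = ½ ℚ.* ε
        0<½ε = ℚ.*-monoʳ-<-pos ½ 0<ε
        ½ε+½ε≡ε = ≡.trans (≡.sym (ℚ.*-distribʳ-+ ε ½ ½)) (ℚ.*-identityˡ ε)
    return (½ε ℚ.* r , *-positive 0<½ε 0<r , λ t 0<t t≤ h →
      let tB≤½ε : t ℚ.* B ℚ.≤ ½ε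
          tB≤½ε = ℚ.≤-trans (ℚ.*-monoʳ-≤-nonNeg B {{ℚ.nonNegative (ℚ.<⇒≤ 0<B)}} t≤)
            (ℚ.≤-reflexive (≡.trans (ℚ.*-assoc ½ε r B) (≡.trans (cong (½ε ℚ.*_) rB≡1) (ℚ.*-identityʳ ½ε))))
          -½ε≲ty = transitive (-‿anti (ι-mono tB≤½ε)) (≲-resp
            (≈-trans (solve 2 (λ t b → t :* :- b := :- (t :* b)) ≈-refl (ι t) (ι B)) (-‿cong (≈-sym (ι-* t B))))
            ≈-refl (*-monoˡ (ι-nonneg (ℚ.<⇒≤ 0<t)) -B≲y))
      in ι-positive 0<½ε (transitive (≲-resp
          (≈-trans (+-congʳ (≈-trans (reflexive′ (≡.sym ½ε+½ε≡ε)) (ι-+ ½ε ½ε)))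
            (solve 1 (λ e → (e :+ e) :+ :- e := e) ≈-refl (ι ½ε))) ≈-refl
          (+-mono ε≲x -½ε≲ty)) h))
    where
    reflexive′ : ∀ {p q} → p ≡ q → ι p ≈ ι q
    reflexive′ refl = ≈-refl

  0≲∧≉0⇒¬≲0 : ∀ {x} → 0# ≲ x → ¬ x ≈ 0# → ¬ x ≲ 0#
  0≲∧≉0⇒¬≲0 0≲x x≉0 x≲0 = x≉0 (antisym x≲0 0≲x)

  -- As a weight vector, `χ τ` describes the sum of the vertices of `τ`: a point in the relative
  -- interior of the cone over `τ`, with integral coordinate sum. Rays towards `q` start there.
  χ : ∀ {n} → Subset n → Fin n → Carrier
  χ (_ ∷ p)       (suc i) = χ p i
  χ (inside ∷ p)  zero    = 1#
  χ (outside ∷ p) zero    = 0#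

  χ-∈ : ∀ {n} {p : Subset n} {u} → u ∈ p → χ p u ≈ 1#
  χ-∈ here = ≈-refl
  χ-∈ {p = _ ∷ _} (there u∈) = χ-∈ u∈

  χ-∉ : ∀ {n} (p : Subset n) → SupportedOn (χ p) p
  χ-∉ (inside ∷ p)  zero    u∉ = ⊥-elim (u∉ here)
  χ-∉ (outside ∷ p) zero    u∉ = ≈-refl
  χ-∉ (_ ∷ p)       (suc u) u∉ = χ-∉ p u (u∉ ∘ there)

  χ-nonneg : ∀ {n} (p : Subset n) u → 0# ≲ χ p u
  χ-nonneg (inside ∷ p)  zero    = total 1≰0
  χ-nonneg (outside ∷ p) zero    = ≲-refl
  χ-nonneg (_ ∷ p)       (suc u) = χ-nonneg p u

  sum-χ : ∀ {n} (p : Subset n) → sum (χ p) ≈ ι (fromℕ (card p))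
  sum-χ []            = ≈-sym ι-0
  sum-χ (inside ∷ p)  = ≈-trans (+-cong (≈-sym ι-1) (sum-χ p)) (≈-sym (ι-+ 1ℚ _))
  sum-χ (outside ∷ p) = ≈-trans (+-identityˡ _) (sum-χ p)

  sum-ι : ∀ {n} (q : Fin n → ℚ) → ∃[ r ] sum (ι ∘ q) ≈ ι r
  sum-ι {zero}  q = 0ℚ , ≈-sym ι-0
  sum-ι {suc n} q = let r , eq = sum-ι (q ∘ suc) in q zero ℚ.+ r , ≈-trans (+-congˡ eq) (≈-sym (ι-+ (q zero) r))

  sum-positive : ∀ {n} {f : Fin n → Carrier} → (∀ u → 0# ≲ f u) → ∀ u → ¬ f u ≲ 0# → ¬ sum f ≲ 0#
  sum-positive f≥0 u fu≰0 ∑≲0 = fu≰0 (reflexive (sum-nonneg-zero f≥0 (antisym ∑≲0 (sum-nonneg f≥0)) u))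

  sum≈∙1 : ∀ {n} (w : Fin n → Carrier) → sum w ≈ w ∙ (λ _ → 1#)
  sum≈∙1 w = sum-cong-≋ (λ u → ≈-sym (*-identityʳ (w u)))

  -- The cone over a triangulated simplex F, in barycentric coordinates: b u is
  -- the vector of coordinates of the vertex u of the triangulation.
  record ConeComplex {n} (F : Subset n) (n′ : ℕ) : Set₁ where
    field
      b            : Fin n′ → Fin n → Carrier
      Cell         : Subset n′ → Set
      down-closed  : ∀ {G H} → G ⊆ H → Cell H → Cell G
      b-nonneg     : ∀ u c → 0# ≲ b u c
      b-supported  : ∀ u → SupportedOn (b u) F
      -- An index that is a vertex of no cell has no meaningful coordinates, so height 1 is required
      -- only on cells.
      b-sum        : ∀ {G u} → Cell G → u ∈ G → sum (b u) ≈ 1#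

    point : (Fin n′ → Carrier) → Fin n → Carrier
    point w c = w ∙ (λ u → b u c)

    field
      independent  : ∀ {G} → Cell G → ∀ w → SupportedOn w G → (∀ c → point w c ≈ 0#) → ∀ u → w u ≈ 0#
      -- A common point of two cones has its weights on the common face; the rational sum `r`
      -- permits rescaling to the simplex.
      intersection : ∀ {G H} → Cell G → Cell H → ∀ w z r → SupportedOn w G → SupportedOn z H →
                     (∀ u → 0# ≲ w u) → (∀ u → 0# ≲ z u) → (∀ c → point w c ≈ point z c) →
                     sum w ≈ ι r → 0ℚ ℚ.< r → SupportedOn w H
      covers       : ∀ y r → (∀ c → 0# ≲ y c) → SupportedOn y F → sum y ≈ ι r → 0ℚ ℚ.< r →
                     ¬ ¬ (∃[ G ] Cell G × (Σ[ w ∈ (Fin n′ → Carrier) ]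
                       SupportedOn w G × (∀ u → 0# ≲ w u) × (∀ c → point w c ≈ y c)))

  module HalfOpen {n n′} {F : Subset n} (𝒞 : ConeComplex F n′) where
    open ConeComplex 𝒞

    unique : ∀ {G} → Cell G → ∀ {w z} → SupportedOn w G → SupportedOn z G →
             (∀ c → point w c ≈ point z c) → ∀ u → w u ≈ z u
    unique cG {w} {z} w-supp z-supp eq u = x-y≈0⇒x≈y (independent cG (λ u → w u + - z u)
      (λ u u∉G → x≈y⇒x-y≈0 (≈-trans (w-supp u u∉G) (≈-sym (z-supp u u∉G))))
      (λ c → ≈-trans (∙-minusˡ w z _) (x≈y⇒x-y≈0 (eq c))) u)

    -- If `G` had more vertices than `E` has coordinates, elimination would produce a linear
    -- relation among the vectors `b u` with `u ∈ G`.
    dimension : ∀ {G E} → Cell G → (∀ u → u ∈ G → SupportedOn (b u) E) → card G ℕ.≤ card E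
    dimension {G} {E} cG b-supp = ℕ.≮⇒≥ λ ∣E∣<∣G∣ →
      homogeneous-solution (λ i u → b u (element E i)) G ∣E∣<∣G∣ λ (w , supp , w≉0 , h) →
        w≉0 (independent cG w supp λ c → case c ∈? E of λ
          { (yes c∈E) → let i , eq = element-surjective E c∈E in subst (λ c → point w c ≈ 0#) eq (h i)
          ; (no  c∉E) → ≈-trans (∙-supported supp (λ u → b u c) (λ _ → 0#) (λ u u∈G → b-supp u u∈G c c∉E))
                                (sum-zero (λ u → zeroʳ (w u))) })

    dimension-≤ : ∀ {G} → Cell G → card G ℕ.≤ card F
    dimension-≤ cG = dimension cG (λ u _ → b-supported u)

    point-+* : ∀ w z t c → point (λ u → w u + t * z u) c ≈ point w c + t * point z c
    point-+* w z t c = ≈-trans (∙-+ˡ w (λ u → t * z u) _) (+-congˡ (∙-*ˡ t z _))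

    sum-point : ∀ {G} → Cell G → ∀ {w} → SupportedOn w G → sum (point w) ≈ sum w
    sum-point cG {w} supp = begin
      sum (point w)                          ≈⟨ sum≈∙1 (point w) ⟩
      point w ∙ (λ _ → 1#)                   ≈⟨ ≈-sym (∙-swap w b (λ _ → 1#)) ⟩
      w ∙ (λ u → b u ∙ (λ _ → 1#))           ≈⟨ ∙-supported supp _ (λ _ → 1#) (λ u u∈G → ≈-trans (≈-sym (sum≈∙1 (b u))) (b-sum cG u∈G)) ⟩
      w ∙ (λ _ → 1#)                         ≈⟨ ≈-sym (sum≈∙1 w) ⟩
      sum w                                  ∎
      where open ≈-Reasoning

    -- The weights carry no sign condition: `q` must avoid the linear span of every smaller cell,
    -- not only its cone. This is what makes all coordinates of `q` in a full cell non-zero.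
    Generic : (Fin n → ℚ) → Set
    Generic q = ∀ G → Cell G → card G ℕ.< card F → ∀ w → SupportedOn w G → ¬ (∀ c → point w c ≈ ι (q c))

    -- Each cell with fewer vertices than `F` lies in a hyperplane, and there are finitely many of
    -- them, so `generic-vector` avoids them all. The multipliers `m c ≥ 1` leave the sign pattern
    -- of `s` intact.
    generic-direction : ∀ {p} → p ∈ F → (s : Fin n → ℚ) → (∀ c → c ∈ F → s c ≢ 0ℚ) →
      ¬ ¬ (Σ[ m ∈ (Fin n → ℚ) ] (∀ c → 1ℚ ℚ.≤ m c) × Generic (λ c → m c ℚ.* s c))
    generic-direction {p} p∈F s s≢0 = do
      let _ , e , e-surjective = subsets n′
      normals ← ¬¬-Fin (normal ∘ e)
      m , 1≤m , m-generic ← generic-vector s F (λ i → proj₁ (normals i)) s≢0 (λ i → proj₁ (proj₂ (normals i)))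
      return (m , 1≤m , λ G cG ∣G∣<∣F∣ w supp w≈q →
        let i , eᵢ≡G = e-surjective G
            ℓ , _ , ℓ⊥ = normals i
        in m-generic i (begin
          (λ c → ι (m c ℚ.* s c)) ∙ ℓ        ≈⟨ ∙-congʳ (λ c → ≈-sym (w≈q c)) ⟩
          point w ∙ ℓ                        ≈⟨ ≈-sym (∙-swap w b ℓ) ⟩
          w ∙ (λ u → b u ∙ ℓ)                ≈⟨ ∙-supported supp _ (λ _ → 0#) (subst (λ G → Cell G → card G ℕ.< card F → ∀ u → u ∈ G → b u ∙ ℓ ≈ 0#) eᵢ≡G ℓ⊥ cG ∣G∣<∣F∣) ⟩
          w ∙ (λ _ → 0#)                     ≈⟨ sum-zero (λ u → zeroʳ (w u)) ⟩
          0#                                 ∎))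
      where
      open ≈-Reasoning
      normal : ∀ G → ¬ ¬ (Σ[ ℓ ∈ (Fin n → Carrier) ] ¬ (∀ c → c ∈ F → ℓ c ≈ 0#) ×
        (Cell G → card G ℕ.< card F → ∀ u → u ∈ G → b u ∙ ℓ ≈ 0#))
      normal G with card G ℕ.<? card F
      -- A dummy normal, non-zero on `F` because `p ∈ F`; nothing has to be avoided for such a `G`.
      ... | no ∣G∣≮∣F∣ = return (δ p
            , (λ h → 1≰0 (reflexive (≈-trans (≈-sym (δ-diagonal p)) (h p p∈F))))
            , λ _ ∣G∣<∣F∣ → ⊥-elim (∣G∣≮∣F∣ ∣G∣<∣F∣))
      ... | yes ∣G∣<∣F∣ = do
        -- With the roles exchanged, the unknowns are the coordinates in `F` and the equations come
        -- from the vertices of `G`.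
        ℓ , supp , ℓ≉0 , h ← homogeneous-solution (b ∘ element G) F ∣G∣<∣F∣
        return (ℓ
          , (λ ℓ≈0 → ℓ≉0 λ c → case c ∈? F of λ { (yes c∈F) → ℓ≈0 c c∈F ; (no c∉F) → supp c c∉F })
          , λ _ _ u u∈G → let i , eq = element-surjective G u∈G
                          in subst (λ u → b u ∙ ℓ ≈ 0#) eq (≈-trans (∙-comm (b (element G i)) ℓ) (h i)))

    point-nonneg : ∀ {w} → (∀ u → 0# ≲ w u) → ∀ c → 0# ≲ point w c
    point-nonneg w≥0 c = sum-nonneg (λ u → *-mono (w≥0 u) (b-nonneg u c))

    point-supported : ∀ w → SupportedOn (point w) F
    point-supported w c c∉F = sum-zero (λ u → ≈-trans (*-congˡ (b-supported u c c∉F)) (zeroʳ (w u)))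

    FullCell : Subset n′ → Set
    FullCell σ = Cell σ × card σ ≡ card F

    -- A partitioning, in the sense of partitionable complexes, of the relative complex cut out by
    -- `P`; `R` is its restriction map.
    IntervalPartition : (Subset n′ → Set) → (Subset n′ → Subset n′) → Set
    IntervalPartition P R =
      (∀ σ → R σ ⊆ σ) ×
      (∀ τ → Cell τ → P τ → ∃[ σ ] FullCell σ × R σ ⊆ τ × τ ⊆ σ) ×
      (∀ σ τ → FullCell σ → R σ ⊆ τ → τ ⊆ σ → P τ) ×
      (∀ σ σ′ τ → FullCell σ → FullCell σ′ → R σ ⊆ τ → τ ⊆ σ → R σ′ ⊆ τ → τ ⊆ σ′ → σ ≡ σ′)

    IntervalPartition-resp : ∀ {P Q R} → (∀ τ → P τ → Q τ) → (∀ τ → Q τ → P τ) → IntervalPartition P R → IntervalPartition Q R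
    IntervalPartition-resp P⇒Q Q⇒P (R⊆ , covered , full , disjoint) =
        R⊆
      , (λ τ cτ Qτ → covered τ cτ (Q⇒P τ Qτ))
      , (λ σ τ fσ R⊆τ τ⊆σ → P⇒Q τ (full σ τ fσ R⊆τ τ⊆σ))
      , disjoint

    module _ {p} (p∈F : p ∈ F) (q : Fin n → ℚ) (q-generic : Generic q)
             (q≢0 : ∀ c → c ∈ F → q c ≢ 0ℚ) (q-supported : ∀ c → c ∉ F → q c ≡ 0ℚ) where

      -- The cells of the half-open simplex: F without the facets visible from q.
      Full : Subset n′ → Set
      Full τ = ∀ c → q c ℚ.< 0ℚ → ¬ (∀ u → u ∈ τ → b u c ≈ 0#)

      Coordinates : Subset n′ → (Fin n′ → Carrier) → Set
      Coordinates G λ′ = SupportedOn λ′ G × (∀ c → point λ′ c ≈ ι (q c))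

      ray : Subset n′ → ℚ → Fin n → Carrier
      ray τ t c = point (χ τ) c + ι t * ι (q c)

      Hit : Subset n′ → ℚ → Subset n′ → Set
      Hit τ t G = Cell G × (Σ[ w ∈ (Fin n′ → Carrier) ]
        SupportedOn w G × (∀ u → 0# ≲ w u) × (∀ c → point w c ≈ ray τ t c))

      -- Here the rationality of `q` and `t` pays off: `covers` and `intersection` can be applied to
      -- points of the ray.
      ray-sum : ∀ {τ} → Cell τ → ∀ t → ∃[ r ] sum (ray τ t) ≈ ι r
      ray-sum {τ} cτ t =
        let s , sum-q≈s = sum-ι q
        in fromℕ (card τ) ℚ.+ t ℚ.* s , (begin
          sum (ray τ t)                                         ≈⟨ ∑-distrib-+ (point (χ τ)) (λ c → ι t * ι (q c)) ⟩
          sum (point (χ τ)) + sum (λ c → ι t * ι (q c))         ≈⟨ +-cong (≈-trans (sum-point cτ (χ-∉ τ)) (sum-χ τ))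
                                                                    (≈-sym (*-distribˡ-sum (ι t) (ι ∘ q))) ⟩
          ι (fromℕ (card τ)) + ι t * sum (ι ∘ q)                ≈⟨ +-congˡ (≈-trans (*-congˡ sum-q≈s) (≈-sym (ι-* t s))) ⟩
          ι (fromℕ (card τ)) + ι (t ℚ.* s)                      ≈⟨ ≈-sym (ι-+ _ _) ⟩
          ι (fromℕ (card τ) ℚ.+ t ℚ.* s)                        ∎)
        where open ≈-Reasoning

      -- Where `q` is negative, fullness of `τ` makes the starting coordinate positive, and it
      -- survives a small step. Where `q` is positive, every step makes the coordinate positive.
      ray-positive : ∀ {τ} → Full τ → ¬ ¬ Eventually (λ t → ∀ c → 0# ≲ ray τ t c × (c ∈ F → ¬ ray τ t c ≲ 0#))
      ray-positive {τ} full = do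
        ev ← ¬¬-Fin positive-at
        return (Eventually-Fin ev)
        where
        x≥0 : ∀ c → 0# ≲ point (χ τ) c
        x≥0 = point-nonneg (χ-nonneg τ)
        x≉0 : ∀ c → q c ℚ.< 0ℚ → ¬ point (χ τ) c ≈ 0#
        x≉0 c q<0 eq = full c q<0 λ u u∈τ → ≈-trans (≈-sym (≈-trans (*-congʳ (χ-∈ u∈τ)) (*-identityˡ (b u c))))
          (sum-nonneg-zero (λ u → *-mono (χ-nonneg τ u) (b-nonneg u c)) eq u)
        positive-at : ∀ c → ¬ ¬ Eventually (λ t → 0# ≲ ray τ t c × (c ∈ F → ¬ ray τ t c ≲ 0#))
        positive-at c with c ∈? F
        ... | no c∉F = return (1ℚ , ℚ.positive⁻¹ 1ℚ , λ t _ _ →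
              reflexive (≈-sym (≈-trans (+-cong (point-supported (χ τ) c c∉F)
                (≈-trans (*-congˡ (≈-trans (subst (λ z → ι (q c) ≈ ι z) (q-supported c c∉F) ≈-refl) ι-0)) (zeroʳ (ι t))))
                (+-identityˡ 0#)))
              , λ c∈F → ⊥-elim (c∉F c∈F))
        ... | yes c∈F with q c ℚ.<? 0ℚ
        ...   | yes q<0 = do
                ev ← perturbation (ι (q c)) (0≲∧≉0⇒¬≲0 (x≥0 c) (x≉0 c q<0))
                return (Eventually-map (λ t _ h → total h , λ _ → h) ev)
        ...   | no q≮0 = return (1ℚ , ℚ.positive⁻¹ 1ℚ , λ t 0<t _ →
                let tq>0 : ¬ ι t * ι (q c) ≲ 0#
                    tq>0 = *-strict (ι-positive 0<t) (0≲∧≉0⇒¬≲0 (ι-nonneg (ℚ.≮⇒≥ q≮0)) (ι-nonzero (q≢0 c c∈F)))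
                    h : ¬ ray τ t c ≲ 0#
                    h ray≲0 = tq>0 (transitive (≲-resp (+-identityˡ _) ≈-refl (+-mono (x≥0 c) (≲-refl {ι t * ι (q c)}))) ray≲0)
                in total h , λ _ → h)

      -- Pigeonhole: if each of the finitely many subsets were missed for all small `t`, a common
      -- small `t` would miss all of them, against `covers`.
      frequently-hit : ∀ {τ} → Cell τ → Full τ →
        ¬ ¬ (∃[ G ] (∀ ε → 0ℚ ℚ.< ε → ¬ ¬ (∃[ t ] 0ℚ ℚ.< t × t ℚ.≤ ε × Hit τ t G)))
      frequently-hit {τ} cτ full k = ¬¬⊥-elim do
        ev ← ray-positive full
        missed ← ¬¬-Subset {P = λ G → Eventually (λ t → ¬ Hit τ t G)} λ G j → k (G , λ ε 0<ε l →
          j (ε , 0<ε , λ t 0<t t≤ε hit → l (t , 0<t , t≤ε , hit)))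
        let t , 0<t , ray>0 , ¬hit = Eventually⇒∃ (Eventually-× ev (Eventually-Subset missed))
            r , sum≈r = ray-sum cτ t
            0<r = ℚ.≰⇒> λ r≤0 → sum-positive (proj₁ ∘ ray>0) p (proj₂ (ray>0 p) p∈F)
              (≲-resp (≈-sym sum≈r) ι-0 (ι-mono r≤0))
        G , hit ← covers (ray τ t) r (proj₁ ∘ ray>0) (λ c c∉F → ≈-trans (+-cong (point-supported (χ τ) c c∉F)
            (≈-trans (*-congˡ (≈-trans (subst (λ z → ι (q c) ≈ ι z) (q-supported c c∉F) ≈-refl) ι-0)) (zeroʳ (ι t)))) (+-identityˡ 0#))
            sum≈r 0<r
        return (¬hit G hit)

      -- A vertex of coordinate zero could be dropped, putting `q` in the span of a smaller cell.
      coordinates-nonzero : ∀ {G λ′} → Cell G → Coordinates G λ′ → ∀ u → u ∈ G → ¬ λ′ u ≈ 0#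
      coordinates-nonzero {G} {λ′} cG (supp , λ≈q) u u∈G λu≈0 = q-generic (G ∖ u) (down-closed (∖-⊆ G u) cG)
        (ℕ.<-≤-trans (x∈p⇒∣p-x∣<∣p∣ u∈G) (dimension-≤ cG)) λ′
        (λ z z∉ → case z ≟ u of λ
          { (yes refl) → λu≈0
          ; (no z≢u)   → supp z λ z∈G → z∉ (x∈p∧x≢y⇒x∈p-y z∈G z≢u) }) λ≈q

      -- A cell met at two points of the ray spans `q`, so genericity makes it full. Being met
      -- arbitrarily close to the start, it contains the starting point as well, hence all of `τ`.
      entered-cell : ∀ {τ} → Cell τ → Full τ →
        ¬ ¬ (∃[ G ] Cell G × card G ≡ card F × τ ⊆ G ×
             (Σ[ λ′ ∈ (Fin n′ → Carrier) ] Coordinates G λ′ × (∀ u → u ∉ τ → 0# ≲ λ′ u)))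
      entered-cell {τ} cτ full = do
        G , frequent ← frequently-hit cτ full
        t₁ , 0<t₁ , _ , hit₁ ← frequent 1ℚ (ℚ.positive⁻¹ 1ℚ)
        -- The bound `½ * t₁` makes the second hit strictly earlier, so that `t₁ - t₂` is
        -- invertible.
        t₂ , 0<t₂ , t₂≤½t₁ , hit₂ ← frequent (½ ℚ.* t₁) (ℚ.*-monoʳ-<-pos ½ 0<t₁)
        return (G , from-hits G frequent t₁ 0<t₁ hit₁ t₂ t₂≤½t₁ hit₂)
        where
        ½<1 : ½ ℚ.< 1ℚ
        ½<1 = ℚ.*<* (ℤ.+<+ (ℕ.s≤s (ℕ.s≤s ℕ.z≤n)))
        open ≈-Reasoning
        slope-supported : ∀ G r {w₁ w₂} → SupportedOn w₁ G → SupportedOn w₂ G → SupportedOn (λ u → ι r * (w₁ u + - w₂ u)) G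
        slope-supported G r supp₁ supp₂ u u∉G =
          ≈-trans (*-congˡ (x≈y⇒x-y≈0 (≈-trans (supp₁ u u∉G) (≈-sym (supp₂ u u∉G))))) (zeroʳ (ι r))
        -- In the difference quotient of the two hits the starting point cancels and `q` remains.
        slope-point : ∀ t₁ t₂ r {w₁ w₂} → (∀ c → point w₁ c ≈ ray τ t₁ c) → (∀ c → point w₂ c ≈ ray τ t₂ c) →
          r ℚ.* (t₁ ℚ.- t₂) ≡ 1ℚ → ∀ c → point (λ u → ι r * (w₁ u + - w₂ u)) c ≈ ι (q c)
        slope-point t₁ t₂ r {w₁} {w₂} w₁≈ w₂≈ eq c = begin
          point (λ u → ι r * (w₁ u + - w₂ u)) c
            ≈⟨ ≈-trans (∙-*ˡ (ι r) (λ u → w₁ u + - w₂ u) (λ u → b u c)) (*-congˡ (∙-minusˡ w₁ w₂ (λ u → b u c))) ⟩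
          ι r * (point w₁ c + - point w₂ c)
            ≈⟨ *-congˡ (+-cong (w₁≈ c) (-‿cong (w₂≈ c))) ⟩
          ι r * (ray τ t₁ c + - ray τ t₂ c)
            ≈⟨ solve 5 (λ r x s t q → r :* ((x :+ s :* q) :+ :- (x :+ t :* q)) := (r :* (s :+ :- t)) :* q) ≈-refl
                 (ι r) (point (χ τ) c) (ι t₁) (ι t₂) (ι (q c)) ⟩
          (ι r * (ι t₁ + - ι t₂)) * ι (q c)
            ≈⟨ *-congʳ (≈-trans (*-congˡ (≈-sym (≈-trans (ι-+ t₁ (ℚ.- t₂)) (+-congˡ (ι-neg t₂))))) (≈-sym (ι-* r _))) ⟩
          ι (r ℚ.* (t₁ ℚ.- t₂)) * ι (q c)
            ≈⟨ *-congʳ (subst (λ z → ι (r ℚ.* (t₁ ℚ.- t₂)) ≈ ι z) eq ≈-refl) ⟩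
          ι 1ℚ * ι (q c)
            ≈⟨ ≈-trans (*-congʳ ι-1) (*-identityˡ _) ⟩
          ι (q c) ∎
        base-supported : ∀ G t {w z} → SupportedOn w G → SupportedOn z G → SupportedOn (λ u → w u + - ι t * z u) G
        base-supported G t w-supp z-supp u u∉G =
          ≈-trans (+-cong (w-supp u u∉G) (≈-trans (*-congˡ (z-supp u u∉G)) (zeroʳ _))) (+-identityˡ 0#)
        base-point : ∀ t {w z} → (∀ c → point w c ≈ ray τ t c) → (∀ c → point z c ≈ ι (q c)) →
          ∀ c → point (λ u → w u + - ι t * z u) c ≈ point (χ τ) c
        base-point t {w} {z} w≈ z≈ c = begin
          point (λ u → w u + - ι t * z u) c                ≈⟨ point-+* w z (- ι t) c ⟩
          point w c + - ι t * point z c                    ≈⟨ +-cong (w≈ c) (*-congˡ (z≈ c)) ⟩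
          ray τ t c + - ι t * ι (q c)                      ≈⟨ solve 3 (λ x t q → (x :+ t :* q) :+ :- t :* q := x) ≈-refl
                                                               (point (χ τ) c) (ι t) (ι (q c)) ⟩
          point (χ τ) c                                    ∎
        base-nonneg : ∀ G → Cell G → ∀ {x z} → SupportedOn x G → SupportedOn z G →
          (∀ c → point x c ≈ point (χ τ) c) → (∀ c → point z c ≈ ι (q c)) →
          (∀ ε → 0ℚ ℚ.< ε → ¬ ¬ (∃[ t ] 0ℚ ℚ.< t × t ℚ.≤ ε × Hit τ t G)) → ∀ u → 0# ≲ x u
        base-nonneg G cG {x} {z} x-supp z-supp x≈ z≈ frequent u = limit λ ε 0<ε → stable (do
          let B , 0<B , z≲B , _ = bound (z u)
              r , 0<r , rB≡1 = inverse B 0<B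
          -- As `z u` is at most `B` and `r` is `1 / B`, this choice makes `t z u` at most `ε`.
          t , 0<t , t≤εr , _ , w , w-supp , w≥0 , w≈ ← frequent (ε ℚ.* r) (*-positive 0<ε 0<r)
          let tB≤ε = ℚ.≤-trans (ℚ.*-monoʳ-≤-nonNeg B {{ℚ.nonNegative (ℚ.<⇒≤ 0<B)}} t≤εr)
                (ℚ.≤-reflexive (≡.trans (ℚ.*-assoc ε r B) (≡.trans (cong (ε ℚ.*_) rB≡1) (ℚ.*-identityʳ ε))))
              w≈x+tz = unique cG {w} {λ u → x u + ι t * z u} w-supp
                (λ v v∉G → ≈-trans (+-cong (x-supp v v∉G) (≈-trans (*-congˡ (z-supp v v∉G)) (zeroʳ _))) (+-identityˡ 0#))
                (λ c → ≈-trans (w≈ c) (≈-sym (≈-trans (point-+* x z (ι t) c) (+-cong (x≈ c) (*-congˡ (z≈ c)))))) u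
              tz≲ε = transitive (*-monoˡ (ι-nonneg (ℚ.<⇒≤ 0<t)) z≲B)
                (≲-resp (ι-* t B) ≈-refl (ι-mono tB≤ε))
          return (≲-resp (+-identityˡ _) (≈-trans (+-congʳ w≈x+tz)
              (solve 2 (λ x y → (x :+ y) :+ :- y := x) ≈-refl (x u) (ι t * z u)))
            (+-mono (w≥0 u) (-‿anti tz≲ε))))
        -- The starting point lies in the cones over `τ` and `G`, so its weights `χ τ`, which equal
        -- 1 on `τ`, are supported on `G`.
        contained : ∀ {G x} → Cell τ → Cell G → SupportedOn x G → (∀ u → 0# ≲ x u) →
          (∀ c → point x c ≈ point (χ τ) c) → τ ⊆ G
        contained {G} {x} cτ cG x-supp x≥0 x≈ {u} u∈τ = case u ∈? G of λ
          { (yes u∈G) → u∈G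
          ; (no  u∉G) → ⊥-elim (1≰0 (reflexive (≈-trans (≈-sym (χ-∈ u∈τ))
              (intersection cτ cG (χ τ) x (fromℕ (card τ)) (χ-∉ τ) x-supp (χ-nonneg τ) x≥0
                (λ c → ≈-sym (x≈ c)) (sum-χ τ) (fromℕ-positive (∈⇒card>0 u∈τ)) u u∉G)))) }
        -- Two hits determine the coordinates λ′ of q and x of the point Σ τ in G;
        -- x ≥ 0 since x + t λ′ ≥ 0 for arbitrarily small t.
        from-hits : ∀ G → (∀ ε → 0ℚ ℚ.< ε → ¬ ¬ (∃[ t ] 0ℚ ℚ.< t × t ℚ.≤ ε × Hit τ t G)) →
          ∀ t₁ → 0ℚ ℚ.< t₁ → Hit τ t₁ G → ∀ t₂ → t₂ ℚ.≤ ½ ℚ.* t₁ → Hit τ t₂ G →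
          Cell G × card G ≡ card F × τ ⊆ G ×
          (Σ[ λ′ ∈ (Fin n′ → Carrier) ] Coordinates G λ′ × (∀ u → u ∉ τ → 0# ≲ λ′ u))
        from-hits G frequent t₁ 0<t₁ (cG , w₁ , supp₁ , w₁≥0 , w₁≈) t₂ t₂≤ (_ , w₂ , supp₂ , _ , w₂≈) =
          cG , ℕ.≤-antisym (dimension-≤ cG) ∣F∣≤∣G∣ , (λ {u} → τ⊆G {u}) , λ′ , (λ-supp , λ≈q) , λ≥0
          where
          t₂<t₁ : t₂ ℚ.< t₁
          t₂<t₁ = ℚ.≤-<-trans t₂≤ (subst (½ ℚ.* t₁ ℚ.<_) (ℚ.*-identityˡ t₁) (ℚ.*-monoˡ-<-pos t₁ {{ℚ.positive 0<t₁}} ½<1))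
          Δ⁻¹ : ∃[ r ] 0ℚ ℚ.< r × r ℚ.* (t₁ ℚ.- t₂) ≡ 1ℚ
          Δ⁻¹ = inverse (t₁ ℚ.- t₂) (subst (ℚ._< t₁ ℚ.- t₂) (ℚ.+-inverseʳ t₂) (ℚ.+-monoˡ-< (ℚ.- t₂) t₂<t₁))
          r : ℚ
          r = proj₁ Δ⁻¹
          λ′ x : Fin n′ → Carrier
          λ′ u = ι r * (w₁ u + - w₂ u)
          x u = w₁ u + - ι t₁ * λ′ u
          λ-supp : SupportedOn λ′ G
          λ-supp = slope-supported G r supp₁ supp₂
          λ≈q : ∀ c → point λ′ c ≈ ι (q c)
          λ≈q = slope-point t₁ t₂ r {w₁} {w₂} w₁≈ w₂≈ (proj₂ (proj₂ Δ⁻¹))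
          x-supp : SupportedOn x G
          x-supp = base-supported G t₁ {w₁} {λ′} supp₁ λ-supp
          x≈ : ∀ c → point x c ≈ point (χ τ) c
          x≈ = base-point t₁ {w₁} {λ′} w₁≈ λ≈q
          x≥0 : ∀ u → 0# ≲ x u
          x≥0 = base-nonneg G cG {x} {λ′} x-supp λ-supp x≈ λ≈q frequent
          τ⊆G : τ ⊆ G
          τ⊆G = contained {G} {x} cτ cG x-supp x≥0 x≈
          ∣F∣≤∣G∣ : card F ℕ.≤ card G
          ∣F∣≤∣G∣ = ℕ.≮⇒≥ λ ∣G∣<∣F∣ → q-generic G cG ∣G∣<∣F∣ λ′ λ-supp λ≈q
          x≈χ : ∀ u → x u ≈ χ τ u
          x≈χ = unique cG {x} {χ τ} x-supp (λ z z∉G → χ-∉ τ z (z∉G ∘ τ⊆G)) x≈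
          λ≥0 : ∀ u → u ∉ τ → 0# ≲ λ′ u
          -- Off `τ` the starting weight vanishes, so the non-negative weight `w₁ u` is `t₁` times
          -- the coordinate of `q`.
          λ≥0 u u∉τ = *-cancel-nonneg (ι-positive 0<t₁) (0≲-resp (begin
            w₁ u                             ≈⟨ solve 3 (λ w t z → w := (w :+ :- t :* z) :+ t :* z) ≈-refl (w₁ u) (ι t₁) (λ′ u) ⟩
            x u + ι t₁ * λ′ u                ≈⟨ +-congʳ (≈-trans (x≈χ u) (χ-∉ τ u u∉τ)) ⟩
            0# + ι t₁ * λ′ u                 ≈⟨ +-identityˡ _ ⟩
            ι t₁ * λ′ u                      ∎) (w₁≥0 u))

      nonneg-eventually : ∀ τ (λ′ : Fin n′ → Carrier) → (∀ u → u ∉ τ → 0# ≲ λ′ u) → ¬ ¬ Eventually (λ t → ∀ u → 0# ≲ χ τ u + ι t * λ′ u)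
      nonneg-eventually τ λ′ λ≥0 = do
        ev ← ¬¬-Fin at
        return (Eventually-Fin ev)
        where
        at : ∀ u → ¬ ¬ Eventually (λ t → 0# ≲ χ τ u + ι t * λ′ u)
        at u with u ∈? τ
        ... | yes u∈τ = do
              ev ← perturbation (λ′ u) (λ χ≲0 → 1≰0 (≲-resp (χ-∈ u∈τ) ≈-refl χ≲0))
              return (Eventually-map (λ _ _ → total) ev)
        ... | no u∉τ = return (1ℚ , ℚ.positive⁻¹ 1ℚ , λ t 0<t _ →
              ≲-resp (+-identityˡ 0#) ≈-refl (+-mono (χ-nonneg τ u) (*-mono (ι-nonneg (ℚ.<⇒≤ 0<t)) (λ≥0 u u∉τ))))

      -- For one small `t` the point of the ray lies in the cones over both cells. A vertex of `σ`
      -- off `σ′` would have weight `t λ′ u` there, which is positive by genericity, against the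
      -- intersection axiom.
      entered-cell-unique : ∀ {τ σ σ′ λ′ μ} → Cell σ → Cell σ′ → τ ⊆ σ → τ ⊆ σ′ →
        Coordinates σ λ′ → Coordinates σ′ μ →
        (∀ u → u ∉ τ → 0# ≲ λ′ u) → (∀ u → u ∉ τ → 0# ≲ μ u) → σ ⊆ σ′
      entered-cell-unique {τ} {σ} {σ′} {λ′} {μ} cσ cσ′ τ⊆σ τ⊆σ′ (λ-supp , λ≈q) (μ-supp , μ≈q) λ≥0 μ≥0 {u} u∈σ
        with u ∈? σ′
      ... | yes u∈σ′ = u∈σ′
      ... | no  u∉σ′ = ⊥-elim (¬¬⊥-elim (do
            ev₁ ← nonneg-eventually τ λ′ λ≥0
            ev₂ ← nonneg-eventually τ μ μ≥0
            let t , 0<t , w≥0 , z≥0 = Eventually⇒∃ (Eventually-× ev₁ ev₂)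
            return (impossible t 0<t w≥0 z≥0)))
            where
            u∉τ : u ∉ τ
            u∉τ = u∉σ′ ∘ τ⊆σ′
            0<λu : ¬ λ′ u ≲ 0#
            0<λu = 0≲∧≉0⇒¬≲0 (λ≥0 u u∉τ) (coordinates-nonzero cσ (λ-supp , λ≈q) u u∈σ)
            step-supported : ∀ {ρ ν} t → τ ⊆ ρ → SupportedOn ν ρ → SupportedOn (λ u → χ τ u + ι t * ν u) ρ
            step-supported t τ⊆ρ ν-supp v v∉ρ =
              ≈-trans (+-cong (χ-∉ τ v (v∉ρ ∘ τ⊆ρ)) (≈-trans (*-congˡ (ν-supp v v∉ρ)) (zeroʳ _))) (+-identityˡ 0#)
            step-point : ∀ {ν} t → (∀ c → point ν c ≈ ι (q c)) → ∀ c → point (λ u → χ τ u + ι t * ν u) c ≈ ray τ t c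
            step-point {ν} t ν≈q c = ≈-trans (point-+* (χ τ) ν (ι t) c) (+-congˡ (*-congˡ (ν≈q c)))
            impossible : ∀ t → 0ℚ ℚ.< t → (∀ u → 0# ≲ χ τ u + ι t * λ′ u) → (∀ u → 0# ≲ χ τ u + ι t * μ u) → ⊥
            impossible t 0<t w≥0 z≥0 = 0<w (reflexive (intersection cσ cσ′ w z r w-supp
              (step-supported t τ⊆σ′ μ-supp) w≥0 z≥0
              (λ c → ≈-trans (step-point t λ≈q c) (≈-sym (step-point t μ≈q c))) sum-w≈r
              (ℚ.≰⇒> λ r≤0 → sum-positive w≥0 u 0<w (≲-resp (≈-sym sum-w≈r) ι-0 (ι-mono r≤0))) u u∉σ′))
              where
              w z : Fin n′ → Carrier
              w u = χ τ u + ι t * λ′ u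
              z u = χ τ u + ι t * μ u
              w-supp : SupportedOn w σ
              w-supp = step-supported t τ⊆σ λ-supp
              r : ℚ
              r = proj₁ (ray-sum (down-closed τ⊆σ cσ) t)
              sum-w≈r : sum w ≈ ι r
              sum-w≈r = ≈-trans (≈-sym (sum-point cσ w-supp))
                (≈-trans (sum-cong-≋ (step-point t λ≈q)) (proj₂ (ray-sum (down-closed τ⊆σ cσ) t)))
              0<w : ¬ w u ≲ 0#
              0<w wu≲0 = *-strict (ι-positive 0<t) 0<λu (≲-resp
                (≈-trans (+-congʳ (χ-∉ τ u u∉τ)) (+-identityˡ _)) ≈-refl wu≲0)

      -- A full cell has too many vertices to lie in the facet opposite `c`.
      full-cell-full : ∀ {σ} → FullCell σ → Full σ
      full-cell-full {σ} (cσ , ∣σ∣≡∣F∣) c qc<0 b≈0 = ℕ.<-irrefl ∣σ∣≡∣F∣ (ℕ.≤-<-trans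
        (dimension {E = F ∖ c} cσ λ u u∈σ x x∉F∖c → case x ≟ c of λ
          { (yes refl) → b≈0 u u∈σ
          ; (no x≢c)   → b-supported u x λ x∈F → x∉F∖c (x∈p∧x≢y⇒x∈p-y x∈F x≢c) })
        (x∈p⇒∣p-x∣<∣p∣ c∈F))
        where
        c∈F : c ∈ F
        c∈F = case c ∈? F of λ
          { (yes c∈F) → c∈F
          ; (no  c∉F) → ⊥-elim (ℚ.<-irrefl (q-supported c c∉F) qc<0) }

      -- The cell entered from `σ` contains `σ` and has equally many vertices, so it is `σ` itself.
      full-cell-coordinates : ∀ σ → FullCell σ → ¬ ¬ (Σ[ λ′ ∈ (Fin n′ → Carrier) ] Coordinates σ λ′)
      full-cell-coordinates σ (cσ , ∣σ∣≡∣F∣) = do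
        G , _ , ∣G∣≡∣F∣ , σ⊆G , λ′ , coords , _ ← entered-cell cσ (full-cell-full (cσ , ∣σ∣≡∣F∣))
        return (λ′ , subst (λ G → Coordinates G λ′)
          (≡.sym (⊆∧card≥⇒≡ σ⊆G (ℕ.≤-reflexive (≡.trans ∣G∣≡∣F∣ (≡.sym ∣σ∣≡∣F∣))))) coords)

      -- R σ consists of the vertices of σ at which q has a negative coordinate:
      -- the points just behind a cell τ in direction q lie in σ iff R σ ⊆ τ ⊆ σ.
      interval-partition : ¬ ¬ (Σ[ R ∈ (Subset n′ → Subset n′) ] IntervalPartition Full R)
      interval-partition = do
        coords ← ¬¬-Subset {P = λ σ → Σ[ R ∈ Subset n′ ] R ⊆ σ × (FullCell σ → Σ[ λ′ ∈ (Fin n′ → Carrier) ]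
            Coordinates σ λ′ × (∀ u → u ∈ R → λ′ u ≲ 0#) × (∀ u → u ∉ R → 0# ≲ λ′ u))} signs
        entered ← ¬¬-Subset {P = λ τ → Cell τ → Full τ → ∃[ σ ] FullCell σ × τ ⊆ σ × (Σ[ λ′ ∈ (Fin n′ → Carrier) ]
            Coordinates σ λ′ × (∀ u → u ∉ τ → 0# ≲ λ′ u))} enters
        return ((λ σ → proj₁ (coords σ)) , assemble coords entered)
        where
        signs : ∀ σ → ¬ ¬ (Σ[ R ∈ Subset n′ ] R ⊆ σ × (FullCell σ → Σ[ λ′ ∈ (Fin n′ → Carrier) ]
            Coordinates σ λ′ × (∀ u → u ∈ R → λ′ u ≲ 0#) × (∀ u → u ∉ R → 0# ≲ λ′ u)))
        signs σ = do
          yes fσ ← ¬¬-excluded-middle {A = FullCell σ}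
            -- For a cell that is not full only `R ⊆ σ` is asked, and `σ` serves as the default.
            where no ¬fσ → return (σ , (λ {u} u∈ → u∈) , λ fσ → ⊥-elim (¬fσ fσ))
          λ′ , coords ← full-cell-coordinates σ fσ
          λ≲0? ← ¬¬-Fin (λ u → ¬¬-excluded-middle {A = λ′ u ≲ 0#})
          let N , N⇒≲0 , ≲0⇒N = comprehension λ≲0?
          return (σ ∩ N , (λ {u} → p∩q⊆p σ N {u}) , λ _ → λ′ , coords
            , (λ u u∈ → N⇒≲0 u (proj₂ (x∈p∩q⁻ σ N u∈)))
            , λ u u∉ → case u ∈? σ of λ
                { (yes u∈σ) → total λ λu≲0 → u∉ (x∈p∩q⁺ (u∈σ , ≲0⇒N u λu≲0))
                ; (no  u∉σ) → reflexive (≈-sym (proj₁ coords u u∉σ)) })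
        enters : ∀ τ → ¬ ¬ (Cell τ → Full τ → ∃[ σ ] FullCell σ × τ ⊆ σ × (Σ[ λ′ ∈ (Fin n′ → Carrier) ]
            Coordinates σ λ′ × (∀ u → u ∉ τ → 0# ≲ λ′ u)))
        enters τ = do
          yes (cτ , full) ← ¬¬-excluded-middle {A = Cell τ × Full τ}
            where no ¬h → return λ cτ full → ⊥-elim (¬h (cτ , full))
          G , cG , ∣G∣≡∣F∣ , τ⊆G , λ′ , coords , λ≥0 ← entered-cell cτ full
          return λ _ _ → G , (cG , ∣G∣≡∣F∣) , (λ {u} → τ⊆G {u}) , λ′ , coords , λ≥0
        assemble : (coords : ∀ σ → Σ[ R ∈ Subset n′ ] R ⊆ σ × (FullCell σ → Σ[ λ′ ∈ (Fin n′ → Carrier) ]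
            Coordinates σ λ′ × (∀ u → u ∈ R → λ′ u ≲ 0#) × (∀ u → u ∉ R → 0# ≲ λ′ u))) →
          (∀ τ → Cell τ → Full τ → ∃[ σ ] FullCell σ × τ ⊆ σ × (Σ[ λ′ ∈ (Fin n′ → Carrier) ]
            Coordinates σ λ′ × (∀ u → u ∉ τ → 0# ≲ λ′ u))) →
          IntervalPartition Full (λ σ → proj₁ (coords σ))
        assemble coords entered = (λ σ → proj₁ (proj₂ (coords σ))) , covered , full , disjoint
          where
          R : Subset n′ → Subset n′
          R σ = proj₁ (coords σ)
          covered : ∀ τ → Cell τ → Full τ → ∃[ σ ] FullCell σ × R σ ⊆ τ × τ ⊆ σ
          covered τ cτ fτ with entered τ cτ fτ
          ... | σ , fσ , τ⊆σ , μ , μ-coords , μ≥0 = σ , fσ , (λ {u} → R⊆τ {u}) , (λ {u} → τ⊆σ {u})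
            where
            λ′ : Fin n′ → Carrier
            λ′ = proj₁ (proj₂ (proj₂ (coords σ)) fσ)
            λ-coords : Coordinates σ λ′
            λ-coords = proj₁ (proj₂ (proj₂ (proj₂ (coords σ)) fσ))
            R⊆τ : R σ ⊆ τ
            -- A vertex of `R σ` off `τ` would have a coordinate that is both non-positive and
            -- non-negative, hence zero, which genericity excludes.
            R⊆τ {u} u∈R = case u ∈? τ of λ
              { (yes u∈τ) → u∈τ
              ; (no  u∉τ) → ⊥-elim (coordinates-nonzero (proj₁ fσ) λ-coords u (proj₁ (proj₂ (coords σ)) u∈R)
                  (antisym (proj₁ (proj₂ (proj₂ (proj₂ (proj₂ (coords σ)) fσ))) u u∈R)
                    (0≲-resp (unique (proj₁ fσ) (proj₁ μ-coords) (proj₁ λ-coords)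
                      (λ c → ≈-trans (proj₂ μ-coords c) (≈-sym (proj₂ λ-coords c))) u) (μ≥0 u u∉τ)))) }
          full : ∀ σ τ → FullCell σ → R σ ⊆ τ → τ ⊆ σ → Full τ
          full σ τ fσ R⊆τ τ⊆σ c qc<0 b≈0 with proj₂ (proj₂ (coords σ)) fσ
          -- If `τ` lay in the facet opposite `c`, only vertices off `τ` would contribute to `q c`,
          -- with non-negative weights, and `q c` could not be negative.
          ... | λ′ , (λ-supp , λ≈q) , _ , λ≥0 = ℚ.<-irrefl refl (ℚ.≤-<-trans
            (ι-reflect (≲-resp (≈-sym ι-0) (λ≈q c) (sum-nonneg term≥0))) qc<0)
            where
            term≥0 : ∀ u → 0# ≲ λ′ u * b u c
            term≥0 u with u ∈? τ
            ... | yes u∈τ = reflexive (≈-sym (≈-trans (*-congˡ (b≈0 u u∈τ)) (zeroʳ _)))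
            ... | no  u∉τ = *-mono (λ≥0 u (u∉τ ∘ R⊆τ)) (b-nonneg u c)
          disjoint : ∀ σ σ′ τ → FullCell σ → FullCell σ′ → R σ ⊆ τ → τ ⊆ σ → R σ′ ⊆ τ → τ ⊆ σ′ → σ ≡ σ′
          disjoint σ σ′ τ fσ fσ′ R⊆τ τ⊆σ R′⊆τ τ⊆σ′ with proj₂ (proj₂ (coords σ)) fσ | proj₂ (proj₂ (coords σ′)) fσ′
          ... | λ′ , λ-coords , _ , λ≥0 | μ , μ-coords , _ , μ≥0 = ⊆-antisym
            (entered-cell-unique (proj₁ fσ) (proj₁ fσ′) τ⊆σ τ⊆σ′ λ-coords μ-coords
              (λ u u∉τ → λ≥0 u (u∉τ ∘ R⊆τ)) (λ u u∉τ → μ≥0 u (u∉τ ∘ R′⊆τ)))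
            (entered-cell-unique (proj₁ fσ′) (proj₁ fσ) τ⊆σ′ τ⊆σ μ-coords λ-coords
              (λ u u∉τ → μ≥0 u (u∉τ ∘ R′⊆τ)) (λ u u∉τ → λ≥0 u (u∉τ ∘ R⊆τ)))

    -- The vector `s` is negative exactly on `S` and scaling by `m c ≥ 1` keeps it so; thus `Full`
    -- becomes a condition on the facets opposite `S`, whichever generic `q` was found.
    half-open-interval-partition : ∀ {p} → p ∈ F → (S : Subset n) → S ⊆ F →
      ¬ ¬ (Σ[ R ∈ (Subset n′ → Subset n′) ]
        IntervalPartition (λ τ → ∀ c → c ∈ S → ¬ (∀ u → u ∈ τ → b u c ≈ 0#)) R)
    half-open-interval-partition p∈F S S⊆F = do
      m , 1≤m , m-generic ← generic-direction p∈F s s≢0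
      let 0<m = λ c → ℚ.<-≤-trans (ℚ.positive⁻¹ 1ℚ) (1≤m c)
      R , R-partition ← interval-partition p∈F (λ c → m c ℚ.* s c) m-generic
        (λ c c∈F → nonzero (0<m c) (s≢0 c c∈F))
        (λ c c∉F → ≡.trans (cong (m c ℚ.*_) (s-outside c c∉F)) (ℚ.*-zeroʳ (m c)))
      return (R , IntervalPartition-resp
        (λ τ full c c∈S → full c (∈S⇒negative c (0<m c) c∈S))
        (λ τ full c q<0 → full c (negative⇒∈S c (0<m c) q<0)) R-partition)
      where
      s : Fin n → ℚ
      s c with c ∈? S | c ∈? F
      ... | yes _ | _     = ℚ.- 1ℚ
      ... | no  _ | yes _ = 1ℚ
      ... | no  _ | no  _ = 0ℚ
      s≢0 : ∀ c → c ∈ F → s c ≢ 0ℚ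
      s≢0 c c∈F with c ∈? S | c ∈? F
      ... | yes _ | _       = λ ()
      ... | no  _ | yes _   = λ ()
      ... | no  _ | no  c∉F = ⊥-elim (c∉F c∈F)
      s-outside : ∀ c → c ∉ F → s c ≡ 0ℚ
      s-outside c c∉F with c ∈? S | c ∈? F
      ... | yes c∈S | _       = ⊥-elim (c∉F (S⊆F c∈S))
      ... | no  _   | yes c∈F = ⊥-elim (c∉F c∈F)
      ... | no  _   | no  _   = refl
      nonzero : ∀ {x y} → 0ℚ ℚ.< x → y ≢ 0ℚ → x ℚ.* y ≢ 0ℚ
      nonzero {x} {y} 0<x y≢0 xy≡0 =
        let r , _ , rx≡1 = inverse x 0<x
        in y≢0 (≡.trans (≡.sym (ℚ.*-identityˡ y)) (≡.trans (cong (ℚ._* y) (≡.sym rx≡1))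
             (≡.trans (ℚ.*-assoc r x y) (≡.trans (cong (r ℚ.*_) xy≡0) (ℚ.*-zeroʳ r)))))
      ∈S⇒negative : ∀ c {x} → 0ℚ ℚ.< x → c ∈ S → x ℚ.* s c ℚ.< 0ℚ
      ∈S⇒negative c {x} 0<x c∈S with c ∈? S | c ∈? F
      ... | yes _  | _ = subst (x ℚ.* (ℚ.- 1ℚ) ℚ.<_) (ℚ.*-zeroʳ x)
            (ℚ.*-monoʳ-<-pos x {{ℚ.positive 0<x}} (ℚ.negative⁻¹ (ℚ.- 1ℚ)))
      ... | no c∉S | _ = ⊥-elim (c∉S c∈S)
      negative⇒∈S : ∀ c {x} → 0ℚ ℚ.< x → x ℚ.* s c ℚ.< 0ℚ → c ∈ S
      negative⇒∈S c {x} 0<x q<0 with c ∈? S | c ∈? F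
      ... | yes c∈S | _     = c∈S
      ... | no  _   | yes _ = ⊥-elim (ℚ.<-asym q<0 (*-positive 0<x (ℚ.positive⁻¹ 1ℚ)))
      ... | no  _   | no  _ = ⊥-elim (ℚ.<-irrefl (ℚ.*-zeroʳ x) q<0)

-- From triangulations to cone complexes

module TriangulatedSimplex (K : ArchimedeanRing) where

  open OrderedAlgebra K
  open ConeGeometry K

  combination : ∀ {n N} → (Fin n → Carrier) → (Fin n → Fin N → Carrier) → Fin N → Carrier
  combination w v c = w ∙ (λ i → v i c)

  IsConvexWeight : ∀ {n N} → (Fin n → Fin N → Carrier) → Subset n → (Fin N → Carrier) → (Fin n → Carrier) → Set
  IsConvexWeight v F x w = (∀ i → 0# ≲ w i) × SupportedOn w F × sum w ≈ 1# × (∀ c → x c ≈ combination w v c)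

  conv : ∀ {n N} → (Fin n → Fin N → Carrier) → Subset n → (Fin N → Carrier) → Set
  conv {n} v F x = Σ[ w ∈ (Fin n → Carrier) ] IsConvexWeight v F x w

  AffinelyIndependent : ∀ {n N} → (Fin n → Fin N → Carrier) → Subset n → Set
  AffinelyIndependent {n} v F = ∀ (w : Fin n → Carrier) →
    SupportedOn w F → sum w ≈ 0# → (∀ c → combination w v c ≈ 0#) → ∀ i → w i ≈ 0#

  IsConvexWeight-⊆ : ∀ {n N} {v : Fin n → Fin N → Carrier} {E F x w} → E ⊆ F → IsConvexWeight v E x w → IsConvexWeight v F x w
  IsConvexWeight-⊆ E⊆F (w≥0 , supp , sum≈1 , x≈) = w≥0 , (λ i i∉F → supp i (i∉F ∘ E⊆F)) , sum≈1 , x≈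

  conv-⊆ : ∀ {n N} {v : Fin n → Fin N → Carrier} {E F} → E ⊆ F → conv v E ⊆ᵖ conv v F
  conv-⊆ {v = v} E⊆F {x} (w , hw) = w , IsConvexWeight-⊆ {v = v} {x = x} E⊆F hw

  vertex∈conv : ∀ {n N} (v : Fin n → Fin N → Carrier) {F u} → u ∈ F → conv v F (v u)
  vertex∈conv v {F} {u} u∈F = δ u , δ-nonneg u
    , (λ i i∉F → δ-off-diagonal u i λ { refl → i∉F u∈F })
    , ≈-trans (sum≈∙1 (δ u)) (δ-∙ u (λ _ → 1#))
    , λ c → ≈-sym (δ-∙ u (λ i → v i c))

  convex-weights-unique : ∀ {n N} {v : Fin n → Fin N → Carrier} {F} → AffinelyIndependent v F → ∀ {w z} →
    SupportedOn w F → SupportedOn z F → sum w ≈ sum z → (∀ c → combination w v c ≈ combination z v c) → ∀ i → w i ≈ z i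
  convex-weights-unique {v = v} indep {w} {z} w-supp z-supp sum≈ comb≈ i = x-y≈0⇒x≈y (indep (λ i → w i + - z i)
    (λ i i∉F → x≈y⇒x-y≈0 (≈-trans (w-supp i i∉F) (≈-sym (z-supp i i∉F))))
    (≈-trans (sum≈∙1 (λ i → w i + - z i)) (≈-trans (∙-minusˡ w z (λ _ → 1#)) (x≈y⇒x-y≈0 (≈-trans (≈-sym (sum≈∙1 w)) (≈-trans sum≈ (sum≈∙1 z))))))
    (λ c → ≈-trans (∙-minusˡ w z (λ i → v i c)) (x≈y⇒x-y≈0 (comb≈ c))) i)

  module _ {n n′ N} {v : Fin n → Fin N → Carrier} {v′ : Fin n′ → Fin N → Carrier} {G : Subset n′}
           (β : Fin n′ → Fin n → Carrier) where

    sum-substitute : (∀ u → u ∈ G → sum (β u) ≈ 1#) → ∀ {w} → SupportedOn w G → sum (λ j → w ∙ (λ u → β u j)) ≈ sum w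
    sum-substitute β-sum {w} supp = begin
      sum (λ j → w ∙ (λ u → β u j))                  ≈⟨ sum≈∙1 (λ j → w ∙ (λ u → β u j)) ⟩
      (λ j → w ∙ (λ u → β u j)) ∙ (λ _ → 1#)         ≈⟨ ≈-sym (∙-swap w β (λ _ → 1#)) ⟩
      w ∙ (λ u → β u ∙ (λ _ → 1#))                   ≈⟨ ∙-supported supp _ (λ _ → 1#) (λ u u∈G → ≈-trans (≈-sym (sum≈∙1 (β u))) (β-sum u u∈G)) ⟩
      w ∙ (λ _ → 1#)                                 ≈⟨ ≈-sym (sum≈∙1 w) ⟩
      sum w                                          ∎
      where open ≈-Reasoning

    combination-substitute : (∀ u → u ∈ G → ∀ c → v′ u c ≈ combination (β u) v c) → ∀ {w} → SupportedOn w G →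
      ∀ c → combination w v′ c ≈ combination (λ j → w ∙ (λ u → β u j)) v c
    combination-substitute v′≈ {w} supp c = ≈-trans
      (∙-supported supp _ _ (λ u u∈G → v′≈ u u∈G c)) (∙-swap w β (λ j → v j c))

    -- Weights compose like matrices: those over the vertices of `G`, multiplied by the weights `β`
    -- of these vertices over `E`.
    conv-substitute : ∀ {E} → (∀ u → u ∈ G → IsConvexWeight v E (v′ u) (β u)) → conv v′ G ⊆ᵖ conv v E
    conv-substitute {E} hβ (w , w≥0 , supp , sum≈1 , x≈) =
        (λ j → w ∙ (λ u → β u j))
      , (λ j → sum-nonneg (λ u → case u ∈? G of λ
          { (yes u∈G) → *-mono (w≥0 u) (proj₁ (hβ u u∈G) j)
          ; (no  u∉G) → reflexive (≈-sym (≈-trans (*-congʳ (supp u u∉G)) (zeroˡ _))) }))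
      , (λ j j∉E → ≈-trans (∙-supported supp (λ u → β u j) (λ _ → 0#) (λ u u∈G → proj₁ (proj₂ (hβ u u∈G)) j j∉E))
                     (sum-zero (λ u → zeroʳ (w u))))
      , ≈-trans (sum-substitute (λ u u∈G → proj₁ (proj₂ (proj₂ (hβ u u∈G)))) supp) sum≈1
      , λ c → ≈-trans (x≈ c) (combination-substitute (λ u u∈G → proj₂ (proj₂ (proj₂ (hβ u u∈G)))) supp c)

  module Subdivision {n n′ N} {v : Fin n → Fin N → Carrier} {v′ : Fin n′ → Fin N → Carrier}
    (Face : Subset n → Set) (Face′ : Subset n′ → Set)
    (Face′-down-closed : ∀ {G H} → G ⊆ H → Face′ H → Face′ G)
    (independent : ∀ F → Face F → AffinelyIndependent v F)
    (intersection : ∀ F G → Face F → Face G → ∀ x → conv v F x → conv v G x → conv v (F ∩ G) x)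
    (independent′ : ∀ F → Face′ F → AffinelyIndependent v′ F)
    (intersection′ : ∀ F G → Face′ F → Face′ G → ∀ x → conv v′ F x → conv v′ G x → conv v′ (F ∩ G) x)
    (refines : ∀ G → Face′ G → ∃[ F ] Face F × conv v′ G ⊆ᵖ conv v F)
    (covers : ∀ F → Face F → ∀ x → conv v F x → ¬ ¬ (∃[ G ] Face′ G × conv v′ G x))
    {F : Subset n} (F-face : Face F)
    where

    Restriction : Subset n → Subset n′ → Set
    Restriction E G = Face′ G × conv v′ G ⊆ᵖ conv v E

    IsCoordinate : (Fin n′ → Fin n → Carrier) → Fin n′ → Set
    IsCoordinate b u = (∀ c → 0# ≲ b u c) × SupportedOn (b u) F ×
      (Restriction F ⁅ u ⁆ → IsConvexWeight v F (v′ u) (b u))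

    coordinates : ¬ ¬ (Σ[ b ∈ (Fin n′ → Fin n → Carrier) ] (∀ u → IsCoordinate b u))
    coordinates = do
      b ← ¬¬-Fin at
      return ((λ u → proj₁ (b u)) , λ u → proj₂ (b u))
      where
      at : ∀ u → ¬ ¬ (Σ[ β ∈ (Fin n → Carrier) ] (∀ c → 0# ≲ β c) × SupportedOn β F ×
             (Restriction F ⁅ u ⁆ → IsConvexWeight v F (v′ u) β))
      at u = do
        yes (_ , ⊆F) ← ¬¬-excluded-middle {A = Restriction F ⁅ u ⁆}
          -- Indices that are not vertices of the triangulation of `F` get the zero vector.
          where no ¬r → return ((λ _ → 0#) , (λ _ → ≲-refl) , (λ _ _ → ≈-refl) , λ r → ⊥-elim (¬r r))
        let β , hβ = ⊆F (vertex∈conv v′ (x∈⁅x⁆ u))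
        return (β , proj₁ hβ , proj₁ (proj₂ hβ) , λ _ → hβ)

    module Cone (b : Fin n′ → Fin n → Carrier) (hb : ∀ u → IsCoordinate b u) where

      vertex-weight : ∀ {G u} → Restriction F G → u ∈ G → IsConvexWeight v F (v′ u) (b u)
      vertex-weight {G} {u} (fG , G⊆F) u∈G = proj₂ (proj₂ (hb u)) (Face′-down-closed ⁅u⁆⊆G fG , λ h → G⊆F (conv-⊆ ⁅u⁆⊆G h))
        where
        ⁅u⁆⊆G : ⁅ u ⁆ ⊆ G
        ⁅u⁆⊆G x∈ = subst (_∈ G) (≡.sym (x∈⁅y⁆⇒x≡y u x∈)) u∈G

      point′ : (Fin n′ → Carrier) → Fin n → Carrier
      point′ w c = w ∙ (λ u → b u c)

      module _ {G} (cG : Restriction F G) {w : Fin n′ → Carrier} (supp : SupportedOn w G) where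

        sum-point′ : sum (point′ w) ≈ sum w
        sum-point′ = sum-substitute {v = v} {v′} {G} b (λ u u∈G → proj₁ (proj₂ (proj₂ (vertex-weight cG u∈G)))) supp

        combination-point′ : ∀ c → combination w v′ c ≈ combination (point′ w) v c
        combination-point′ = combination-substitute {v = v} {v′} {G} b (λ u u∈G → proj₂ (proj₂ (proj₂ (vertex-weight cG u∈G)))) supp

      *-supported : ∀ {m} {w : Fin m → Carrier} {G} r → SupportedOn w G → SupportedOn (λ u → r * w u) G
      *-supported r supp u u∉G = ≈-trans (*-congˡ (supp u u∉G)) (zeroʳ r)

      sum-* : ∀ {m} r (w : Fin m → Carrier) → sum (λ u → r * w u) ≈ r * sum w
      sum-* r w = ≈-sym (*-distribˡ-sum r w)

      ι-inverse : ∀ {r s} → s ℚ.* r ≡ 1ℚ → ι s * ι r ≈ 1#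
      ι-inverse {r} {s} eq = ≈-trans (≈-sym (ι-* s r)) (subst (λ z → ι z ≈ 1#) (≡.sym eq) ι-1)

      -- Scaling by `1 / r` turns the common point of the cones into a common point of the two
      -- simplices. The intersection axiom gives it weights on `G ∩ H`, and uniqueness in `G`
      -- identifies these with the scaled `w`.
      cells-intersect : ∀ {G H} → Restriction F G → Restriction F H → ∀ w z r → SupportedOn w G → SupportedOn z H →
        (∀ u → 0# ≲ w u) → (∀ u → 0# ≲ z u) → (∀ c → point′ w c ≈ point′ z c) →
        sum w ≈ ι r → 0ℚ ℚ.< r → SupportedOn w H
      cells-intersect {G} {H} cG cH w z r w-supp z-supp w≥0 z≥0 w≈z sum-w≈r 0<r u u∉H =
        *-cancel-0 (ι-positive 0<s ∘ reflexive) (≈-trans (≈-sym (y≈sw u)) (proj₁ (proj₂ (proj₂ y-in)) u (u∉H ∘ proj₂ ∘ x∈p∩q⁻ G H)))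
        where
        s : ℚ
        s = proj₁ (inverse r 0<r)
        0<s : 0ℚ ℚ.< s
        0<s = proj₁ (proj₂ (inverse r 0<r))
        sr≈1 : ι s * ι r ≈ 1#
        sr≈1 = ι-inverse {r} {s} (proj₂ (proj₂ (inverse r 0<r)))
        x : Fin N → Carrier
        x = combination (λ u → ι s * w u) v′
        sum-z≈r : sum z ≈ ι r
        sum-z≈r = ≈-trans (≈-sym (sum-point′ cH z-supp)) (≈-trans (sum-cong-≋ (λ c → ≈-sym (w≈z c)))
          (≈-trans (sum-point′ cG w-supp) sum-w≈r))
        x∈G : conv v′ G x
        x∈G = (λ u → ι s * w u) , (λ u → *-mono (ι-nonneg (ℚ.<⇒≤ 0<s)) (w≥0 u)) , *-supported (ι s) w-supp
          , ≈-trans (sum-* (ι s) w) (≈-trans (*-congˡ sum-w≈r) sr≈1) , λ c → ≈-refl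
        x≈z : ∀ c → x c ≈ combination (λ u → ι s * z u) v′ c
        x≈z c = begin
          combination (λ u → ι s * w u) v′ c         ≈⟨ ∙-*ˡ (ι s) w _ ⟩
          ι s * combination w v′ c                   ≈⟨ *-congˡ (combination-point′ cG w-supp c) ⟩
          ι s * combination (point′ w) v c           ≈⟨ *-congˡ (∙-congʳ w≈z) ⟩
          ι s * combination (point′ z) v c           ≈⟨ *-congˡ (≈-sym (combination-point′ cH z-supp c)) ⟩
          ι s * combination z v′ c                   ≈⟨ ≈-sym (∙-*ˡ (ι s) z _) ⟩
          combination (λ u → ι s * z u) v′ c         ∎
          where open ≈-Reasoning
        x∈H : conv v′ H x
        x∈H = (λ u → ι s * z u) , (λ u → *-mono (ι-nonneg (ℚ.<⇒≤ 0<s)) (z≥0 u)) , *-supported (ι s) z-supp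
          , ≈-trans (sum-* (ι s) z) (≈-trans (*-congˡ sum-z≈r) sr≈1) , x≈z
        y-in : conv v′ (G ∩ H) x
        y-in = intersection′ G H (proj₁ cG) (proj₁ cH) x x∈G x∈H
        y≈sw : ∀ u → proj₁ y-in u ≈ ι s * w u
        y≈sw = convex-weights-unique {v = v′} (independent′ G (proj₁ cG))
          (λ i i∉G → proj₁ (proj₂ (proj₂ y-in)) i (i∉G ∘ p∩q⊆p G H)) (*-supported (ι s) w-supp)
          (≈-trans (proj₁ (proj₂ (proj₂ (proj₂ y-in)))) (≈-sym (proj₁ (proj₂ (proj₂ (proj₂ x∈G))))))
          (λ c → ≈-sym (proj₂ (proj₂ (proj₂ (proj₂ y-in))) c))

      -- The cell given by covers may stick out of F, but its face H spanned by the
      -- vertices of positive weight does not, by the intersection axiom for Δ.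
      cells-cover : ∀ y r → (∀ c → 0# ≲ y c) → SupportedOn y F → sum y ≈ ι r → 0ℚ ℚ.< r →
        ¬ ¬ (∃[ G ] Restriction F G × (Σ[ w ∈ (Fin n′ → Carrier) ]
          SupportedOn w G × (∀ u → 0# ≲ w u) × (∀ c → point′ w c ≈ y c)))
      cells-cover y r y≥0 y-supp sum-y≈r 0<r = do
        G , fG , x∈G ← covers F F-face x x∈F
        let F₂ , fF₂ , G⊆F₂ = refines G fG
        w≈0? ← ¬¬-Fin (λ u → ¬¬-excluded-middle {A = ¬ proj₁ x∈G u ≈ 0#})
        return (from-cell G fG x∈G F₂ fF₂ G⊆F₂ (comprehension w≈0?))
        where
        s : ℚ
        s = proj₁ (inverse r 0<r)
        0<s : 0ℚ ℚ.< s
        0<s = proj₁ (proj₂ (inverse r 0<r))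
        sr≈1 : ι s * ι r ≈ 1#
        sr≈1 = ι-inverse {r} {s} (proj₂ (proj₂ (inverse r 0<r)))
        y′ : Fin n → Carrier
        y′ c = ι s * y c
        x : Fin N → Carrier
        x = combination y′ v
        sum-y′≈1 : sum y′ ≈ 1#
        sum-y′≈1 = ≈-trans (sum-* (ι s) y) (≈-trans (*-congˡ sum-y≈r) sr≈1)
        x∈F : conv v F x
        x∈F = y′ , (λ c → *-mono (ι-nonneg (ℚ.<⇒≤ 0<s)) (y≥0 c)) , *-supported (ι s) y-supp , sum-y′≈1 , λ c → ≈-refl
        from-cell : ∀ G → Face′ G → (x∈G : conv v′ G x) → ∀ F₂ → Face F₂ → conv v′ G ⊆ᵖ conv v F₂ →
          (Σ[ H ∈ Subset n′ ] (∀ u → u ∈ H → ¬ proj₁ x∈G u ≈ 0#) × (∀ u → ¬ proj₁ x∈G u ≈ 0# → u ∈ H)) →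
          ∃[ G ] Restriction F G × (Σ[ w ∈ (Fin n′ → Carrier) ]
            SupportedOn w G × (∀ u → 0# ≲ w u) × (∀ c → point′ w c ≈ y c))
        from-cell G fG x∈G@(w , w≥0 , w-supp , sum-w≈1 , x≈w) F₂ fF₂ G⊆F₂ (H , H⇒≉0 , ≉0⇒H) =
          H , cH , (λ u → ι r * w u) , *-supported (ι r) w-supp-H
            , (λ u → *-mono (ι-nonneg (ℚ.<⇒≤ 0<r)) (w≥0 u)) , λ c → begin
              point′ (λ u → ι r * w u) c       ≈⟨ ∙-*ˡ (ι r) w _ ⟩
              ι r * point′ w c                 ≈⟨ *-congˡ (point≈y′ c) ⟩
              ι r * (ι s * y c)                ≈⟨ solve 3 (λ r s y → r :* (s :* y) := (s :* r) :* y) ≈-refl (ι r) (ι s) (y c) ⟩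
              (ι s * ι r) * y c                ≈⟨ *-congʳ sr≈1 ⟩
              1# * y c                         ≈⟨ *-identityˡ (y c) ⟩
              y c                              ∎
          where
          open ≈-Reasoning
          w-supp-H : SupportedOn w H
          w-supp-H u u∉H = ≈-stable λ wu≉0 → u∉H (≉0⇒H u wu≉0)
          H⊆G : H ⊆ G
          H⊆G {u} u∈H = case u ∈? G of λ
            { (yes u∈G) → u∈G
            ; (no  u∉G) → ⊥-elim (H⇒≉0 u u∈H (w-supp u u∉G)) }
          β-with : ∀ u → Dec (u ∈ G) → Fin n → Carrier
          β-with u (yes u∈G) = proj₁ (G⊆F₂ (vertex∈conv v′ u∈G))
          β-with u (no  _)   = λ _ → 0#
          β : Fin n′ → Fin n → Carrier
          β u = β-with u (u ∈? G)
          β-convex-with : ∀ u (d : Dec (u ∈ G)) → u ∈ G → IsConvexWeight v F₂ (v′ u) (β-with u d)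
          β-convex-with u (yes u∈G) _   = proj₂ (G⊆F₂ (vertex∈conv v′ u∈G))
          β-convex-with u (no  u∉G) u∈G = ⊥-elim (u∉G u∈G)
          β-convex : ∀ u → u ∈ G → IsConvexWeight v F₂ (v′ u) (β u)
          β-convex u = β-convex-with u (u ∈? G)
          β-nonneg-with : ∀ u (d : Dec (u ∈ G)) j → 0# ≲ β-with u d j
          β-nonneg-with u (yes u∈G) = proj₁ (proj₂ (G⊆F₂ (vertex∈conv v′ u∈G)))
          β-nonneg-with u (no  _)   = λ _ → ≲-refl
          x∈F₂ : conv v F₂ x
          x∈F₂ = conv-substitute {v = v} {v′} {G} β β-convex x∈G
          x∈F∩F₂ : conv v (F ∩ F₂) x
          x∈F∩F₂ = intersection F F₂ F-face fF₂ x x∈F x∈F₂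
          x-weights : ∀ j → proj₁ x∈F₂ j ≈ proj₁ x∈F∩F₂ j
          x-weights = convex-weights-unique {v = v} (independent F₂ fF₂)
            (proj₁ (proj₂ (proj₂ x∈F₂))) (λ j j∉F₂ → proj₁ (proj₂ (proj₂ x∈F∩F₂)) j (j∉F₂ ∘ p∩q⊆q F F₂))
            (≈-trans (proj₁ (proj₂ (proj₂ (proj₂ x∈F₂)))) (≈-sym (proj₁ (proj₂ (proj₂ (proj₂ x∈F∩F₂))))))
            (λ c → ≈-trans (≈-sym (proj₂ (proj₂ (proj₂ (proj₂ x∈F₂))) c)) (proj₂ (proj₂ (proj₂ (proj₂ x∈F∩F₂))) c))
          -- Over `F₂`, the point `x` has the weights `∑ w u * β u j`, which vanish for `j` off `F`.
          -- All summands are non-negative, so each is zero, and `w u` is non-zero on `H`.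
          β-supp : ∀ u → u ∈ H → SupportedOn (β u) F
          β-supp u u∈H j j∉F = *-cancel-0 (H⇒≉0 u u∈H)
            (sum-nonneg-zero {f = λ u → w u * β u j} (λ u → *-mono (w≥0 u) (β-nonneg-with u (u ∈? G) j))
              (≈-trans (x-weights j) (proj₁ (proj₂ (proj₂ x∈F∩F₂)) j (j∉F ∘ p∩q⊆p F F₂))) u)
          cH : Restriction F H
          cH = Face′-down-closed H⊆G fG , conv-substitute {v = v} {v′} {H} β (λ u u∈H →
            let β≥0 , _ , sum≈1 , v′≈ = β-convex u (H⊆G u∈H) in β≥0 , β-supp u u∈H , sum≈1 , v′≈)
          point≈y′ : ∀ c → point′ w c ≈ y′ c
          point≈y′ = convex-weights-unique {v = v} (independent F F-face)
            (λ j j∉F → sum-zero (λ u → ≈-trans (*-congˡ (proj₁ (proj₂ (hb u)) j j∉F)) (zeroʳ (w u))))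
            (*-supported (ι s) y-supp)
            (≈-trans (sum-point′ cH w-supp-H) (≈-trans sum-w≈1 (≈-sym sum-y′≈1)))
            (λ c → ≈-trans (≈-sym (combination-point′ cH w-supp-H c)) (≈-sym (x≈w c)))

      coneComplex : ConeComplex F n′
      coneComplex = record
        { b = b
        ; Cell = Restriction F
        ; down-closed = λ {G} {H} G⊆H (fH , H⊆F) → Face′-down-closed G⊆H fH , λ {x} h → H⊆F (conv-⊆ {v = v′} G⊆H {x} h)
        ; b-nonneg = λ u → proj₁ (hb u)
        ; b-supported = λ u → proj₁ (proj₂ (hb u))
        ; b-sum = λ cG u∈G → proj₁ (proj₂ (proj₂ (vertex-weight cG u∈G)))
        ; independent = λ {G} cG w supp w≈0 → independent′ G (proj₁ cG) w supp
            (≈-trans (≈-sym (sum-point′ cG supp)) (sum-zero w≈0))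
            (λ c → ≈-trans (combination-point′ cG supp c) (sum-zero (λ j → ≈-trans (*-congʳ (w≈0 j)) (zeroˡ _))))
        ; intersection = cells-intersect
        ; covers = cells-cover
        }

      -- By affine independence of `F`, lying in a subface `E` can be read off from the vanishing of
      -- barycentric coordinates; `restriction⁺` is the converse.
      restriction⁻ : ∀ {E G} → E ⊆ F → Restriction E G → Restriction F G × (∀ u → u ∈ G → SupportedOn (b u) E)
      restriction⁻ {E} {G} E⊆F (fG , G⊆E) = cG , λ u u∈G j j∉E →
        let e , e-convex = G⊆E (vertex∈conv v′ u∈G)
            _ , e-supp , sum-e≈1 , v′≈e = IsConvexWeight-⊆ {v = v} {x = v′ u} E⊆F e-convex
            _ , b-supp , sum-b≈1 , v′≈b = vertex-weight cG u∈G
        in ≈-trans (convex-weights-unique {v = v} (independent F F-face) b-supp e-supp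
             (≈-trans sum-b≈1 (≈-sym sum-e≈1)) (λ c → ≈-trans (≈-sym (v′≈b c)) (v′≈e c)) j)
             (proj₁ (proj₂ e-convex) j j∉E)
        where
        cG : Restriction F G
        cG = fG , λ {x} h → conv-⊆ {v = v} E⊆F {x} (G⊆E h)

      restriction⁺ : ∀ {E G} → Restriction F G → (∀ u → u ∈ G → SupportedOn (b u) E) → Restriction E G
      restriction⁺ {E} {G} cG b-supp = proj₁ cG , conv-substitute {v = v} {v′} {G} b (λ u u∈G →
        let b≥0 , _ , sum≈1 , v′≈ = vertex-weight cG u∈G in b≥0 , b-supp u u∈G , sum≈1 , v′≈)

-- Coefficients of interlacing polynomials

module RealRootedPolynomials (K : ArchimedeanRing) where

  open OrderedAlgebra K

  -- The relation `p = (X - r) p₁`, coefficient by coefficient.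
  record IsLinearMultiple (r : Carrier) (p₁ p : ℕ → Carrier) : Set where
    constructor linearMultiple
    field
      constant : p 0 ≈ - (r * p₁ 0)
      higher   : ∀ k → p (suc k) ≈ p₁ k + - (r * p₁ (suc k))

  IsProduct : ∀ {m} → (Fin m → Carrier) → (ℕ → Carrier) → Set
  IsProduct {zero}  r p = p 0 ≈ 1# × (∀ k → p (suc k) ≈ 0#)
  IsProduct {suc m} r p = Σ[ p₁ ∈ (ℕ → Carrier) ] IsProduct (r ∘ suc) p₁ × IsLinearMultiple (r zero) p₁ p

  monic : ∀ {m} {r : Fin m → Carrier} {p} → IsProduct r p → p m ≈ 1# × (∀ k → m ℕ.< k → p k ≈ 0#)
  monic {zero}      (p₀≈1 , p₊≈0) = p₀≈1 , λ { (suc k) _ → p₊≈0 k }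
  monic {suc m} {r} (p₁ , isP₁ , linearMultiple constant higher) =
    let p₁m≈1 , p₁>m≈0 = monic isP₁
    in ≈-trans (higher m) (≈-trans (+-cong p₁m≈1 (times-zero (p₁>m≈0 (suc m) (ℕ.n<1+n m)))) (+-identityʳ 1#))
     , λ { (suc k) (ℕ.s≤s m<k) → ≈-trans (higher k) (≈-trans
         (+-cong (p₁>m≈0 k m<k) (times-zero (p₁>m≈0 (suc k) (ℕ.<-trans m<k (ℕ.n<1+n k))))) (+-identityʳ 0#)) }
    where
    times-zero : ∀ {x} → x ≈ 0# → - (r zero * x) ≈ 0#
    times-zero x≈0 = ≈-trans (-‿cong (≈-trans (*-congˡ x≈0) (zeroʳ (r zero)))) -0≈0

  *-nonpos : ∀ {r x} → r ≲ 0# → 0# ≲ x → 0# ≲ - (r * x)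
  *-nonpos {r} {x} r≲0 0≲x = 0≲-resp (solve 2 (λ r x → :- r :* x := :- (r :* x)) ≈-refl r x) (*-mono (x≲0⇒0≲-x r≲0) 0≲x)

  coefficients-nonneg : ∀ {m} {r : Fin m → Carrier} {p : ℕ → Carrier} → (∀ i → r i ≲ 0#) → IsProduct r p → ∀ k → 0# ≲ p k
  coefficients-nonneg {zero} r≲0 (p₀≈1 , p₊≈0) zero    = 0≲-resp (≈-sym p₀≈1) (total 1≰0)
  coefficients-nonneg {zero} r≲0 (p₀≈1 , p₊≈0) (suc k) = reflexive (≈-sym (p₊≈0 k))
  coefficients-nonneg {suc m} r≲0 (p₁ , isP₁ , linearMultiple constant higher) zero =
    0≲-resp (≈-sym constant) (*-nonpos (r≲0 zero) (coefficients-nonneg (r≲0 ∘ suc) isP₁ 0))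
  coefficients-nonneg {suc m} r≲0 (p₁ , isP₁ , linearMultiple constant higher) (suc k) =
    0≲-resp (≈-sym (higher k)) (+-nonneg (coefficients-nonneg (r≲0 ∘ suc) isP₁ k)
      (*-nonpos (r≲0 zero) (coefficients-nonneg (r≲0 ∘ suc) isP₁ (suc k))))

  -- If r > 0 and (X - r) p₁ has non-negative coefficients, then all
  -- coefficients of p₁ are non-positive.
  zero-nonpos : ∀ {m} {r : Fin (suc m) → Carrier} {p : ℕ → Carrier} → IsProduct r p → (∀ k → 0# ≲ p k) → r zero ≲ 0#
  zero-nonpos {m} {r} {p} (p₁ , isP₁ , linearMultiple constant higher) p≥0 = stable λ r₀≰0 →
    -- The cofactor is monic, so its coefficients cannot all be non-positive.
    1≰0 (≲-resp (proj₁ (monic isP₁)) ≈-refl (cofactor≲0 r₀≰0 m))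
    where
    cancel : ∀ {x} → ¬ r zero ≲ 0# → 0# ≲ - (r zero * x) → x ≲ 0#
    cancel {x} r₀≰0 h = 0≲-x⇒x≲0 (*-cancel-nonneg r₀≰0 (0≲-resp
      (solve 2 (λ r x → :- (r :* x) := r :* :- x) ≈-refl (r zero) x) h))
    cofactor≲0 : ¬ r zero ≲ 0# → ∀ k → p₁ k ≲ 0#
    cofactor≲0 r₀≰0 zero    = cancel r₀≰0 (0≲-resp constant (p≥0 0))
    cofactor≲0 r₀≰0 (suc k) = cancel r₀≰0 (transitive (0≲-resp (higher k) (p≥0 (suc k)))
      (≲-resp ≈-refl (+-identityˡ _) (+-mono (cofactor≲0 r₀≰0 k) ≲-refl)))

  -- The minors of (f , x ^ s * g) for all s ≥ 0. This family, unlike s = 0 alone,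
  -- is preserved when f and g are multiplied by X - r and X - s with r ≤ s ≤ 0.
  Dominated : (f g : ℕ → Carrier) → Set
  Dominated f g = ∀ i c t → c ℕ.≤ i → f (i ℕ.+ t) * g c ≲ f i * g (c ℕ.+ t)

  dominated-t≡0 : ∀ (f g : ℕ → Carrier) i c → f (i ℕ.+ 0) * g c ≲ f i * g (c ℕ.+ 0)
  dominated-t≡0 f g i c rewrite ℕ.+-identityʳ i | ℕ.+-identityʳ c = ≲-refl

  -- With `ρ = - r` and `σ = - s`, so that `ρ ≥ σ ≥ 0`, every new minor expands into old minors and
  -- products of old coefficients, with multipliers `1`, `ρσ`, `σ` and `ρ - σ`, all non-negative.
  dominated-shift : ∀ {r s f₁ f g₁ g} → r ≲ s → s ≲ 0# → IsLinearMultiple r f₁ f → IsLinearMultiple s g₁ g →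
    (∀ k → 0# ≲ f₁ k) → (∀ k → 0# ≲ g₁ k) → Dominated f₁ g₁ → Dominated f g
  dominated-shift {r} {s} {f₁} {f} {g₁} {g} r≲s s≲0 (linearMultiple f-0 f-suc) (linearMultiple g-0 g-suc) f₁≥0 g₁≥0 dom = λ
    { i c zero c≤i → dominated-t≡0 f g i c
    -- At index 0 the coefficient of index -1 is absent, so the terms containing it drop out of the
    -- general expansion.
    ; zero zero (suc t) _ → difference (0≲-resp
        (≈-trans
          (solve 8 (λ r s b c d a′ b′ h →
            (:- r :* :- s) :* (b :* d :- b′ :* h) :+ :- s :* (b :* c :- a′ :* h) :+ (s :- r) :* (b :* c)
            := (:- (r :* b)) :* (c :+ :- (s :* d)) :- (a′ :+ :- (r :* b′)) :* (:- (s :* h))) ≈-refl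
            r s (f₁ 0) (g₁ t) (g₁ (suc t)) (f₁ t) (f₁ (suc t)) (g₁ 0))
          (≈-sym (+-cong (*-cong f-0 (g-suc t)) (-‿cong (*-cong (f-suc t) g-0)))))
        (+-nonneg (+-nonneg (*-mono ρσ≥0 (x≲y⇒0≲y-x (dom 0 0 (suc t) ℕ.z≤n))) (*-mono σ≥0 (x≲y⇒0≲y-x (dom 0 0 t ℕ.z≤n))))
          (*-mono ρ-σ≥0 (*-mono (f₁≥0 0) (g₁≥0 t)))))
    ; (suc i) zero (suc t) _ → difference (0≲-resp
        (≈-trans
          (solve 9 (λ r s a b c d a′ b′ h →
            (a :* c :+ :- s :* (a :* d)) :+ (:- r :* :- s) :* (b :* d :- b′ :* h) :+ :- s :* (b :* c :- a′ :* h) :+ (s :- r) :* (b :* c)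
            := (a :+ :- (r :* b)) :* (c :+ :- (s :* d)) :- (a′ :+ :- (r :* b′)) :* (:- (s :* h))) ≈-refl
            r s (f₁ i) (f₁ (suc i)) (g₁ t) (g₁ (suc t)) (f₁ (i ℕ.+ suc t)) (f₁ (suc (i ℕ.+ suc t))) (g₁ 0))
          (≈-sym (+-cong (*-cong (f-suc i) (g-suc t)) (-‿cong (*-cong (f-suc (i ℕ.+ suc t)) g-0)))))
        (+-nonneg (+-nonneg (+-nonneg
          (+-nonneg (*-mono (f₁≥0 i) (g₁≥0 t)) (*-mono σ≥0 (*-mono (f₁≥0 i) (g₁≥0 (suc t)))))
          (*-mono ρσ≥0 (x≲y⇒0≲y-x (dom (suc i) 0 (suc t) ℕ.z≤n))))
          (*-mono σ≥0 (x≲y⇒0≲y-x (subst (λ k → f₁ k * g₁ 0 ≲ f₁ (suc i) * g₁ t) (≡.sym (ℕ.+-suc i t)) (dom (suc i) 0 t ℕ.z≤n)))))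
          (*-mono ρ-σ≥0 (*-mono (f₁≥0 (suc i)) (g₁≥0 t)))))
    ; (suc i) (suc c) (suc t) (ℕ.s≤s c≤i) → difference (0≲-resp
        (≈-trans
          (solve 10 (λ r s a b c d a′ b′ e h →
            (a :* c :- a′ :* e) :+ (:- r :* :- s) :* (b :* d :- b′ :* h)
              :+ :- s :* ((a :* d :- b′ :* e) :+ (b :* c :- a′ :* h)) :+ (s :- r) :* (b :* c :- b′ :* e)
            := (a :+ :- (r :* b)) :* (c :+ :- (s :* d)) :- (a′ :+ :- (r :* b′)) :* (e :+ :- (s :* h))) ≈-refl
            r s (f₁ i) (f₁ (suc i)) (g₁ (c ℕ.+ suc t)) (g₁ (suc (c ℕ.+ suc t)))
            (f₁ (i ℕ.+ suc t)) (f₁ (suc (i ℕ.+ suc t))) (g₁ c) (g₁ (suc c)))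
          (≈-sym (+-cong (*-cong (f-suc i) (g-suc (c ℕ.+ suc t))) (-‿cong (*-cong (f-suc (i ℕ.+ suc t)) (g-suc c))))))
        (+-nonneg (+-nonneg (+-nonneg
          (x≲y⇒0≲y-x (dom i c (suc t) c≤i))
          (*-mono ρσ≥0 (x≲y⇒0≲y-x (dom (suc i) (suc c) (suc t) (ℕ.s≤s c≤i)))))
          (*-mono σ≥0 (+-nonneg
            (x≲y⇒0≲y-x (≡.subst₂ (λ k l → f₁ k * g₁ c ≲ f₁ i * g₁ l) (ℕ.+-suc i (suc t)) (ℕ.+-suc c (suc t)) (dom i c (suc (suc t)) c≤i)))
            (x≲y⇒0≲y-x (≡.subst₂ (λ k l → f₁ k * g₁ (suc c) ≲ f₁ (suc i) * g₁ l) (≡.sym (ℕ.+-suc i t)) (≡.sym (ℕ.+-suc c t))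
              (dom (suc i) (suc c) t (ℕ.s≤s c≤i)))))))
          -- This minor has its indices `suc i` and `c` one further apart than the minor being
          -- proved: the reason to carry all `c ≤ i` through the induction.
          (*-mono ρ-σ≥0 (x≲y⇒0≲y-x (dom (suc i) c (suc t) (ℕ.m≤n⇒m≤1+n c≤i)))))) }
    where
    σ≥0 : 0# ≲ - s
    σ≥0 = x≲0⇒0≲-x s≲0
    ρσ≥0 : 0# ≲ - r * - s
    ρσ≥0 = *-mono (x≲0⇒0≲-x (transitive r≲s s≲0)) σ≥0
    ρ-σ≥0 : 0# ≲ s + - r
    ρ-σ≥0 = x≲y⇒0≲y-x r≲s
    difference : ∀ {x y} → 0# ≲ y + - x → x ≲ y
    difference = 0≲y-x⇒x≲y

  -- Factors are removed in pairs of equal index. Once `f` has run out of factors it is the constant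
  -- 1, and the left side is zero unless both sides agree.
  products-dominated : ∀ {m n} {r : Fin m → Carrier} {s : Fin n → Carrier} {f g : ℕ → Carrier} → m ℕ.≤ n →
    (∀ i → r i ≲ 0#) → (∀ j → s j ≲ 0#) → (∀ i j → toℕ i ≡ toℕ j → r i ≲ s j) →
    IsProduct r f → IsProduct s g → Dominated f g
  products-dominated {zero} {r = r} {s} {f} {g} _ r≲0 s≲0 r≲s isF isG = λ
    { zero    zero zero    _ → ≲-refl
    ; zero    zero (suc t) _ → below (zero-coefficient t) 0 (suc t)
    ; (suc i) c    t       _ → below (zero-coefficient (i ℕ.+ t)) (suc i) (c ℕ.+ t) }
    where
    zero-coefficient : ∀ k → f (suc k) ≈ 0#
    zero-coefficient = proj₂ isF
    below : ∀ {x y} → x ≈ 0# → ∀ k l → x * y ≲ f k * g l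
    below {x} {y} x≈0 k l = transitive (reflexive (≈-trans (*-congʳ x≈0) (zeroˡ y)))
      (*-mono (coefficients-nonneg {r = r} {f} r≲0 isF k) (coefficients-nonneg {r = s} {g} s≲0 isG l))
  products-dominated {suc m} {suc n} (ℕ.s≤s m≤n) r≲0 s≲0 r≲s (f₁ , isF₁ , f-shift) (g₁ , isG₁ , g-shift) =
    dominated-shift (r≲s zero zero refl) (s≲0 zero) f-shift g-shift
      (coefficients-nonneg (r≲0 ∘ suc) isF₁) (coefficients-nonneg (s≲0 ∘ suc) isG₁)
      (products-dominated m≤n (r≲0 ∘ suc) (s≲0 ∘ suc) (λ i j eq → r≲s (suc i) (suc j) (cong suc eq)) isF₁ isG₁)

  zeros-nonpos : ∀ {m} {r : Fin m → Carrier} {a} {p f : ℕ → Carrier} → ¬ a ≲ 0# → IsProduct r p →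
    (∀ k → f k ≈ a * p k) → (∀ k → 0# ≲ f k) →
    (∀ i j → toℕ i ℕ.≤ toℕ j → r j ≲ r i) → ∀ i → r i ≲ 0#
  zeros-nonpos {suc m} {r} {p = p} a>0 isP f≈ap f≥0 r-antitone i = transitive (r-antitone zero i ℕ.z≤n)
    (zero-nonpos {r = r} {p} isP (λ k → *-cancel-nonneg a>0 (0≲-resp (f≈ap k) (f≥0 k))))

  interlacing-minor : ∀ {m n} {r : Fin m → Carrier} {s : Fin n → Carrier} {a b} {p q f g : ℕ → Carrier} →
    ¬ a ≲ 0# → ¬ b ≲ 0# → IsProduct r p → IsProduct s q →
    (∀ k → f k ≈ a * p k) → (∀ k → g k ≈ b * q k) → (∀ k → 0# ≲ f k) → (∀ k → 0# ≲ g k) →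
    (∀ i j → toℕ i ℕ.≤ toℕ j → r j ≲ r i) → (∀ i j → toℕ i ℕ.≤ toℕ j → s j ≲ s i) →
    m ℕ.≤ n → (∀ i j → toℕ i ≡ toℕ j → r i ≲ s j) →
    ∀ i t → f (i ℕ.+ t) * g i ≲ f i * g (i ℕ.+ t)
  interlacing-minor {a = a} {b} {p} {q} {f} {g} a>0 b>0 isP isQ f≈ g≈ f≥0 g≥0 r-antitone s-antitone m≤n r≲s i t = 0≲y-x⇒x≲y
    (0≲-resp
      (≈-trans (solve 6 (λ a b x y z w → (a :* b) :* (x :* y :- z :* w) := (a :* x) :* (b :* y) :- (a :* z) :* (b :* w)) ≈-refl
          a b (p i) (q (i ℕ.+ t)) (p (i ℕ.+ t)) (q i))
        (≈-sym (+-cong (*-cong (f≈ i) (g≈ (i ℕ.+ t))) (-‿cong (*-cong (f≈ (i ℕ.+ t)) (g≈ i))))))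
      (*-mono (*-mono (total a>0) (total b>0)) (x≲y⇒0≲y-x (products-dominated m≤n
        (zeros-nonpos a>0 isP f≈ f≥0 r-antitone) (zeros-nonpos b>0 isQ g≈ g≥0 s-antitone) r≲s isP isQ i i t ℕ.≤-refl))))

open SemiringSum ℤ.+-*-semiring using (*-distribˡ-sum; *-distribʳ-sum)
open CommutativeMonoidSum ℤ.+-0-commutativeMonoid using () renaming (sum to sumℤ; ∑-comm to sumℤ-comm; sum-cong-≗ to sumℤ-cong)

-- Sums over initial segments of ℕ

∑< : ℕ → (ℕ → ℤ) → ℤ
∑< zero    f = 0ℤ
∑< (suc n) f = f 0 ℤ.+ ∑< n (f ∘ suc)

sumℤ≡∑< : ∀ n (f : ℕ → ℤ) → sumℤ {n} (f ∘ toℕ) ≡ ∑< n f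
sumℤ≡∑< zero    f = refl
sumℤ≡∑< (suc n) f = cong (ℤ._+_ (f 0)) (sumℤ≡∑< n (f ∘ suc))

∑<-cong : ∀ n {f g : ℕ → ℤ} → (∀ i → i ℕ.< n → f i ≡ g i) → ∑< n f ≡ ∑< n g
∑<-cong zero    h = refl
∑<-cong (suc n) h = cong₂ ℤ._+_ (h 0 (ℕ.s≤s ℕ.z≤n)) (∑<-cong n (λ i i<n → h (suc i) (ℕ.s≤s i<n)))

∑<-zero : ∀ n {f : ℕ → ℤ} → (∀ i → f i ≡ 0ℤ) → ∑< n f ≡ 0ℤ
∑<-zero zero    h = refl
∑<-zero (suc n) h = cong₂ ℤ._+_ (h 0) (∑<-zero n (h ∘ suc))

∑<-last : ∀ n (f : ℕ → ℤ) → ∑< (suc n) f ≡ ∑< n f ℤ.+ f n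
∑<-last zero    f = ℤ.+-comm (f 0) 0ℤ
∑<-last (suc n) f = trans (cong (ℤ._+_ (f 0)) (∑<-last n (f ∘ suc))) (sym (ℤ.+-assoc (f 0) _ _))

∑<-+ : ∀ n (f g : ℕ → ℤ) → ∑< n (λ i → f i ℤ.+ g i) ≡ ∑< n f ℤ.+ ∑< n g
∑<-+ zero    f g = refl
∑<-+ (suc n) f g = trans (cong (ℤ._+_ (f 0 ℤ.+ g 0)) (∑<-+ n (f ∘ suc) (g ∘ suc))) (interchange (f 0) (g 0) _ _)
  where
  interchange : ∀ a b c d → (a ℤ.+ b) ℤ.+ (c ℤ.+ d) ≡ (a ℤ.+ c) ℤ.+ (b ℤ.+ d)
  interchange = solve-∀

∑<-neg : ∀ n (f : ℕ → ℤ) → ∑< n (λ i → ℤ.- f i) ≡ ℤ.- ∑< n f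
∑<-neg zero    f = refl
∑<-neg (suc n) f = trans (cong (ℤ._+_ (ℤ.- f 0)) (∑<-neg n (f ∘ suc))) (sym (ℤ.neg-distrib-+ (f 0) _))

-- Binomial inversion

nC0≡1 : ∀ n → n C 0 ≡ 1
nC0≡1 n = trans (nCk≡nC[n∸k] {0} {n} ℕ.z≤n) (nCn≡1 n)

pascal : ∀ n k → + (suc n C suc k) ≡ + (n C k) ℤ.+ + (n C suc k)
pascal n k = cong +_ (sym (nCk+nC[k+1]≡[n+1]C[k+1] n k))

diff : (ℕ → ℤ) → ℕ → ℤ
diff a m = a (suc m) ℤ.- a m

diff^ : ℕ → (ℕ → ℤ) → ℕ → ℤ
diff^ zero    a = a
diff^ (suc k) a = diff^ k (diff a)

diff^-suc : ∀ k a m → diff^ (suc k) a m ≡ diff^ k a (suc m) ℤ.- diff^ k a m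
diff^-suc zero    a m = refl
diff^-suc (suc k) a m = diff^-suc k (diff a) m

-- The `j`-th forward difference of `a` at 0 in closed form; with `a` a row of `𝓕` this is an entry
-- of `fMatrix`.
alternating : (ℕ → ℤ) → ℕ → ℤ
alternating a j = ∑< (suc j) (λ k → -1ℤ ℤ.^ (j ∸ k) ℤ.* + (j C k) ℤ.* a k)

-- Pascal's rule splits each term in two; a shift of the index in one of the two sums then leaves
-- the terms of `diff a`.
alternating-suc : ∀ a j → alternating a (suc j) ≡ alternating (diff a) j
alternating-suc a j = begin
  T 0 ℤ.+ ∑< (suc j) (T ∘ suc)
    ≡⟨ cong (ℤ._+_ (T 0)) (trans (∑<-cong (suc j) (λ k _ → T-suc k)) (∑<-+ (suc j) V (λ k → ℤ.- W (suc k)))) ⟩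
  T 0 ℤ.+ (∑< (suc j) V ℤ.+ ∑< (suc j) (λ k → ℤ.- W (suc k)))
    ≡⟨ cong (λ z → T 0 ℤ.+ (∑< (suc j) V ℤ.+ z)) (∑<-neg (suc j) (W ∘ suc)) ⟩
  T 0 ℤ.+ (∑< (suc j) V ℤ.- ∑< (suc j) (W ∘ suc))
    ≡⟨ cong (ℤ._+ (∑< (suc j) V ℤ.- ∑< (suc j) (W ∘ suc))) T-zero ⟩
  ℤ.- (U 0 ℤ.* a 0) ℤ.+ (∑< (suc j) V ℤ.- ∑< (suc j) (W ∘ suc))
    ≡⟨ regroup (U 0 ℤ.* a 0) (∑< (suc j) V) (∑< (suc j) (W ∘ suc)) ⟩
  ∑< (suc j) V ℤ.+ ℤ.- ∑< (suc (suc j)) W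
    ≡⟨ cong (λ z → ∑< (suc j) V ℤ.+ ℤ.- z)
         (trans (∑<-last (suc j) W) (trans (cong (ℤ._+_ (alternating a j)) U-last) (ℤ.+-identityʳ _))) ⟩
  ∑< (suc j) V ℤ.+ ℤ.- ∑< (suc j) W
    ≡⟨ cong (ℤ._+_ (∑< (suc j) V)) (∑<-neg (suc j) W) ⟨
  ∑< (suc j) V ℤ.+ ∑< (suc j) (λ k → ℤ.- W k)
    ≡⟨ ∑<-+ (suc j) V (λ k → ℤ.- W k) ⟨
  ∑< (suc j) (λ k → U k ℤ.* a (suc k) ℤ.+ ℤ.- (U k ℤ.* a k))
    ≡⟨ ∑<-cong (suc j) (λ k _ → factor (U k) (a (suc k)) (a k)) ⟩
  alternating (diff a) j ∎
  where
  open ≡-Reasoning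
  T U V W : ℕ → ℤ
  T k = -1ℤ ℤ.^ (suc j ∸ k) ℤ.* + (suc j C k) ℤ.* a k
  U k = -1ℤ ℤ.^ (j ∸ k) ℤ.* + (j C k)
  V k = U k ℤ.* a (suc k)
  W k = U k ℤ.* a k
  factor : ∀ u x y → u ℤ.* x ℤ.+ ℤ.- (u ℤ.* y) ≡ u ℤ.* (x ℤ.- y)
  factor = solve-∀
  regroup : ∀ x y z → ℤ.- x ℤ.+ (y ℤ.- z) ≡ y ℤ.+ ℤ.- (x ℤ.+ z)
  regroup = solve-∀
  U-last : U (suc j) ℤ.* a (suc j) ≡ 0ℤ
  U-last = trans (cong (λ z → -1ℤ ℤ.^ (j ∸ suc j) ℤ.* + z ℤ.* a (suc j)) (k>n⇒nCk≡0 {j} {suc j} (ℕ.n<1+n j)))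
    (trans (cong (ℤ._* a (suc j)) (ℤ.*-zeroʳ (-1ℤ ℤ.^ (j ∸ suc j)))) (ℤ.*-zeroˡ (a (suc j))))
  T-zero : T 0 ≡ ℤ.- (U 0 ℤ.* a 0)
  T-zero = trans (cong (λ z → -1ℤ ℤ.^ suc j ℤ.* + z ℤ.* a 0) (trans (nC0≡1 (suc j)) (sym (nC0≡1 j))))
    (minus (-1ℤ ℤ.^ j) (+ (j C 0)) (a 0))
    where
    minus : ∀ p c x → -1ℤ ℤ.* p ℤ.* c ℤ.* x ≡ ℤ.- (p ℤ.* c ℤ.* x)
    minus = solve-∀
  -- For `k ≥ j` truncated subtraction breaks the sign rule, but the binomial coefficient vanishes
  -- there.
  sign-shift : ∀ k → -1ℤ ℤ.^ (j ∸ k) ℤ.* + (j C suc k) ≡ ℤ.- U (suc k)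
  sign-shift k with k ℕ.<? j
  ... | yes k<j = trans (cong (λ e → -1ℤ ℤ.^ e ℤ.* + (j C suc k)) (ℕ.+-∸-assoc 1 k<j))
        (minus (-1ℤ ℤ.^ (j ∸ suc k)) (+ (j C suc k)))
    where
    minus : ∀ p c → -1ℤ ℤ.* p ℤ.* c ≡ ℤ.- (p ℤ.* c)
    minus = solve-∀
  ... | no  k≮j = trans (cong (λ z → -1ℤ ℤ.^ (j ∸ k) ℤ.* + z) C≡0) (trans (ℤ.*-zeroʳ (-1ℤ ℤ.^ (j ∸ k)))
        (sym (trans (cong (λ z → ℤ.- (-1ℤ ℤ.^ (j ∸ suc k) ℤ.* + z)) C≡0) (cong ℤ.-_ (ℤ.*-zeroʳ (-1ℤ ℤ.^ (j ∸ suc k)))))))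
    where
    C≡0 : j C suc k ≡ 0
    C≡0 = k>n⇒nCk≡0 {j} {suc k} (ℕ.s≤s (ℕ.≮⇒≥ k≮j))
  T-suc : ∀ k → T (suc k) ≡ U k ℤ.* a (suc k) ℤ.+ ℤ.- (U (suc k) ℤ.* a (suc k))
  T-suc k = begin
    -1ℤ ℤ.^ (j ∸ k) ℤ.* + (suc j C suc k) ℤ.* a (suc k)
      ≡⟨ cong (λ z → -1ℤ ℤ.^ (j ∸ k) ℤ.* z ℤ.* a (suc k)) (pascal j k) ⟩
    -1ℤ ℤ.^ (j ∸ k) ℤ.* (+ (j C k) ℤ.+ + (j C suc k)) ℤ.* a (suc k)
      ≡⟨ expand (-1ℤ ℤ.^ (j ∸ k)) (+ (j C k)) (+ (j C suc k)) (a (suc k)) ⟩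
    U k ℤ.* a (suc k) ℤ.+ -1ℤ ℤ.^ (j ∸ k) ℤ.* + (j C suc k) ℤ.* a (suc k)
      ≡⟨ cong (λ z → U k ℤ.* a (suc k) ℤ.+ z ℤ.* a (suc k)) (sign-shift k) ⟩
    U k ℤ.* a (suc k) ℤ.+ ℤ.- U (suc k) ℤ.* a (suc k)
      ≡⟨ cong (ℤ._+_ (U k ℤ.* a (suc k))) (ℤ.neg-distribˡ-* (U (suc k)) (a (suc k))) ⟨
    U k ℤ.* a (suc k) ℤ.+ ℤ.- (U (suc k) ℤ.* a (suc k)) ∎
    where
    expand : ∀ p x y z → p ℤ.* (x ℤ.+ y) ℤ.* z ≡ p ℤ.* x ℤ.* z ℤ.+ p ℤ.* y ℤ.* z
    expand = solve-∀

-- Newton's forward difference formula: the shift operator is `1 + diff`, and its `m`-th power is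
-- expanded at 0.
binomial-inversion : ∀ a m → ∑< (suc m) (λ j → alternating a j ℤ.* + (m C j)) ≡ a m
binomial-inversion a zero = simplify (a 0)
  where
  simplify : ∀ x → (1ℤ ℤ.* + 1 ℤ.* x ℤ.+ 0ℤ) ℤ.* + 1 ℤ.+ 0ℤ ≡ x
  simplify = solve-∀
binomial-inversion a (suc m) = begin
  alternating a 0 ℤ.* + (suc m C 0) ℤ.+ ∑< (suc m) (λ j → alternating a (suc j) ℤ.* + (suc m C suc j))
    ≡⟨ cong₂ ℤ._+_ (cong (λ z → alternating a 0 ℤ.* + z) (trans (nC0≡1 (suc m)) (sym (nC0≡1 m))))
         (trans (∑<-cong (suc m) (λ j _ → trans (cong (ℤ._*_ (alternating a (suc j))) (pascal m j))
           (ℤ.*-distribˡ-+ (alternating a (suc j)) (+ (m C j)) (+ (m C suc j))))) (∑<-+ (suc m) g (f ∘ suc))) ⟩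
  f 0 ℤ.+ (∑< (suc m) (λ j → alternating a (suc j) ℤ.* + (m C j)) ℤ.+ ∑< (suc m) (f ∘ suc))
    ≡⟨ regroup (f 0) (∑< (suc m) g) (∑< (suc m) (f ∘ suc)) ⟩
  ∑< (suc m) (λ j → alternating a (suc j) ℤ.* + (m C j)) ℤ.+ ∑< (suc (suc m)) f
    ≡⟨ cong₂ ℤ._+_ (trans (∑<-cong (suc m) (λ j _ → cong (ℤ._* + (m C j)) (alternating-suc a j))) (binomial-inversion (diff a) m))
         (trans (∑<-last (suc m) f) (trans (cong₂ ℤ._+_ (binomial-inversion a m) f-last) (ℤ.+-identityʳ (a m)))) ⟩
  (a (suc m) ℤ.- a m) ℤ.+ a m
    ≡⟨ cancel (a (suc m)) (a m) ⟩
  a (suc m) ∎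
  where
  open ≡-Reasoning
  f g : ℕ → ℤ
  g j = alternating a (suc j) ℤ.* + (m C j)
  f j = alternating a j ℤ.* + (m C j)
  f-last : f (suc m) ≡ 0ℤ
  f-last = trans (cong (λ z → alternating a (suc m) ℤ.* + z) (k>n⇒nCk≡0 {m} {suc m} (ℕ.n<1+n m))) (ℤ.*-zeroʳ (alternating a (suc m)))
  regroup : ∀ x y z → x ℤ.+ (y ℤ.+ z) ≡ y ℤ.+ (x ℤ.+ z)
  regroup = solve-∀
  cancel : ∀ x y → (x ℤ.- y) ℤ.+ y ≡ x
  cancel = solve-∀

-- Entries of the transformation matrix as differences

h→f-entry f→h-entry : ℕ → ℕ → ℕ → ℤ
h→f-entry d i j = if j ≤ᵇ i then + ((d ∸ j) C (i ∸ j)) else 0ℤ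
f→h-entry d i j = if j ≤ᵇ i then -1ℤ ℤ.^ (i ∸ j) ℤ.* + ((d ∸ j) C (i ∸ j)) else 0ℤ

h→f-entry-suc : ∀ d i j → h→f-entry (suc d) (suc i) (suc j) ≡ h→f-entry d i j
h→f-entry-suc d i zero    = refl
h→f-entry-suc d i (suc j) = refl

f→h-entry-suc : ∀ d i j → f→h-entry (suc d) (suc i) (suc j) ≡ f→h-entry d i j
f→h-entry-suc d i zero    = refl
f→h-entry-suc d i (suc j) = refl

-- Newton's formula for the `k`-th difference of `a`: lowering `d`, `j` and `k` together absorbs one
-- difference into `a` and leaves the binomial coefficient unchanged.
alternating-h→f : ∀ a d k → k ℕ.≤ d → ∑< (suc d) (λ j → alternating a j ℤ.* h→f-entry d j k) ≡ diff^ k a (d ∸ k)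
alternating-h→f a d       zero    k≤d = binomial-inversion a d
alternating-h→f a (suc d) (suc k) (ℕ.s≤s k≤d) = begin
  alternating a 0 ℤ.* 0ℤ ℤ.+ ∑< (suc d) (λ j → alternating a (suc j) ℤ.* h→f-entry (suc d) (suc j) (suc k))
    ≡⟨ cong₂ ℤ._+_ (ℤ.*-zeroʳ (alternating a 0))
         (∑<-cong (suc d) (λ j _ → cong₂ ℤ._*_ (alternating-suc a j) (h→f-entry-suc d j k))) ⟩
  0ℤ ℤ.+ ∑< (suc d) (λ j → alternating (diff a) j ℤ.* h→f-entry d j k)
    ≡⟨ ℤ.+-identityˡ _ ⟩
  ∑< (suc d) (λ j → alternating (diff a) j ℤ.* h→f-entry d j k)
    ≡⟨ alternating-h→f (diff a) d k k≤d ⟩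
  diff^ k (diff a) (d ∸ k) ∎
  where open ≡-Reasoning

-- Reassociating the triple product exhibits column `k` as `f→h` applied to a vector of `k`-th
-- differences, which will be the face numbers of a half-open simplex.
transformationMatrix-entry : ∀ d 𝓕 i k → transformationMatrix d 𝓕 i k ≡
  ∑< (suc d) (λ l → f→h-entry d (toℕ i) l ℤ.* diff^ (toℕ k) (λ j → + extend 𝓕 l j) (d ∸ toℕ k))
transformationMatrix-entry d 𝓕 i k = begin
  sumℤ (λ j → sumℤ (λ l → f→h d i l ℤ.* fMatrix d 𝓕 l j) ℤ.* h→f d j k)
    ≡⟨ sumℤ-cong (λ j → *-distribʳ-sum (h→f d j k) (λ l → f→h d i l ℤ.* fMatrix d 𝓕 l j)) ⟩
  sumℤ (λ j → sumℤ (λ l → f→h d i l ℤ.* fMatrix d 𝓕 l j ℤ.* h→f d j k))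
    ≡⟨ sumℤ-comm (λ j l → f→h d i l ℤ.* fMatrix d 𝓕 l j ℤ.* h→f d j k) ⟩
  sumℤ (λ l → sumℤ (λ j → f→h d i l ℤ.* fMatrix d 𝓕 l j ℤ.* h→f d j k))
    ≡⟨ sumℤ-cong (λ l → sumℤ-cong (λ j → ℤ.*-assoc (f→h d i l) (fMatrix d 𝓕 l j) (h→f d j k))) ⟩
  sumℤ (λ l → sumℤ (λ j → f→h d i l ℤ.* (fMatrix d 𝓕 l j ℤ.* h→f d j k)))
    ≡⟨ sumℤ-cong (λ l → *-distribˡ-sum (f→h d i l) (λ j → fMatrix d 𝓕 l j ℤ.* h→f d j k)) ⟨
  sumℤ (λ l → f→h d i l ℤ.* sumℤ (λ j → fMatrix d 𝓕 l j ℤ.* h→f d j k))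
    ≡⟨ sumℤ-cong (λ l → cong (ℤ._*_ (f→h d i l)) (column l)) ⟩
  sumℤ {suc d} (λ l → f→h-entry d (toℕ i) (toℕ l) ℤ.* diff^ (toℕ k) (λ j → + extend 𝓕 (toℕ l) j) (d ∸ toℕ k))
    ≡⟨ sumℤ≡∑< (suc d) (λ l → f→h-entry d (toℕ i) l ℤ.* diff^ (toℕ k) (λ j → + extend 𝓕 l j) (d ∸ toℕ k)) ⟩
  ∑< (suc d) (λ l → f→h-entry d (toℕ i) l ℤ.* diff^ (toℕ k) (λ j → + extend 𝓕 l j) (d ∸ toℕ k)) ∎
  where
  open ≡-Reasoning
  column : ∀ l → sumℤ (λ j → fMatrix d 𝓕 l j ℤ.* h→f d j k) ≡ diff^ (toℕ k) (λ j → + extend 𝓕 (toℕ l) j) (d ∸ toℕ k)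
  column l = begin
    sumℤ (λ j → fMatrix d 𝓕 l j ℤ.* h→f d j k)
      ≡⟨ sumℤ-cong (λ j → cong (ℤ._* h→f d j k) (sumℤ≡∑< (suc (toℕ j))
           (λ m → -1ℤ ℤ.^ (toℕ j ∸ m) ℤ.* + (toℕ j C m) ℤ.* + extend 𝓕 (toℕ l) m))) ⟩
    sumℤ {suc d} (λ j → alternating (λ m → + extend 𝓕 (toℕ l) m) (toℕ j) ℤ.* h→f-entry d (toℕ j) (toℕ k))
      ≡⟨ sumℤ≡∑< (suc d) (λ j → alternating (λ m → + extend 𝓕 (toℕ l) m) j ℤ.* h→f-entry d j (toℕ k)) ⟩
    ∑< (suc d) (λ j → alternating (λ m → + extend 𝓕 (toℕ l) m) j ℤ.* h→f-entry d j (toℕ k))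
      ≡⟨ alternating-h→f (λ m → + extend 𝓕 (toℕ l) m) d (toℕ k) (ℕ.s≤s⁻¹ (toℕ<n k)) ⟩
    diff^ (toℕ k) (λ m → + extend 𝓕 (toℕ l) m) (d ∸ toℕ k) ∎

-- Indicators of decidable propositions

⟦_⟧ : ∀ {p} {P : Set p} → Dec P → ℤ
⟦ yes _ ⟧ = 1ℤ
⟦ no  _ ⟧ = 0ℤ

⟦⟧-yes : ∀ {p} {P : Set p} (P? : Dec P) → P → ⟦ P? ⟧ ≡ 1ℤ
⟦⟧-yes (yes _) p = refl
⟦⟧-yes (no ¬p) p = ⊥-elim (¬p p)

⟦⟧-no : ∀ {p} {P : Set p} (P? : Dec P) → ¬ P → ⟦ P? ⟧ ≡ 0ℤ
⟦⟧-no (yes p) ¬p = ⊥-elim (¬p p)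
⟦⟧-no (no _)  ¬p = refl

⟦⟧-cong : ∀ {p q} {P : Set p} {Q : Set q} (P? : Dec P) (Q? : Dec Q) → (P → Q) → (Q → P) → ⟦ P? ⟧ ≡ ⟦ Q? ⟧
⟦⟧-cong (yes p) Q? P⇒Q Q⇒P = sym (⟦⟧-yes Q? (P⇒Q p))
⟦⟧-cong (no ¬p) Q? P⇒Q Q⇒P = sym (⟦⟧-no Q? (¬p ∘ Q⇒P))

⟦⟧-nonneg : ∀ {p} {P : Set p} (P? : Dec P) → 0ℤ ℤ.≤ ⟦ P? ⟧
⟦⟧-nonneg (yes _) = ℤ.+≤+ ℕ.z≤n
⟦⟧-nonneg (no _)  = ℤ.≤-refl

_≟ˢ_ : ∀ {n} → DecidableEquality (Subset n)
_≟ˢ_ = Vec.≡-dec Bool._≟_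

-- Sums over all subsets

∑ˢ : ∀ {n} → (Subset n → ℤ) → ℤ
∑ˢ {zero}  f = f []
∑ˢ {suc n} f = ∑ˢ (f ∘ (outside ∷_)) ℤ.+ ∑ˢ (f ∘ (inside ∷_))

∑ˢ-cong : ∀ {n} {f g : Subset n → ℤ} → (∀ S → f S ≡ g S) → ∑ˢ f ≡ ∑ˢ g
∑ˢ-cong {zero}  h = h []
∑ˢ-cong {suc n} h = cong₂ ℤ._+_ (∑ˢ-cong (λ S → h (outside ∷ S))) (∑ˢ-cong (λ S → h (inside ∷ S)))

∑ˢ-zero : ∀ {n} {f : Subset n → ℤ} → (∀ S → f S ≡ 0ℤ) → ∑ˢ f ≡ 0ℤ
∑ˢ-zero {zero}  h = h []
∑ˢ-zero {suc n} h = cong₂ ℤ._+_ (∑ˢ-zero (λ S → h (outside ∷ S))) (∑ˢ-zero (λ S → h (inside ∷ S)))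

∑ˢ-+ : ∀ {n} (f g : Subset n → ℤ) → ∑ˢ (λ S → f S ℤ.+ g S) ≡ ∑ˢ f ℤ.+ ∑ˢ g
∑ˢ-+ {zero}  f g = refl
∑ˢ-+ {suc n} f g = trans (cong₂ ℤ._+_ (∑ˢ-+ (f ∘ (outside ∷_)) (g ∘ (outside ∷_))) (∑ˢ-+ (f ∘ (inside ∷_)) (g ∘ (inside ∷_))))
  (interchange (∑ˢ (f ∘ (outside ∷_))) (∑ˢ (g ∘ (outside ∷_))) (∑ˢ (f ∘ (inside ∷_))) (∑ˢ (g ∘ (inside ∷_))))
  where
  interchange : ∀ a b c d → (a ℤ.+ b) ℤ.+ (c ℤ.+ d) ≡ (a ℤ.+ c) ℤ.+ (b ℤ.+ d)
  interchange = solve-∀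

∑ˢ-neg : ∀ {n} (f : Subset n → ℤ) → ∑ˢ (λ S → ℤ.- f S) ≡ ℤ.- ∑ˢ f
∑ˢ-neg {zero}  f = refl
∑ˢ-neg {suc n} f = trans (cong₂ ℤ._+_ (∑ˢ-neg (f ∘ (outside ∷_))) (∑ˢ-neg (f ∘ (inside ∷_))))
  (sym (ℤ.neg-distrib-+ (∑ˢ (f ∘ (outside ∷_))) (∑ˢ (f ∘ (inside ∷_)))))

∑ˢ-*ˡ : ∀ {n} c (f : Subset n → ℤ) → c ℤ.* ∑ˢ f ≡ ∑ˢ (λ S → c ℤ.* f S)
∑ˢ-*ˡ {zero}  c f = refl
∑ˢ-*ˡ {suc n} c f = trans (ℤ.*-distribˡ-+ c (∑ˢ (f ∘ (outside ∷_))) (∑ˢ (f ∘ (inside ∷_))))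
  (cong₂ ℤ._+_ (∑ˢ-*ˡ c (f ∘ (outside ∷_))) (∑ˢ-*ˡ c (f ∘ (inside ∷_))))

∑ˢ-swap : ∀ {m n} (f : Subset m → Subset n → ℤ) → ∑ˢ (λ S → ∑ˢ (f S)) ≡ ∑ˢ (λ T → ∑ˢ (λ S → f S T))
∑ˢ-swap {zero}  f = refl
∑ˢ-swap {suc m} f = trans (cong₂ ℤ._+_ (∑ˢ-swap (f ∘ (outside ∷_))) (∑ˢ-swap (f ∘ (inside ∷_))))
  (sym (∑ˢ-+ (λ T → ∑ˢ (λ S → f (outside ∷ S) T)) (λ T → ∑ˢ (λ S → f (inside ∷ S) T))))

∑<-∑ˢ : ∀ {n} m (f : ℕ → Subset n → ℤ) → ∑< m (λ l → ∑ˢ (f l)) ≡ ∑ˢ (λ S → ∑< m (λ l → f l S))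
∑<-∑ˢ {n} zero f = sym (∑ˢ-zero {n} {λ _ → 0ℤ} (λ _ → refl))
∑<-∑ˢ (suc m) f = trans (cong (ℤ._+_ (∑ˢ (f 0))) (∑<-∑ˢ m (f ∘ suc)))
  (sym (∑ˢ-+ (f 0) (λ S → ∑< m (λ l → f (suc l) S))))

∑ˢ-nonneg : ∀ {n} {f : Subset n → ℤ} → (∀ S → 0ℤ ℤ.≤ f S) → 0ℤ ℤ.≤ ∑ˢ f
∑ˢ-nonneg {zero}  h = h []
∑ˢ-nonneg {suc n} h = ℤ.+-mono-≤ (∑ˢ-nonneg (λ S → h (outside ∷ S))) (∑ˢ-nonneg (λ S → h (inside ∷ S)))

∑ˢ-single : ∀ {n} (T : Subset n) {f : Subset n → ℤ} → (∀ S → S ≢ T → f S ≡ 0ℤ) → ∑ˢ f ≡ f T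
∑ˢ-single []            h = refl
∑ˢ-single (outside ∷ T) h = trans (cong₂ ℤ._+_
  (∑ˢ-single T (λ S S≢T → h (outside ∷ S) λ { refl → S≢T refl }))
  (∑ˢ-zero (λ S → h (inside ∷ S) λ ()))) (ℤ.+-identityʳ _)
∑ˢ-single (inside ∷ T)  h = trans (cong₂ ℤ._+_
  (∑ˢ-zero (λ S → h (outside ∷ S) λ ()))
  (∑ˢ-single T (λ S S≢T → h (inside ∷ S) λ { refl → S≢T refl }))) (ℤ.+-identityˡ _)

∑<-single : ∀ m k {f : ℕ → ℤ} → k ℕ.< m → (∀ l → l ≢ k → f l ≡ 0ℤ) → ∑< m f ≡ f k
∑<-single (suc m) zero    {f} _       h = trans (cong (ℤ._+_ (f 0)) (∑<-zero m (λ l → h (suc l) λ ()))) (ℤ.+-identityʳ (f 0))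
∑<-single (suc m) (suc k) (ℕ.s≤s k<m) h = trans (cong₂ ℤ._+_ (h 0 λ ())
  (∑<-single m k k<m (λ l l≢k → h (suc l) (l≢k ∘ ℕ.suc-injective)))) (ℤ.+-identityˡ _)

HasSize⇒∑ˢ : ∀ {n} {P : Subset n → Set} (P? : ∀ S → Dec (P S)) {m} → HasSize P m → ∑ˢ (⟦_⟧ ∘ P?) ≡ + m
HasSize⇒∑ˢ {n} P? (Fs , Fs-unique , refl , Fs⇔P) =
  go Fs-unique P? (λ S → Equivalence.from (Fs⇔P S)) (λ S → Equivalence.to (Fs⇔P S))
  where
  open DecMembership (_≟ˢ_ {n}) using () renaming (_∈?_ to _∈ˡ?_)
  go : ∀ {Fs} → Unique Fs → ∀ {P : Subset n → Set} (P? : ∀ S → Dec (P S)) →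
       (∀ S → P S → S List.∈ Fs) → (∀ S → S List.∈ Fs → P S) → ∑ˢ (⟦_⟧ ∘ P?) ≡ + length Fs
  go [] P? P⇒∈ ∈⇒P = ∑ˢ-zero (λ S → ⟦⟧-no (P? S) (λ p → case P⇒∈ S p of λ ()))
  go {T ∷ Fs} (T∉Fs ∷ unique) P? P⇒∈ ∈⇒P = trans
    (trans (∑ˢ-cong split) (∑ˢ-+ (λ S → ⟦ S ≟ˢ T ⟧) (λ S → ⟦ S ∈ˡ? Fs ⟧)))
    (cong₂ ℤ._+_
      (trans (∑ˢ-single T (λ S S≢T → ⟦⟧-no (S ≟ˢ T) S≢T)) (⟦⟧-yes (T ≟ˢ T) refl))
      (go unique (_∈ˡ? Fs) (λ _ → id) (λ _ → id)))
    where
    split : ∀ S → ⟦ P? S ⟧ ≡ ⟦ S ≟ˢ T ⟧ ℤ.+ ⟦ S ∈ˡ? Fs ⟧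
    split S with S ≟ˢ T | S ∈ˡ? Fs
    ... | yes refl | yes S∈ = ⊥-elim (All.lookup T∉Fs S∈ refl)
    ... | yes refl | no _   = ⟦⟧-yes (P? S) (∈⇒P S (here refl))
    ... | no _     | yes S∈ = ⟦⟧-yes (P? S) (∈⇒P S (there S∈))
    ... | no S≢T   | no S∉  = ⟦⟧-no (P? S) (λ p → case P⇒∈ S p of λ { (here eq) → S≢T eq ; (there S∈) → S∉ S∈ })

-- Since x^l (1 - x)^(D + 1 - l) + x^(l+1) (1 - x)^(D - l) = x^l (1 - x)^(D - l).
f→h-entry-merge : ∀ D i l → l ℕ.≤ D → f→h-entry (suc D) i l ℤ.+ f→h-entry (suc D) i (suc l) ≡ f→h-entry D i l
f→h-entry-merge D zero    zero    _ = refl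
f→h-entry-merge D (suc i) zero    _ = trans
  (cong (λ z → -1ℤ ℤ.* -1ℤ ℤ.^ i ℤ.* z ℤ.+ -1ℤ ℤ.^ i ℤ.* + (D C i)) (pascal D i))
  (cancel (-1ℤ ℤ.^ i) (+ (D C i)) (+ (D C suc i)))
  where
  cancel : ∀ s x y → -1ℤ ℤ.* s ℤ.* (x ℤ.+ y) ℤ.+ s ℤ.* x ≡ -1ℤ ℤ.* s ℤ.* y
  cancel = solve-∀
f→h-entry-merge (suc D) zero    (suc l) _ = refl
f→h-entry-merge (suc D) (suc i) (suc l) (ℕ.s≤s l≤D) = trans
  (cong₂ ℤ._+_ (f→h-entry-suc (suc D) i l) (f→h-entry-suc (suc D) i (suc l)))
  (trans (f→h-entry-merge D i l l≤D) (sym (f→h-entry-suc D i l)))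

-- Summing `x^|τ| (1 - x)^(|σ| - |τ|)` over the interval gives `x^|R|`: a vertex of `R` contributes
-- a factor `x`, and any other vertex of `σ` contributes `x + (1 - x) = 1`.
interval-sum : ∀ {n} (R σ : Subset n) i → R ⊆ σ →
  ∑ˢ (λ τ → ⟦ (R ⊆? τ) ×-dec (τ ⊆? σ) ⟧ ℤ.* f→h-entry (card σ) i (card τ)) ≡ ⟦ i ℕ.≟ card R ⟧
interval-sum [] [] zero    R⊆σ = refl
interval-sum [] [] (suc i) R⊆σ = trans (ℤ.*-identityˡ _) (trans (cong (λ z → -1ℤ ℤ.^ suc i ℤ.* + z) (k>n⇒nCk≡0 {0} {suc i} (ℕ.s≤s ℕ.z≤n))) (ℤ.*-zeroʳ (-1ℤ ℤ.^ suc i)))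
interval-sum (inside ∷ R) (outside ∷ σ) i R⊆σ = case R⊆σ here of λ ()
interval-sum (outside ∷ R) (outside ∷ σ) i R⊆σ = trans (cong₂ ℤ._+_
  (∑ˢ-cong (λ τ → cong (ℤ._* f→h-entry (card σ) i (card τ))
    (⟦⟧-cong (((outside ∷ R) ⊆? (outside ∷ τ)) ×-dec ((outside ∷ τ) ⊆? (outside ∷ σ))) ((R ⊆? τ) ×-dec (τ ⊆? σ))
      (λ (p , q) → drop-∷-⊆ p , drop-∷-⊆ q) (λ (p , q) → out⊆ p , out⊆ q))))
  (∑ˢ-zero (λ τ → trans (cong (ℤ._* f→h-entry (card σ) i (suc (card τ)))
    (⟦⟧-no (((outside ∷ R) ⊆? (inside ∷ τ)) ×-dec ((inside ∷ τ) ⊆? (outside ∷ σ))) (λ (_ , q) → case q here of λ ())))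
    (ℤ.*-zeroˡ (f→h-entry (card σ) i (suc (card τ)))))))
  (trans (ℤ.+-identityʳ _) (interval-sum R σ i (drop-∷-⊆ R⊆σ)))
interval-sum (outside ∷ R) (inside ∷ σ) i R⊆σ = trans (sym (∑ˢ-+ A B)) (trans (∑ˢ-cong merge) (interval-sum R σ i (drop-∷-⊆ R⊆σ)))
  where
  A B : Subset _ → ℤ
  A τ = ⟦ ((outside ∷ R) ⊆? (outside ∷ τ)) ×-dec ((outside ∷ τ) ⊆? (inside ∷ σ)) ⟧ ℤ.* f→h-entry (suc (card σ)) i (card τ)
  B τ = ⟦ ((outside ∷ R) ⊆? (inside ∷ τ)) ×-dec ((inside ∷ τ) ⊆? (inside ∷ σ)) ⟧ ℤ.* f→h-entry (suc (card σ)) i (suc (card τ))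
  merge : ∀ τ → A τ ℤ.+ B τ ≡ ⟦ (R ⊆? τ) ×-dec (τ ⊆? σ) ⟧ ℤ.* f→h-entry (card σ) i (card τ)
  merge τ with (R ⊆? τ) ×-dec (τ ⊆? σ)
  ... | yes (R⊆τ , τ⊆σ) = trans (cong₂ ℤ._+_
          (cong (ℤ._* f→h-entry (suc (card σ)) i (card τ)) (⟦⟧-yes (((outside ∷ R) ⊆? (outside ∷ τ)) ×-dec ((outside ∷ τ) ⊆? (inside ∷ σ))) (out⊆ R⊆τ , out⊆ τ⊆σ)))
          (cong (ℤ._* f→h-entry (suc (card σ)) i (suc (card τ))) (⟦⟧-yes (((outside ∷ R) ⊆? (inside ∷ τ)) ×-dec ((inside ∷ τ) ⊆? (inside ∷ σ))) (out⊆ R⊆τ , in⊆in τ⊆σ))))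
        (trans (sym (ℤ.*-distribˡ-+ 1ℤ (f→h-entry (suc (card σ)) i (card τ)) (f→h-entry (suc (card σ)) i (suc (card τ)))))
          (cong (ℤ._*_ 1ℤ) (f→h-entry-merge (card σ) i (card τ) (p⊆q⇒∣p∣≤∣q∣ τ⊆σ))))
  ... | no ¬h = trans (cong₂ ℤ._+_
          (cong (ℤ._* f→h-entry (suc (card σ)) i (card τ)) (⟦⟧-no (((outside ∷ R) ⊆? (outside ∷ τ)) ×-dec ((outside ∷ τ) ⊆? (inside ∷ σ))) (λ (p , q) → ¬h (drop-∷-⊆ p , drop-∷-⊆ q))))
          (cong (ℤ._* f→h-entry (suc (card σ)) i (suc (card τ))) (⟦⟧-no (((outside ∷ R) ⊆? (inside ∷ τ)) ×-dec ((inside ∷ τ) ⊆? (inside ∷ σ))) (λ (p , q) → ¬h (drop-∷-⊆ p , drop-∷-⊆ q)))))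
        (zeros (f→h-entry (suc (card σ)) i (card τ)) (f→h-entry (suc (card σ)) i (suc (card τ))) (f→h-entry (card σ) i (card τ)))
    where
    zeros : ∀ x y z → 0ℤ ℤ.* x ℤ.+ 0ℤ ℤ.* y ≡ 0ℤ ℤ.* z
    zeros = solve-∀
interval-sum (inside ∷ R) (inside ∷ σ) i R⊆σ = trans (cong₂ ℤ._+_
  (∑ˢ-zero (λ τ → trans (cong (ℤ._* f→h-entry (suc (card σ)) i (card τ))
    (⟦⟧-no (((inside ∷ R) ⊆? (outside ∷ τ)) ×-dec ((outside ∷ τ) ⊆? (inside ∷ σ))) (λ (p , _) → case p here of λ ())))
    (ℤ.*-zeroˡ (f→h-entry (suc (card σ)) i (card τ)))))
  (∑ˢ-cong (λ τ → cong (ℤ._* f→h-entry (suc (card σ)) i (suc (card τ)))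
    (⟦⟧-cong (((inside ∷ R) ⊆? (inside ∷ τ)) ×-dec ((inside ∷ τ) ⊆? (inside ∷ σ))) ((R ⊆? τ) ×-dec (τ ⊆? σ))
      (λ (p , q) → drop-∷-⊆ p , drop-∷-⊆ q) (λ (p , q) → in⊆in p , in⊆in q)))))
  (trans (ℤ.+-identityˡ _) (by-index i))
  where
  by-index : ∀ i → ∑ˢ (λ τ → ⟦ (R ⊆? τ) ×-dec (τ ⊆? σ) ⟧ ℤ.* f→h-entry (suc (card σ)) i (suc (card τ))) ≡ ⟦ i ℕ.≟ suc (card R) ⟧
  by-index zero    = ∑ˢ-zero (λ τ → ℤ.*-zeroʳ ⟦ (R ⊆? τ) ×-dec (τ ⊆? σ) ⟧)
  by-index (suc i) = trans
    (∑ˢ-cong (λ τ → cong (ℤ._*_ ⟦ (R ⊆? τ) ×-dec (τ ⊆? σ) ⟧) (f→h-entry-suc (card σ) i (card τ))))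
    (trans (interval-sum R σ i (drop-∷-⊆ R⊆σ))
      (⟦⟧-cong (i ℕ.≟ card R) (suc i ℕ.≟ suc (card R)) (cong suc) ℕ.suc-injective))

-- Counting the cells of a half-open simplex

extend-≤ : ∀ 𝓕 {i j} → i ℕ.≤ j → extend 𝓕 i j ≡ 𝓕 i j
extend-≤ 𝓕 {i} {j} i≤j with i ≤ᵇ j | ℕ.≤⇒≤ᵇ i≤j
... | true | _ = refl

extend-> : ∀ 𝓕 {i j} → j ℕ.< i → extend 𝓕 i j ≡ 0
extend-> 𝓕 {i} {j} j<i with i ≤ᵇ j | ℕ.≤ᵇ⇒≤ i j
... | true  | h = ⊥-elim (ℕ.<⇒≱ j<i (h _))
... | false | _ = refl

∖-mono : ∀ {n} {p q : Subset n} {x} → p ⊆ q → p ∖ x ⊆ q ∖ x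
∖-mono {p = p} {x = x} p⊆q {y} y∈p∖x =
  x∈p∧x≢y⇒x∈p-y (p⊆q (∖-⊆ p x y∈p∖x)) λ { refl → x∉p∖x p x y∈p∖x }

module HalfOpenCount {n n′} {F : Subset n} (𝓕 : ℕ → ℕ → ℕ) (Restricts : Subset n → Subset n′ → Set)
  (Restricts? : ∀ E τ → Dec (Restricts E τ))
  (monotone : ∀ {E E′ τ} → E ⊆ E′ → Restricts E τ → Restricts E′ τ)
  (intersects : ∀ {E c τ} → E ⊆ F → Restricts E τ → Restricts (F ∖ c) τ → Restricts (E ∖ c) τ)
  (dimension : ∀ {E τ} → E ⊆ F → Restricts E τ → card τ ℕ.≤ card E)
  (sizes : ∀ i j → i ℕ.≤ j → ∀ E → E ⊆ F → card E ≡ j → HasSize (λ G → Restricts E G × card G ≡ i) (𝓕 i j))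
  where

  Avoids : Subset n → Subset n′ → Set
  Avoids S τ = ∀ c → c ∈ S → ¬ Restricts (F ∖ c) τ

  Avoids? : ∀ S τ → Dec (Avoids S τ)
  Avoids? S τ = all? λ c → (c ∈? S) →-dec ¬? (Restricts? (F ∖ c) τ)

  Counted : ℕ → Subset n → Subset n → Subset n′ → Set
  Counted l E S τ = (Restricts E τ × card τ ≡ l) × Avoids S τ

  Counted? : ∀ l E S τ → Dec (Counted l E S τ)
  Counted? l E S τ = (Restricts? E τ ×-dec (card τ ℕ.≟ l)) ×-dec Avoids? S τ

  -- The zeros of `extend` agree with the geometry: no cell inside `E` has more vertices than `E`.
  face-count : ∀ l E → E ⊆ F → ∑ˢ (λ τ → ⟦ Restricts? E τ ×-dec (card τ ℕ.≟ l) ⟧) ≡ + extend 𝓕 l (card E)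
  face-count l E E⊆F with l ℕ.≤? card E
  ... | yes l≤∣E∣ = trans (HasSize⇒∑ˢ (λ τ → Restricts? E τ ×-dec (card τ ℕ.≟ l)) (sizes l (card E) l≤∣E∣ E E⊆F refl))
        (cong +_ (sym (extend-≤ 𝓕 l≤∣E∣)))
  ... | no  l≰∣E∣ = trans (∑ˢ-zero (λ τ → ⟦⟧-no (Restricts? E τ ×-dec (card τ ℕ.≟ l))
          (λ { (r , refl) → l≰∣E∣ (dimension E⊆F r) })))
        (cong +_ (sym (extend-> 𝓕 (ℕ.≰⇒> l≰∣E∣))))

  -- Inclusion-exclusion, one `s ∈ S` at a time. The cells of `E` that lie in the facet of `F`
  -- opposite `s` are those of `E` without `s`; subtracting them performs one difference step
  -- between `card E - 1` and `card E`.
  half-open-count : ∀ k l E S → E ⊆ F → S ⊆ E → card S ≡ k →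
    ∑ˢ (λ τ → ⟦ Counted? l E S τ ⟧) ≡ diff^ k (λ j → + extend 𝓕 l j) (card E ∸ k)
  half-open-count zero l E S E⊆F S⊆E ∣S∣≡0 = trans
    (∑ˢ-cong (λ τ → ⟦⟧-cong (Counted? l E S τ) (Restricts? E τ ×-dec (card τ ℕ.≟ l)) proj₁
      (λ h → h , λ c c∈S → ⊥-elim (ℕ.n≮0 (subst (card (S ∖ c) ℕ.<_) ∣S∣≡0 (x∈p⇒∣p-x∣<∣p∣ c∈S))))))
    (face-count l E E⊆F)
  half-open-count (suc k) l E S E⊆F S⊆E ∣S∣≡1+k = begin
    ∑ˢ (λ τ → ⟦ Counted? l E S τ ⟧)
      ≡⟨ ∑ˢ-cong split ⟩
    ∑ˢ (λ τ → ⟦ Counted? l E S′ τ ⟧ ℤ.- ⟦ Counted? l (E ∖ s) S′ τ ⟧)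
      ≡⟨ trans (∑ˢ-+ (λ τ → ⟦ Counted? l E S′ τ ⟧) (λ τ → ℤ.- ⟦ Counted? l (E ∖ s) S′ τ ⟧))
           (cong (ℤ._+_ (∑ˢ (λ τ → ⟦ Counted? l E S′ τ ⟧))) (∑ˢ-neg (λ τ → ⟦ Counted? l (E ∖ s) S′ τ ⟧))) ⟩
    ∑ˢ (λ τ → ⟦ Counted? l E S′ τ ⟧) ℤ.- ∑ˢ (λ τ → ⟦ Counted? l (E ∖ s) S′ τ ⟧)
      ≡⟨ cong₂ ℤ._-_
           (half-open-count k l E S′ E⊆F (S⊆E ∘ ∖-⊆ S s) ∣S′∣≡k)
           (half-open-count k l (E ∖ s) S′ (E⊆F ∘ ∖-⊆ E s) S′⊆E∖s ∣S′∣≡k) ⟩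
    diff^ k a (card E ∸ k) ℤ.- diff^ k a (card (E ∖ s) ∸ k)
      ≡⟨ cong (λ e → diff^ k a (e ∸ k) ℤ.- diff^ k a (card (E ∖ s) ∸ k)) (card-∖ E (S⊆E s∈S)) ⟨
    diff^ k a (suc (card (E ∖ s)) ∸ k) ℤ.- diff^ k a (card (E ∖ s) ∸ k)
      ≡⟨ cong (λ e → diff^ k a e ℤ.- diff^ k a (card (E ∖ s) ∸ k)) (ℕ.+-∸-assoc 1 (subst (ℕ._≤ card (E ∖ s)) ∣S′∣≡k (p⊆q⇒∣p∣≤∣q∣ S′⊆E∖s))) ⟩
    diff^ k a (suc (card (E ∖ s) ∸ k)) ℤ.- diff^ k a (card (E ∖ s) ∸ k)
      ≡⟨ diff^-suc k a (card (E ∖ s) ∸ k) ⟨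
    diff^ (suc k) a (card (E ∖ s) ∸ k)
      ≡⟨ cong (λ e → diff^ (suc k) a (e ∸ suc k)) (card-∖ E (S⊆E s∈S)) ⟩
    diff^ (suc k) a (card E ∸ suc k) ∎
    where
    open ≡-Reasoning
    a : ℕ → ℤ
    a j = + extend 𝓕 l j
    s∈ : ∃[ s ] s ∈ S
    s∈ = card>0⇒∃∈ S (subst (0 ℕ.<_) (sym ∣S∣≡1+k) (ℕ.s≤s ℕ.z≤n))
    s : Fin n
    s = proj₁ s∈
    s∈S : s ∈ S
    s∈S = proj₂ s∈
    S′ : Subset n
    S′ = S ∖ s
    ∣S′∣≡k : card S′ ≡ k
    ∣S′∣≡k = ℕ.suc-injective (trans (card-∖ S s∈S) ∣S∣≡1+k)
    S′⊆E∖s : S′ ⊆ E ∖ s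
    S′⊆E∖s = ∖-mono S⊆E
    split : ∀ τ → ⟦ Counted? l E S τ ⟧ ≡ ⟦ Counted? l E S′ τ ⟧ ℤ.- ⟦ Counted? l (E ∖ s) S′ τ ⟧
    split τ with Restricts? (F ∖ s) τ
    ... | yes r = trans (⟦⟧-no (Counted? l E S τ) (λ h → proj₂ h s s∈S r))
          (sym (trans (cong (ℤ._- ⟦ Counted? l (E ∖ s) S′ τ ⟧) (⟦⟧-cong (Counted? l E S′ τ) (Counted? l (E ∖ s) S′ τ)
            (λ ((rE , eq) , av) → (intersects E⊆F rE r , eq) , av)
            (λ ((rE , eq) , av) → (monotone (∖-⊆ E s) rE , eq) , av)))
            (ℤ.+-inverseʳ ⟦ Counted? l (E ∖ s) S′ τ ⟧)))
    ... | no ¬r = trans (⟦⟧-cong (Counted? l E S τ) (Counted? l E S′ τ)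
            (λ (rE , av) → rE , λ c c∈S′ → av c (∖-⊆ S s c∈S′))
            (λ (rE , av) → rE , λ c c∈S → case c ≟ s of λ
              { (yes refl) → ¬r ; (no c≢s) → av c (x∈p∧x≢y⇒x∈p-y c∈S c≢s) }))
          (sym (trans (cong (λ z → ⟦ Counted? l E S′ τ ⟧ ℤ.- z)
            (⟦⟧-no (Counted? l (E ∖ s) S′ τ) (λ ((rE , _) , _) → ¬r (monotone (∖-mono E⊆F) rE))))
            (ℤ.+-identityʳ ⟦ Counted? l E S′ τ ⟧)))

  FullCell′ : Subset n′ → Set
  FullCell′ σ = Restricts F σ × card σ ≡ card F

  -- Each interval R σ ⊆ τ ⊆ σ contributes x ^ |R σ| to the h-polynomial.
  entry-nonneg : (R : Subset n′ → Subset n′) (S : Subset n) → S ⊆ F →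
    (∀ σ → R σ ⊆ σ) →
    (∀ τ → Restricts F τ → Avoids S τ → ∃[ σ ] FullCell′ σ × R σ ⊆ τ × τ ⊆ σ) →
    (∀ σ τ → FullCell′ σ → R σ ⊆ τ → τ ⊆ σ → Restricts F τ × Avoids S τ) →
    (∀ σ σ′ τ → FullCell′ σ → FullCell′ σ′ → R σ ⊆ τ → τ ⊆ σ → R σ′ ⊆ τ → τ ⊆ σ′ → σ ≡ σ′) →
    ∀ i → 0ℤ ℤ.≤ ∑< (suc (card F)) (λ l → f→h-entry (card F) i l ℤ.* diff^ (card S) (λ j → + extend 𝓕 l j) (card F ∸ card S))
  entry-nonneg R S S⊆F R⊆ covered full disjoint i = subst (0ℤ ℤ.≤_) (sym entry≡) (∑ˢ-nonneg (λ σ → row-nonneg σ (FullCell? σ)))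
    where
    d : ℕ
    d = card F
    P? : ∀ τ → Dec (Restricts F τ × Avoids S τ)
    P? τ = Restricts? F τ ×-dec Avoids? S τ
    FullCell? : ∀ σ → Dec (FullCell′ σ)
    FullCell? σ = Restricts? F σ ×-dec (card σ ℕ.≟ card F)
    I? : ∀ σ τ → Dec (FullCell′ σ × (R σ ⊆ τ × τ ⊆ σ))
    I? σ τ = FullCell? σ ×-dec ((R σ ⊆? τ) ×-dec (τ ⊆? σ))
    by-size : ∀ τ → ∑< (suc d) (λ l → f→h-entry d i l ℤ.* ⟦ Counted? l F S τ ⟧) ≡ ⟦ P? τ ⟧ ℤ.* f→h-entry d i (card τ)
    by-size τ = by-membership (P? τ)
      where
      by-membership : (p : Dec (Restricts F τ × Avoids S τ)) →
        ∑< (suc d) (λ l → f→h-entry d i l ℤ.* ⟦ Counted? l F S τ ⟧) ≡ ⟦ p ⟧ ℤ.* f→h-entry d i (card τ)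
      by-membership (yes (r , av)) = trans
        (∑<-single (suc d) (card τ) (ℕ.s≤s (dimension ⊆-refl r)) (λ l l≢ → trans
          (cong (ℤ._*_ (f→h-entry d i l)) (⟦⟧-no (Counted? l F S τ) (λ ((_ , eq) , _) → l≢ (sym eq))))
          (ℤ.*-zeroʳ (f→h-entry d i l))))
        (trans (cong (ℤ._*_ (f→h-entry d i (card τ))) (⟦⟧-yes (Counted? (card τ) F S τ) ((r , refl) , av)))
          (ℤ.*-comm (f→h-entry d i (card τ)) 1ℤ))
      by-membership (no ¬p) = trans
        (∑<-zero (suc d) (λ l → trans
          (cong (ℤ._*_ (f→h-entry d i l)) (⟦⟧-no (Counted? l F S τ) (λ ((r , _) , av) → ¬p (r , av))))
          (ℤ.*-zeroʳ (f→h-entry d i l))))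
        (sym (ℤ.*-zeroˡ (f→h-entry d i (card τ))))
    by-interval : ∀ τ → ⟦ P? τ ⟧ ≡ ∑ˢ (λ σ → ⟦ I? σ τ ⟧)
    by-interval τ = by-membership (P? τ)
      where
      by-membership : (p : Dec (Restricts F τ × Avoids S τ)) → ⟦ p ⟧ ≡ ∑ˢ (λ σ → ⟦ I? σ τ ⟧)
      by-membership (yes (r , av)) =
        let σ , fσ , R⊆τ , τ⊆σ = covered τ r av
        in sym (trans (∑ˢ-single σ (λ σ′ σ′≢σ → ⟦⟧-no (I? σ′ τ)
             (λ (fσ′ , R′⊆τ , τ⊆σ′) → σ′≢σ (disjoint σ′ σ τ fσ′ fσ R′⊆τ τ⊆σ′ R⊆τ τ⊆σ))))
           (⟦⟧-yes (I? σ τ) (fσ , (λ {u} → R⊆τ {u}) , (λ {u} → τ⊆σ {u}))))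
      by-membership (no ¬p) = sym (∑ˢ-zero (λ σ → ⟦⟧-no (I? σ τ) (λ (fσ , R⊆τ , τ⊆σ) → ¬p (full σ τ fσ R⊆τ τ⊆σ))))
    entry≡ : ∑< (suc d) (λ l → f→h-entry d i l ℤ.* diff^ (card S) (λ j → + extend 𝓕 l j) (d ∸ card S))
           ≡ ∑ˢ (λ σ → ∑ˢ (λ τ → ⟦ I? σ τ ⟧ ℤ.* f→h-entry d i (card τ)))
    entry≡ = begin
      ∑< (suc d) (λ l → f→h-entry d i l ℤ.* diff^ (card S) (λ j → + extend 𝓕 l j) (d ∸ card S))
        ≡⟨ ∑<-cong (suc d) (λ l _ → cong (ℤ._*_ (f→h-entry d i l)) (half-open-count (card S) l F S ⊆-refl S⊆F refl)) ⟨
      ∑< (suc d) (λ l → f→h-entry d i l ℤ.* ∑ˢ (λ τ → ⟦ Counted? l F S τ ⟧))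
        ≡⟨ ∑<-cong (suc d) (λ l _ → ∑ˢ-*ˡ (f→h-entry d i l) (λ τ → ⟦ Counted? l F S τ ⟧)) ⟩
      ∑< (suc d) (λ l → ∑ˢ (λ τ → f→h-entry d i l ℤ.* ⟦ Counted? l F S τ ⟧))
        ≡⟨ ∑<-∑ˢ (suc d) (λ l τ → f→h-entry d i l ℤ.* ⟦ Counted? l F S τ ⟧) ⟩
      ∑ˢ (λ τ → ∑< (suc d) (λ l → f→h-entry d i l ℤ.* ⟦ Counted? l F S τ ⟧))
        ≡⟨ ∑ˢ-cong by-size ⟩
      ∑ˢ (λ τ → ⟦ P? τ ⟧ ℤ.* f→h-entry d i (card τ))
        ≡⟨ ∑ˢ-cong (λ τ → trans (cong (ℤ._* f→h-entry d i (card τ)) (by-interval τ))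
             (trans (ℤ.*-comm (∑ˢ (λ σ → ⟦ I? σ τ ⟧)) (f→h-entry d i (card τ)))
               (trans (∑ˢ-*ˡ (f→h-entry d i (card τ)) (λ σ → ⟦ I? σ τ ⟧))
                 (∑ˢ-cong (λ σ → ℤ.*-comm (f→h-entry d i (card τ)) ⟦ I? σ τ ⟧))))) ⟩
      ∑ˢ (λ τ → ∑ˢ (λ σ → ⟦ I? σ τ ⟧ ℤ.* f→h-entry d i (card τ)))
        ≡⟨ ∑ˢ-swap (λ τ σ → ⟦ I? σ τ ⟧ ℤ.* f→h-entry d i (card τ)) ⟩
      ∑ˢ (λ σ → ∑ˢ (λ τ → ⟦ I? σ τ ⟧ ℤ.* f→h-entry d i (card τ))) ∎
      where open ≡-Reasoning
    -- For a full cell `card σ` is `card F`, so its row is the single coefficient given by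
    -- `interval-sum`; the other rows vanish.
    row-nonneg : ∀ σ → Dec (FullCell′ σ) → 0ℤ ℤ.≤ ∑ˢ (λ τ → ⟦ I? σ τ ⟧ ℤ.* f→h-entry d i (card τ))
    row-nonneg σ (yes fσ) = subst (0ℤ ℤ.≤_) (sym (trans
      (∑ˢ-cong (λ τ → cong₂ ℤ._*_
        (⟦⟧-cong (I? σ τ) ((R σ ⊆? τ) ×-dec (τ ⊆? σ)) proj₂ (fσ ,_))
        (cong (λ e → f→h-entry e i (card τ)) (sym (proj₂ fσ)))))
      (interval-sum (R σ) σ i (R⊆ σ)))) (⟦⟧-nonneg (i ℕ.≟ card (R σ)))
    row-nonneg σ (no ¬fσ) = ℤ.≤-reflexive (sym (∑ˢ-zero (λ τ → trans
      (cong (ℤ._* f→h-entry d i (card τ)) (⟦⟧-no (I? σ τ) (¬fσ ∘ proj₁))) (ℤ.*-zeroˡ (f→h-entry d i (card τ))))))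

open import Defs

-- The ordered ring of Cauchy reals

ℚ-neg-involutive : ∀ p → ℚ.- (ℚ.- p) ≡ p
ℚ-neg-involutive = GroupProperties.⁻¹-involutive ℚ.+-0-group

½-positive : ∀ {ε} → 0ℚ ℚ.< ε → 0ℚ ℚ.< ½ ℚ.* ε
½-positive = ℚ.*-monoʳ-<-pos ½

halves : ∀ ε → ½ ℚ.* ε ℚ.+ ½ ℚ.* ε ≡ ε
halves ε = trans (sym (ℚ.*-distribʳ-+ ε ½ ½)) (ℚ.*-identityˡ ε)

p≤p+ε : ∀ p {ε} → 0ℚ ℚ.≤ ε → p ℚ.≤ p ℚ.+ ε
p≤p+ε p {ε} 0≤ε = ℚ.≤-trans (ℚ.≤-reflexive (sym (ℚ.+-identityʳ p))) (ℚ.+-monoʳ-≤ p 0≤ε)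

≤-pointwise : ∀ {x y} → (∀ n → approx x n ℚ.≤ approx y n) → x ≤ y
≤-pointwise {x} {y} h ε 0<ε = 0 , λ n _ → ℚ.≤-trans (h n) (p≤p+ε (approx y n) (ℚ.<⇒≤ 0<ε))

≈-pointwise : ∀ {x y} → (∀ n → approx x n ≡ approx y n) → x ≈ y
≈-pointwise {x} {y} h =
  ≤-pointwise {x} {y} (ℚ.≤-reflexive ∘ h) , ≤-pointwise {y} {x} (ℚ.≤-reflexive ∘ sym ∘ h)

≤-refl : ∀ {x} → x ≤ x
≤-refl {x} = ≤-pointwise {x} {x} (λ _ → ℚ.≤-refl)

≤-trans : ∀ {x y z} → x ≤ y → y ≤ z → x ≤ z
≤-trans {x} {y} {z} x≤y y≤z ε 0<ε =
  let M , h = x≤y (½ ℚ.* ε) (½-positive 0<ε)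
      N , k = y≤z (½ ℚ.* ε) (½-positive 0<ε)
  in M ℕ.⊔ N , λ n p → begin
    approx x n                               ≤⟨ h n (ℕ.m⊔n≤o⇒m≤o M N p) ⟩
    approx y n ℚ.+ ½ ℚ.* ε                   ≤⟨ ℚ.+-monoˡ-≤ (½ ℚ.* ε) (k n (ℕ.m⊔n≤o⇒n≤o M N p)) ⟩
    approx z n ℚ.+ ½ ℚ.* ε ℚ.+ ½ ℚ.* ε       ≡⟨ ℚ.+-assoc (approx z n) (½ ℚ.* ε) (½ ℚ.* ε) ⟩
    approx z n ℚ.+ (½ ℚ.* ε ℚ.+ ½ ℚ.* ε)     ≡⟨ cong (approx z n ℚ.+_) (halves ε) ⟩
    approx z n ℚ.+ ε                         ∎
  where open ℚ.≤-Reasoning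

private
  +-interchange : ∀ a b c d → (a ℚ.+ b) ℚ.+ (c ℚ.+ d) ≡ (a ℚ.+ c) ℚ.+ (b ℚ.+ d)
  +-interchange a b c d = begin
    (a ℚ.+ b) ℚ.+ (c ℚ.+ d)   ≡⟨ ℚ.+-assoc a b (c ℚ.+ d) ⟩
    a ℚ.+ (b ℚ.+ (c ℚ.+ d))   ≡⟨ cong (a ℚ.+_) (ℚ.+-assoc b c d) ⟨
    a ℚ.+ ((b ℚ.+ c) ℚ.+ d)   ≡⟨ cong (λ e → a ℚ.+ (e ℚ.+ d)) (ℚ.+-comm b c) ⟩
    a ℚ.+ ((c ℚ.+ b) ℚ.+ d)   ≡⟨ cong (a ℚ.+_) (ℚ.+-assoc c b d) ⟩
    a ℚ.+ (c ℚ.+ (b ℚ.+ d))   ≡⟨ ℚ.+-assoc a c (b ℚ.+ d) ⟨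
    (a ℚ.+ c) ℚ.+ (b ℚ.+ d)   ∎
    where open ≡-Reasoning

+-mono-≤ : ∀ {x y u v} → x ≤ y → u ≤ v → x + u ≤ y + v
+-mono-≤ {x} {y} {u} {v} x≤y u≤v ε 0<ε =
  let M , h = x≤y (½ ℚ.* ε) (½-positive 0<ε)
      N , k = u≤v (½ ℚ.* ε) (½-positive 0<ε)
  in M ℕ.⊔ N , λ n p → begin
    approx x n ℚ.+ approx u n
      ≤⟨ ℚ.+-mono-≤ (h n (ℕ.m⊔n≤o⇒m≤o M N p)) (k n (ℕ.m⊔n≤o⇒n≤o M N p)) ⟩
    (approx y n ℚ.+ ½ ℚ.* ε) ℚ.+ (approx v n ℚ.+ ½ ℚ.* ε)
      ≡⟨ +-interchange (approx y n) (½ ℚ.* ε) (approx v n) (½ ℚ.* ε) ⟩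
    (approx y n ℚ.+ approx v n) ℚ.+ (½ ℚ.* ε ℚ.+ ½ ℚ.* ε)
      ≡⟨ cong ((approx y n ℚ.+ approx v n) ℚ.+_) (halves ε) ⟩
    (approx y n ℚ.+ approx v n) ℚ.+ ε ∎
  where open ℚ.≤-Reasoning

private
  shift : ∀ a b → a ≡ (a ℚ.+ b) ℚ.- b
  shift a b = sym (trans (ℚ.+-assoc a b (ℚ.- b)) (trans (cong (a ℚ.+_) (ℚ.+-inverseʳ b)) (ℚ.+-identityʳ a)))

-‿anti-≤ : ∀ {x y} → x ≤ y → - y ≤ - x
-‿anti-≤ {x} {y} x≤y ε 0<ε =
  let N , h = x≤y ε 0<ε
  in N , λ n p → begin
    ℚ.- approx y n                       ≡⟨ shift (ℚ.- approx y n) ε ⟩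
    (ℚ.- approx y n ℚ.+ ε) ℚ.- ε         ≡⟨ swap (ℚ.- approx y n) ε (ℚ.- ε) ⟩
    (ℚ.- approx y n ℚ.- ε) ℚ.+ ε         ≡⟨ cong (ℚ._+ ε) (ℚ.neg-distrib-+ (approx y n) ε) ⟨
    ℚ.- (approx y n ℚ.+ ε) ℚ.+ ε         ≤⟨ ℚ.+-monoˡ-≤ ε (ℚ.neg-antimono-≤ (h n p)) ⟩
    ℚ.- approx x n ℚ.+ ε                 ∎
  where
  open ℚ.≤-Reasoning
  swap : ∀ a b c → (a ℚ.+ b) ℚ.+ c ≡ (a ℚ.+ c) ℚ.+ b
  swap a b c = trans (ℚ.+-assoc a b c) (trans (cong (a ℚ.+_) (ℚ.+-comm b c)) (sym (ℚ.+-assoc a c b)))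

bounded : ∀ x → ∃[ B ] 0ℚ ℚ.< B × ∃[ N ] ∀ n → N ℕ.≤ n → ℚ.∣ approx x n ∣ ℚ.≤ B
bounded x =
  let N , h = isCauchy x 1ℚ (ℚ.positive⁻¹ 1ℚ)
  in ℚ.∣ approx x N ∣ ℚ.+ 1ℚ
   , ℚ.+-mono-≤-< (ℚ.0≤∣p∣ (approx x N)) (ℚ.positive⁻¹ 1ℚ)
   , N , λ n p → begin
    ℚ.∣ approx x n ∣
      ≡⟨ cong ℚ.∣_∣ (split (approx x n) (approx x N)) ⟩
    ℚ.∣ approx x N ℚ.+ (approx x n ℚ.- approx x N) ∣
      ≤⟨ ℚ.∣p+q∣≤∣p∣+∣q∣ (approx x N) (approx x n ℚ.- approx x N) ⟩
    ℚ.∣ approx x N ∣ ℚ.+ ℚ.∣ approx x n ℚ.- approx x N ∣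
      ≤⟨ ℚ.+-monoʳ-≤ ℚ.∣ approx x N ∣ (h n N p ℕ.≤-refl) ⟩
    ℚ.∣ approx x N ∣ ℚ.+ 1ℚ ∎
  where
  open ℚ.≤-Reasoning
  split : ∀ a b → a ≡ b ℚ.+ (a ℚ.- b)
  split a b = sym (trans (ℚ.+-comm b (a ℚ.- b)) (trans (ℚ.+-assoc a (ℚ.- b) b) (trans (cong (a ℚ.+_) (ℚ.+-inverseˡ b)) (ℚ.+-identityʳ a))))

p≤∣p∣ : ∀ p → p ℚ.≤ ℚ.∣ p ∣
p≤∣p∣ p with ℚ.≤-total 0ℚ p
... | inj₁ 0≤p = ℚ.≤-reflexive (sym (ℚ.0≤p⇒∣p∣≡p 0≤p))
... | inj₂ p≤0 = ℚ.≤-trans p≤0 (ℚ.0≤∣p∣ p)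

-- (x + δ)(y + δ) ≥ 0 gives xy ≥ -δ(x + y + δ).
private
  product-lower-bound : ∀ {x y B δ} → 0ℚ ℚ.≤ δ → δ ℚ.≤ B →
    0ℚ ℚ.≤ x ℚ.+ δ → 0ℚ ℚ.≤ y ℚ.+ δ → x ℚ.≤ B → y ℚ.≤ B →
    0ℚ ℚ.≤ x ℚ.* y ℚ.+ δ ℚ.* ((B ℚ.+ B) ℚ.+ B)
  product-lower-bound {x} {y} {B} {δ} 0≤δ δ≤B 0≤x+δ 0≤y+δ x≤B y≤B = begin
    0ℚ                                           ≡⟨ ℚ.*-zeroʳ (x ℚ.+ δ) ⟨
    (x ℚ.+ δ) ℚ.* 0ℚ                             ≤⟨ ℚ.*-monoˡ-≤-nonNeg (x ℚ.+ δ) {{ℚ.nonNegative 0≤x+δ}} 0≤y+δ ⟩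
    (x ℚ.+ δ) ℚ.* (y ℚ.+ δ)                      ≡⟨ ℚ.*-distribʳ-+ (y ℚ.+ δ) x δ ⟩
    x ℚ.* (y ℚ.+ δ) ℚ.+ δ ℚ.* (y ℚ.+ δ)          ≡⟨ cong (ℚ._+ δ ℚ.* (y ℚ.+ δ)) (ℚ.*-distribˡ-+ x y δ) ⟩
    x ℚ.* y ℚ.+ x ℚ.* δ ℚ.+ δ ℚ.* (y ℚ.+ δ)      ≡⟨ ℚ.+-assoc (x ℚ.* y) (x ℚ.* δ) _ ⟩
    x ℚ.* y ℚ.+ (x ℚ.* δ ℚ.+ δ ℚ.* (y ℚ.+ δ))    ≡⟨ cong (λ z → x ℚ.* y ℚ.+ (z ℚ.+ δ ℚ.* (y ℚ.+ δ))) (ℚ.*-comm x δ) ⟩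
    x ℚ.* y ℚ.+ (δ ℚ.* x ℚ.+ δ ℚ.* (y ℚ.+ δ))    ≡⟨ cong (x ℚ.* y ℚ.+_) (ℚ.*-distribˡ-+ δ x (y ℚ.+ δ)) ⟨
    x ℚ.* y ℚ.+ δ ℚ.* (x ℚ.+ (y ℚ.+ δ))          ≡⟨ cong (λ z → x ℚ.* y ℚ.+ δ ℚ.* z) (ℚ.+-assoc x y δ) ⟨
    x ℚ.* y ℚ.+ δ ℚ.* ((x ℚ.+ y) ℚ.+ δ)          ≤⟨ ℚ.+-monoʳ-≤ (x ℚ.* y) (ℚ.*-monoˡ-≤-nonNeg δ {{ℚ.nonNegative 0≤δ}}
                                                      (ℚ.+-mono-≤ (ℚ.+-mono-≤ x≤B y≤B) δ≤B)) ⟩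
    x ℚ.* y ℚ.+ δ ℚ.* ((B ℚ.+ B) ℚ.+ B)          ∎
    where open ℚ.≤-Reasoning

*-nonneg : ∀ {x y} → 0ℝ ≤ x → 0ℝ ≤ y → 0ℝ ≤ x * y
*-nonneg {x} {y} 0≤x 0≤y ε 0<ε =
  let A , 0<A , L , hA = bounded x
      C , 0<C , M , hC = bounded y
      B = A ℚ.⊔ C
      A≤B = ℚ.p≤p⊔q A C
      C≤B = ℚ.p≤q⊔p A C
      0<B = ℚ.<-≤-trans 0<A A≤B
      -- `B₃` bounds the factor `x + y + δ` of the error as long as `δ ≤ B`, which the minimum
      -- ensures; `δ₁` is `ε / B₃`.
      B₃ = (B ℚ.+ B) ℚ.+ B
      0<B₃ = ℚ.+-mono-< (ℚ.+-mono-< 0<B 0<B) 0<B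
      r , 0<r , r*B₃≡1 = inverse B₃ 0<B₃
      δ₁ = r ℚ.* ε
      0<δ₁ = *-positive 0<r 0<ε
      δ = δ₁ ℚ.⊓ B
      0<δ : 0ℚ ℚ.< δ
      0<δ = ⊓-positive 0<δ₁ 0<B
      J , hJ = 0≤x δ 0<δ
      K , hK = 0≤y δ 0<δ
  in (L ℕ.⊔ M) ℕ.⊔ (J ℕ.⊔ K) , λ n p →
    let LM = ℕ.m⊔n≤o⇒m≤o (L ℕ.⊔ M) (J ℕ.⊔ K) p
        JK = ℕ.m⊔n≤o⇒n≤o (L ℕ.⊔ M) (J ℕ.⊔ K) p
    in begin
    0ℚ
      ≤⟨ product-lower-bound (ℚ.<⇒≤ 0<δ) (ℚ.p⊓q≤q δ₁ B)
           (hJ n (ℕ.m⊔n≤o⇒m≤o J K JK)) (hK n (ℕ.m⊔n≤o⇒n≤o J K JK))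
           (ℚ.≤-trans (p≤∣p∣ _) (ℚ.≤-trans (hA n (ℕ.m⊔n≤o⇒m≤o L M LM)) A≤B))
           (ℚ.≤-trans (p≤∣p∣ _) (ℚ.≤-trans (hC n (ℕ.m⊔n≤o⇒n≤o L M LM)) C≤B)) ⟩
    approx x n ℚ.* approx y n ℚ.+ δ ℚ.* B₃
      ≤⟨ ℚ.+-monoʳ-≤ (approx x n ℚ.* approx y n)
           (ℚ.*-monoʳ-≤-nonNeg B₃ {{ℚ.nonNegative (ℚ.<⇒≤ 0<B₃)}} (ℚ.p⊓q≤p δ₁ B)) ⟩
    approx x n ℚ.* approx y n ℚ.+ r ℚ.* ε ℚ.* B₃
      ≡⟨ cong (approx x n ℚ.* approx y n ℚ.+_) (regroup r B₃ r*B₃≡1) ⟩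
    approx x n ℚ.* approx y n ℚ.+ ε ∎
  where
  open ℚ.≤-Reasoning
  ⊓-positive : ∀ {p q} → 0ℚ ℚ.< p → 0ℚ ℚ.< q → 0ℚ ℚ.< p ℚ.⊓ q
  ⊓-positive {p} {q} 0<p 0<q with ℚ.⊓-sel p q
  ... | inj₁ eq = subst (0ℚ ℚ.<_) (sym eq) 0<p
  ... | inj₂ eq = subst (0ℚ ℚ.<_) (sym eq) 0<q
  regroup : ∀ r b → r ℚ.* b ≡ 1ℚ → r ℚ.* ε ℚ.* b ≡ ε
  regroup r b eq = trans (cong (ℚ._* b) (ℚ.*-comm r ε))
    (trans (ℚ.*-assoc ε r b) (trans (cong (ε ℚ.*_) eq) (ℚ.*-identityʳ ε)))

≈-refl : ∀ {x} → x ≈ x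
≈-refl {x} = ≤-refl {x} , ≤-refl {x}

≈-sym : ∀ {x y} → x ≈ y → y ≈ x
≈-sym (p , q) = q , p

≈-trans : ∀ {x y z} → x ≈ y → y ≈ z → x ≈ z
≈-trans {x} {y} {z} (p , q) (r , s) = ≤-trans {x} {y} {z} p r , ≤-trans {z} {y} {x} s q

+-cong : ∀ {x y u v} → x ≈ y → u ≈ v → x + u ≈ y + v
+-cong {x} {y} {u} {v} (p , q) (r , s) = +-mono-≤ {x} {y} {u} {v} p r , +-mono-≤ {y} {x} {v} {u} q s

-‿cong : ∀ {x y} → x ≈ y → - x ≈ - y
-‿cong {x} {y} (p , q) = -‿anti-≤ {y} {x} q , -‿anti-≤ {x} {y} p

x≤y⇒0≤y-x : ∀ {x y} → x ≤ y → 0ℝ ≤ y + - x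
x≤y⇒0≤y-x {x} {y} x≤y = ≤-trans {0ℝ} {x + - x} {y + - x}
  (≤-pointwise {0ℝ} {x + - x} (λ n → ℚ.≤-reflexive (sym (ℚ.+-inverseʳ (approx x n)))))
  (+-mono-≤ {x} {y} { - x} { - x} x≤y (≤-refl { - x}))

0≤y-x⇒x≤y : ∀ {x y} → 0ℝ ≤ y + - x → x ≤ y
0≤y-x⇒x≤y {x} {y} h =
  ≤-trans {x} {0ℝ + x} {y} (≤-pointwise {x} {0ℝ + x} (λ n → ℚ.≤-reflexive (sym (ℚ.+-identityˡ _))))
    (≤-trans {0ℝ + x} {(y + - x) + x} {y} (+-mono-≤ {0ℝ} {y + - x} {x} {x} h (≤-refl {x}))
      (≤-pointwise {(y + - x) + x} {y} (λ n → ℚ.≤-reflexive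
        (trans (ℚ.+-assoc (approx y n) (ℚ.- approx x n) (approx x n))
          (trans (cong (approx y n ℚ.+_) (ℚ.+-inverseˡ (approx x n))) (ℚ.+-identityʳ (approx y n)))))))

∃-rational-bound : ∀ x → ∃[ B ] 0ℚ ℚ.< B × (x ≤ fromℚ B) × (- fromℚ B ≤ x)
∃-rational-bound x =
  let B , 0<B , N , h = bounded x
  in B , 0<B ,
     (λ ε 0<ε → N , λ n p → ℚ.≤-trans (p≤∣p∣ (approx x n))
       (ℚ.≤-trans (h n p) (p≤p+ε B (ℚ.<⇒≤ 0<ε)))) ,
     (λ ε 0<ε → N , λ n p → ℚ.≤-trans (ℚ.neg-antimono-≤ (h n p))
       (ℚ.≤-trans (-∣p∣≤p (approx x n)) (p≤p+ε (approx x n) (ℚ.<⇒≤ 0<ε))))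
  where
  -∣p∣≤p : ∀ p → ℚ.- ℚ.∣ p ∣ ℚ.≤ p
  -∣p∣≤p p = ℚ.≤-trans (ℚ.neg-antimono-≤ (subst (ℚ.- p ℚ.≤_) (ℚ.∣-p∣≡∣p∣ p) (p≤∣p∣ (ℚ.- p))))
    (ℚ.≤-reflexive (ℚ-neg-involutive p))

private
  *-bounded : ∀ {x y B} → 0ℝ ≤ x → y ≤ fromℚ B → x * y ≤ x * fromℚ B
  *-bounded {x} {y} {B} 0≤x y≤B = 0≤y-x⇒x≤y {x * y} {x * fromℚ B}
    (≤-trans {0ℝ} {x * (fromℚ B + - y)} {x * fromℚ B + - (x * y)}
      (*-nonneg {x} {fromℚ B + - y} 0≤x (x≤y⇒0≤y-x {y} {fromℚ B} y≤B))
      (≤-pointwise {x * (fromℚ B + - y)} {x * fromℚ B + - (x * y)} (λ n → ℚ.≤-reflexive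
        (trans (ℚ.*-distribˡ-+ (approx x n) B (ℚ.- approx y n))
          (cong (approx x n ℚ.* B ℚ.+_) (sym (ℚ.neg-distribʳ-* (approx x n) (approx y n))))))))

  -- A rational bound `y ≤ B` gives `x * y ≤ x * B` because `0 ≤ x`, and `x * B ≤ 0` because
  -- `0 ≤ - x`. Thus congruence of multiplication follows from the order alone.
  zero*≤0 : ∀ {x y} → x ≈ 0ℝ → x * y ≤ 0ℝ
  zero*≤0 {x} {y} (x≤0 , 0≤x) =
    let B , 0<B , y≤B , _ = ∃-rational-bound y
    in ≤-trans {x * y} {x * fromℚ B} {0ℝ} (*-bounded {x} {y} {B} 0≤x y≤B)
         (0≤y-x⇒x≤y {x * fromℚ B} {0ℝ}
           (≤-trans {0ℝ} { - x * fromℚ B} {0ℝ + - (x * fromℚ B)}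
             (*-nonneg { - x} {fromℚ B} (-‿anti-≤ {x} {0ℝ} x≤0) (≤-pointwise {0ℝ} {fromℚ B} (λ _ → ℚ.<⇒≤ 0<B)))
             (≤-pointwise { - x * fromℚ B} {0ℝ + - (x * fromℚ B)} (λ n → ℚ.≤-reflexive
               (trans (sym (ℚ.neg-distribˡ-* (approx x n) B)) (sym (ℚ.+-identityˡ _)))))))

  zero* : ∀ {x y} → x ≈ 0ℝ → x * y ≈ 0ℝ
  zero* {x} {y} x≈0 = zero*≤0 {x} {y} x≈0 ,
    ≤-trans {0ℝ} { - (x * - y)} {x * y}
      (-‿anti-≤ {x * - y} {0ℝ} (zero*≤0 {x} { - y} x≈0))
      (≤-pointwise { - (x * - y)} {x * y} (λ n → ℚ.≤-reflexive
        (trans (cong ℚ.-_ (sym (ℚ.neg-distribʳ-* (approx x n) (approx y n)))) (ℚ-neg-involutive _))))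

  *-congʳ′ : ∀ {x y z} → x ≈ y → x * z ≈ y * z
  *-congʳ′ {x} {y} {z} x≈y@(x≤y , y≤x) =
    let z₁ , z₂ = zero* {x + - y} {z} (x-y≤0 , x≤y⇒0≤y-x {y} {x} y≤x)
        eq = ≈-pointwise {(x + - y) * z} {x * z + - (y * z)} (λ n →
          trans (ℚ.*-distribʳ-+ (approx z n) (approx x n) (ℚ.- approx y n))
            (cong (approx x n ℚ.* approx z n ℚ.+_) (sym (ℚ.neg-distribˡ-* (approx y n) (approx z n)))))
    in 0≤y-x⇒x≤y {x * z} {y * z}
         (≤-trans {0ℝ} { - (x * z + - (y * z))} {y * z + - (x * z)}
           (-‿anti-≤ {x * z + - (y * z)} {0ℝ} (≤-trans {x * z + - (y * z)} {(x + - y) * z} {0ℝ} (proj₂ eq) z₁))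
           (≤-pointwise { - (x * z + - (y * z))} {y * z + - (x * z)} (λ n → ℚ.≤-reflexive
             (flip-difference (approx x n ℚ.* approx z n) (approx y n ℚ.* approx z n))))) ,
       0≤y-x⇒x≤y {y * z} {x * z} (≤-trans {0ℝ} {(x + - y) * z} {x * z + - (y * z)} z₂ (proj₁ eq))
    where
    flip-difference : ∀ a b → ℚ.- (a ℚ.- b) ≡ b ℚ.- a
    flip-difference a b = trans (ℚ.neg-distrib-+ a (ℚ.- b))
      (trans (cong (ℚ.- a ℚ.+_) (ℚ-neg-involutive b)) (ℚ.+-comm (ℚ.- a) b))
    x-y≤0 : x + - y ≤ 0ℝ
    x-y≤0 = ≤-trans {x + - y} {y + - y} {0ℝ} (+-mono-≤ {x} {y} { - y} { - y} x≤y (≤-refl { - y}))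
      (≤-pointwise {y + - y} {0ℝ} (λ n → ℚ.≤-reflexive (ℚ.+-inverseʳ (approx y n))))

*-cong : ∀ {x y u v} → x ≈ y → u ≈ v → x * u ≈ y * v
*-cong {x} {y} {u} {v} x≈y u≈v = ≈-trans {x * u} {y * u} {y * v} (*-congʳ′ {x} {y} {u} x≈y)
  (≈-trans {y * u} {u * y} {y * v} (comm y u)
    (≈-trans {u * y} {v * y} {y * v} (*-congʳ′ {u} {v} {y} u≈v) (comm v y)))
  where
  comm : ∀ a b → a * b ≈ b * a
  comm a b = ≈-pointwise {a * b} {b * a} (λ n → ℚ.*-comm (approx a n) (approx b n))

ℝ-commutativeRing : CommutativeRing 0ℓ 0ℓ
ℝ-commutativeRing = record
  { Carrier = ℝ ; _≈_ = _≈_ ; _+_ = _+_ ; _*_ = _*_ ; -_ = -_ ; 0# = 0ℝ ; 1# = 1ℝ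
  ; isCommutativeRing = record
    { isRing = record
      { +-isAbelianGroup = record
        { isGroup = record
          { isMonoid = record
            { isSemigroup = record
              { isMagma = record
                { isEquivalence = record
                  { refl  = λ {x} → ≈-refl {x}
                  ; sym   = λ {x} {y} → ≈-sym {x} {y}
                  ; trans = λ {x} {y} {z} → ≈-trans {x} {y} {z} }
                ; ∙-cong = λ {x} {y} {u} {v} → +-cong {x} {y} {u} {v} }
              ; assoc = λ x y z → ≈-pointwise {x + y + z} {x + (y + z)} (λ n → ℚ.+-assoc (approx x n) (approx y n) (approx z n)) }
            ; identity = (λ x → ≈-pointwise {0ℝ + x} {x} (λ n → ℚ.+-identityˡ (approx x n)))
                       , (λ x → ≈-pointwise {x + 0ℝ} {x} (λ n → ℚ.+-identityʳ (approx x n))) }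
          ; inverse = (λ x → ≈-pointwise { - x + x} {0ℝ} (λ n → ℚ.+-inverseˡ (approx x n)))
                    , (λ x → ≈-pointwise {x + - x} {0ℝ} (λ n → ℚ.+-inverseʳ (approx x n)))
          ; ⁻¹-cong = λ {x} {y} → -‿cong {x} {y} }
        ; comm = λ x y → ≈-pointwise {x + y} {y + x} (λ n → ℚ.+-comm (approx x n) (approx y n)) }
      ; *-cong = λ {x} {y} {u} {v} → *-cong {x} {y} {u} {v}
      ; *-assoc = λ x y z → ≈-pointwise {x * y * z} {x * (y * z)} (λ n → ℚ.*-assoc (approx x n) (approx y n) (approx z n))
      ; *-identity = (λ x → ≈-pointwise {1ℝ * x} {x} (λ n → ℚ.*-identityˡ (approx x n)))
                   , (λ x → ≈-pointwise {x * 1ℝ} {x} (λ n → ℚ.*-identityʳ (approx x n)))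
      ; distrib = (λ x y z → ≈-pointwise {x * (y + z)} {x * y + x * z} (λ n → ℚ.*-distribˡ-+ (approx x n) (approx y n) (approx z n)))
                , (λ x y z → ≈-pointwise {(y + z) * x} {y * x + z * x} (λ n → ℚ.*-distribʳ-+ (approx x n) (approx y n) (approx z n))) }
    ; *-comm = λ x y → ≈-pointwise {x * y} {y * x} (λ n → ℚ.*-comm (approx x n) (approx y n)) } }

<⇒≤ : ∀ {x y} → x < y → x ≤ y
<⇒≤ {x} {y} (δ , 0<δ , N , h) ε 0<ε = N , λ n p →
  ℚ.≤-trans (p≤p+ε (approx x n) (ℚ.<⇒≤ 0<δ)) (ℚ.≤-trans (h n p) (p≤p+ε (approx y n) (ℚ.<⇒≤ 0<ε)))

<⇒≱ : ∀ {x y} → x < y → ¬ y ≤ x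
<⇒≱ {x} {y} (ε , 0<ε , M , h) y≤x =
  let N , k = y≤x (½ ℚ.* ε) (½-positive 0<ε)
      n = M ℕ.⊔ N
      x+ε≤x+½ε = ℚ.≤-trans (h n (ℕ.m≤m⊔n M N)) (k n (ℕ.m≤n⊔m M N))
  in ℚ.<-irrefl refl (ℚ.<-≤-trans (ℚ.+-monoʳ-< (approx x n) ½ε<ε) x+ε≤x+½ε)
  where
  ½<1 : ½ ℚ.< 1ℚ
  ½<1 = ℚ.*<* (ℤ.+<+ (ℕ.s≤s (ℕ.s≤s ℕ.z≤n)))
  ½ε<ε : ½ ℚ.* ε ℚ.< ε
  ½ε<ε = subst (½ ℚ.* ε ℚ.<_) (ℚ.*-identityˡ ε) (ℚ.*-monoˡ-<-pos ε {{ℚ.positive 0<ε}} ½<1)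

private
  +-cancelʳ-≤ : ∀ {p q} e → p ℚ.+ e ℚ.≤ q ℚ.+ e → p ℚ.≤ q
  +-cancelʳ-≤ {p} {q} e h = ℚ.≤-trans (ℚ.≤-reflexive (shift p e))
    (ℚ.≤-trans (ℚ.+-monoˡ-≤ (ℚ.- e) h) (ℚ.≤-reflexive (sym (shift q e))))

  close : ∀ {a b e} → ℚ.∣ a ℚ.- b ∣ ℚ.≤ e → a ℚ.≤ b ℚ.+ e
  close {a} {b} {e} h = ℚ.≤-trans
    (ℚ.≤-reflexive (sym (trans (ℚ.+-comm b (a ℚ.- b)) (trans (ℚ.+-assoc a (ℚ.- b) b)
      (trans (cong (a ℚ.+_) (ℚ.+-inverseˡ b)) (ℚ.+-identityʳ a))))))
    (ℚ.+-monoʳ-≤ b (ℚ.≤-trans (p≤∣p∣ (a ℚ.- b)) h))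

  abstract
    regroup₁ : ∀ x ε → ((x ℚ.+ ½ ℚ.* (½ ℚ.* (½ ℚ.* ε))) ℚ.+ ½ ℚ.* ε) ℚ.+ ½ ℚ.* (½ ℚ.* (½ ℚ.* ε))
             ≡ x ℚ.+ (½ ℚ.* ε ℚ.+ ½ ℚ.* (½ ℚ.* ε))
    regroup₁ = solve 2 (λ x e → ((x :+ con ½ :* (con ½ :* (con ½ :* e))) :+ con ½ :* e) :+ con ½ :* (con ½ :* (con ½ :* e))
             := x :+ (con ½ :* e :+ con ½ :* (con ½ :* e))) refl
      where open ℚSolver.+-*-Solver

    regroup₂ : ∀ x ε → (x ℚ.+ ½ ℚ.* (½ ℚ.* (½ ℚ.* ε))) ℚ.+ ½ ℚ.* (½ ℚ.* ε) ℚ.+ ½ ℚ.* (½ ℚ.* (½ ℚ.* ε))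
             ≡ x ℚ.+ ½ ℚ.* ε
    regroup₂ = solve 2 (λ x e → (x :+ con ½ :* (con ½ :* (con ½ :* e))) :+ con ½ :* (con ½ :* e) :+ con ½ :* (con ½ :* (con ½ :* e))
             := x :+ con ½ :* e) refl
      where open ℚSolver.+-*-Solver

-- One rational comparison decides, at an index `K` past both moduli for `e = ε / 8`. If
-- `y ≤ x + ε / 2` holds there, it spreads to all later indices with total error at most `ε`; if it
-- fails, the gap `q = ε / 4` persists and witnesses `x < y`.
≮⇒≥ : ∀ {x y} → ¬ x < y → y ≤ x
≮⇒≥ {x} {y} x≮y ε 0<ε = by-cases (approx y K ℚ.≤? approx x K ℚ.+ h)
  where
  open ℚ.≤-Reasoning
  h = ½ ℚ.* ε
  q = ½ ℚ.* h
  e = ½ ℚ.* q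
  0<h = ½-positive 0<ε
  0<q = ½-positive 0<h
  0<e = ½-positive 0<q
  M = proj₁ (isCauchy x e 0<e)
  N = proj₁ (isCauchy y e 0<e)
  K = M ℕ.⊔ N
  q≤h : q ℚ.≤ h
  q≤h = ℚ.≤-trans (p≤p+ε q (ℚ.<⇒≤ 0<q)) (ℚ.≤-reflexive (halves h))
  x-close : ∀ m n → K ℕ.≤ m → K ℕ.≤ n → approx x m ℚ.≤ approx x n ℚ.+ e
  x-close m n p r = close (proj₂ (isCauchy x e 0<e) m n (ℕ.m⊔n≤o⇒m≤o M N p) (ℕ.m⊔n≤o⇒m≤o M N r))
  y-close : ∀ m n → K ℕ.≤ m → K ℕ.≤ n → approx y m ℚ.≤ approx y n ℚ.+ e
  y-close m n p r = close (proj₂ (isCauchy y e 0<e) m n (ℕ.m⊔n≤o⇒n≤o M N p) (ℕ.m⊔n≤o⇒n≤o M N r))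
  by-cases : Dec (approx y K ℚ.≤ approx x K ℚ.+ h) →
             ∃[ L ] ∀ n → L ℕ.≤ n → approx y n ℚ.≤ approx x n ℚ.+ ε
  by-cases (yes p) = K , λ n K≤n → begin
    approx y n                             ≤⟨ y-close n K K≤n ℕ.≤-refl ⟩
    approx y K ℚ.+ e                       ≤⟨ ℚ.+-monoˡ-≤ e p ⟩
    (approx x K ℚ.+ h) ℚ.+ e               ≤⟨ ℚ.+-monoˡ-≤ e (ℚ.+-monoˡ-≤ h (x-close K n ℕ.≤-refl K≤n)) ⟩
    ((approx x n ℚ.+ e) ℚ.+ h) ℚ.+ e       ≡⟨ regroup₁ (approx x n) ε ⟩
    approx x n ℚ.+ (h ℚ.+ q)               ≤⟨ ℚ.+-monoʳ-≤ (approx x n) (ℚ.+-monoʳ-≤ h q≤h) ⟩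
    approx x n ℚ.+ (h ℚ.+ h)               ≡⟨ cong (approx x n ℚ.+_) (halves ε) ⟩
    approx x n ℚ.+ ε                       ∎
  by-cases (no ¬p) = ⊥-elim (x≮y (q , 0<q , K , λ n K≤n → +-cancelʳ-≤ e (begin
    approx x n ℚ.+ q ℚ.+ e                 ≤⟨ ℚ.+-monoˡ-≤ e (ℚ.+-monoˡ-≤ q (x-close n K K≤n ℕ.≤-refl)) ⟩
    (approx x K ℚ.+ e) ℚ.+ q ℚ.+ e         ≡⟨ regroup₂ (approx x K) ε ⟩
    approx x K ℚ.+ h                       ≤⟨ ℚ.<⇒≤ (ℚ.≰⇒> ¬p) ⟩
    approx y K                             ≤⟨ y-close K n ℕ.≤-refl K≤n ⟩
    approx y n ℚ.+ e                       ∎)))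

*-pos : ∀ {x y} → 0ℝ < x → 0ℝ < y → 0ℝ < x * y
*-pos {x} {y} (δ , 0<δ , M , h) (ε , 0<ε , N , k) =
  δ ℚ.* ε , *-positive 0<δ 0<ε , M ℕ.⊔ N , λ n p →
    let δ≤x = ℚ.≤-trans (ℚ.≤-reflexive (sym (ℚ.+-identityˡ δ))) (h n (ℕ.m⊔n≤o⇒m≤o M N p))
        ε≤y = ℚ.≤-trans (ℚ.≤-reflexive (sym (ℚ.+-identityˡ ε))) (k n (ℕ.m⊔n≤o⇒n≤o M N p))
    in begin
    0ℚ ℚ.+ δ ℚ.* ε                  ≡⟨ ℚ.+-identityˡ (δ ℚ.* ε) ⟩
    δ ℚ.* ε                         ≤⟨ ℚ.*-monoˡ-≤-nonNeg δ {{ℚ.nonNegative (ℚ.<⇒≤ 0<δ)}} ε≤y ⟩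
    δ ℚ.* approx y n                ≤⟨ ℚ.*-monoʳ-≤-nonNeg (approx y n)
                                         {{ℚ.nonNegative (ℚ.≤-trans (ℚ.<⇒≤ 0<ε) ε≤y)}} δ≤x ⟩
    approx x n ℚ.* approx y n       ∎
  where open ℚ.≤-Reasoning

ℝ-archimedean : ArchimedeanRing
ℝ-archimedean = record
  { commutativeRing = ℝ-commutativeRing
  ; _≲_ = _≤_
  ; antisym = _,_
  ; reflexive = proj₁
  ; transitive = λ {x} {y} {z} → ≤-trans {x} {y} {z}
  ; +-mono = λ {x} {y} {u} {v} → +-mono-≤ {x} {y} {u} {v}
  ; *-mono = λ {x} {y} → *-nonneg {x} {y}
  ; *-strict = λ {x} {y} x≰0 y≰0 xy≤0 → x≰0 (≮⇒≥ {0ℝ} {x} λ 0<x → y≰0 (≮⇒≥ {0ℝ} {y} λ 0<y →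
      <⇒≱ {0ℝ} {x * y} (*-pos {x} {y} 0<x 0<y) xy≤0))
  ; total = λ {x} {y} x≰y → ≮⇒≥ {x} {y} (x≰y ∘ <⇒≤ {x} {y})
  ; stable = λ {x} {y} ¬¬x≤y → ≮⇒≥ {y} {x} λ y<x → ¬¬x≤y (<⇒≱ {y} {x} y<x)
  ; ι = fromℚ
  ; ι-+ = λ p q → ≈-pointwise {fromℚ (p ℚ.+ q)} {fromℚ p + fromℚ q} (λ _ → refl)
  ; ι-* = λ p q → ≈-pointwise {fromℚ (p ℚ.* q)} {fromℚ p * fromℚ q} (λ _ → refl)
  ; ι-neg = λ p → ≈-pointwise {fromℚ (ℚ.- p)} { - fromℚ p} (λ _ → refl)
  ; ι-0 = ≈-refl {0ℝ}
  ; ι-1 = ≈-refl {1ℝ}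
  ; ι-mono = λ {p} {q} p≤q → ≤-pointwise {fromℚ p} {fromℚ q} (λ _ → p≤q)
  ; ι-reflect = λ {p} {q} p≤q → ℚ.≮⇒≥ λ q<p → <⇒≱ {fromℚ q} {fromℚ p} (fromℚ-mono-< q<p) p≤q
  ; bound = ∃-rational-bound
  ; limit = λ {x} → 0≤-limit {x}
  }
  where
  fromℚ-mono-< : ∀ {p q} → p ℚ.< q → fromℚ p < fromℚ q
  fromℚ-mono-< {p} {q} p<q = q ℚ.- p
    , subst (ℚ._< q ℚ.- p) (ℚ.+-inverseʳ p) (ℚ.+-monoˡ-< (ℚ.- p) p<q)
    , 0 , λ _ _ → ℚ.≤-reflexive (trans (ℚ.+-comm p (q ℚ.- p)) (trans (ℚ.+-assoc q (ℚ.- p) p)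
        (trans (cong (q ℚ.+_) (ℚ.+-inverseˡ p)) (ℚ.+-identityʳ q))))
  0≤-limit : ∀ {x} → (∀ ε → 0ℚ ℚ.< ε → - fromℚ ε ≤ x) → 0ℝ ≤ x
  0≤-limit {x} h ε 0<ε =
    let N , k = h (½ ℚ.* ε) (½-positive 0<ε) (½ ℚ.* ε) (½-positive 0<ε)
    in N , λ n p → begin
      0ℚ                                          ≡⟨ ℚ.+-inverseˡ (½ ℚ.* ε) ⟨
      ℚ.- (½ ℚ.* ε) ℚ.+ ½ ℚ.* ε                   ≤⟨ ℚ.+-monoˡ-≤ (½ ℚ.* ε) (k n p) ⟩
      approx x n ℚ.+ ½ ℚ.* ε ℚ.+ ½ ℚ.* ε          ≡⟨ ℚ.+-assoc (approx x n) (½ ℚ.* ε) (½ ℚ.* ε) ⟩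
      approx x n ℚ.+ (½ ℚ.* ε ℚ.+ ½ ℚ.* ε)        ≡⟨ cong (approx x n ℚ.+_) (halves ε) ⟩
      approx x n ℚ.+ ε                            ∎
    where open ℚ.≤-Reasoning

-- The transformation matrix

subset-of-size : ∀ {n} (p : Subset n) k → k ℕ.≤ card p → ∃[ S ] S ⊆ p × card S ≡ k
subset-of-size []            zero    _         = [] , (λ ()) , refl
subset-of-size (outside ∷ p) k       k≤        = let S , S⊆p , eq = subset-of-size p k k≤ in outside ∷ S , out⊆ S⊆p , eq
subset-of-size (inside ∷ p)  zero    _         = let S , S⊆p , eq = subset-of-size p zero ℕ.z≤n in outside ∷ S , out⊆ S⊆p , eq
subset-of-size (inside ∷ p)  (suc k) (ℕ.s≤s k≤) = let S , S⊆p , eq = subset-of-size p k k≤ in inside ∷ S , in⊆in S⊆p , cong suc eq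

module UniformTriangulation {n} {Δ : SimplicialComplex n} (T : Triangulation Δ) {F : Subset n} (F-face : Face Δ F) where

  open Triangulation T

  module Subdivided = TriangulatedSimplex.Subdivision ℝ-archimedean {v = position} {v′ = position′} (Face Δ) (Face Δ′)
    (SimplicialComplex.down-closed Δ′)
    (IsRealization.independent realizes) (IsRealization.intersection realizes)
    (IsRealization.independent realizes′) (IsRealization.intersection realizes′)
    (Subdivides.refines subdivides) (Subdivides.covers subdivides) F-face

  module _ (b : Fin vertices′ → Fin n → ℝ) (hb : ∀ u → Subdivided.IsCoordinate b u) where

    module Cone = Subdivided.Cone b hb
    module HalfOpen = ConeGeometry.HalfOpen ℝ-archimedean Cone.coneComplex

    Restriction-mono : ∀ {E E′ τ} → E ⊆ E′ → Restriction E τ → Restriction E′ τ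
    Restriction-mono E⊆E′ (fτ , τ⊆E) = fτ , λ {x} h → TriangulatedSimplex.conv-⊆ ℝ-archimedean {v = position} E⊆E′ {x} (τ⊆E {x} h)

    -- In barycentric coordinates both assumptions say which coordinates vanish on `τ`: those off
    -- `E`, and the one at `c`.
    Restriction-∖ : ∀ {E c τ} → E ⊆ F → Restriction E τ → Restriction (F ∖ c) τ → Restriction (E ∖ c) τ
    Restriction-∖ {E} {c} {τ} E⊆F rE rF∖c =
      let cτ , b-suppE = Cone.restriction⁻ {E} {τ} E⊆F rE
          _ , b-suppF∖c = Cone.restriction⁻ {F ∖ c} {τ} (∖-⊆ F c) rF∖c
      in Cone.restriction⁺ {E ∖ c} {τ} cτ λ u u∈τ x x∉E∖c → case x ≟ c of λ
        { (yes refl) → b-suppF∖c u u∈τ x (x∉p∖x F x)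
        ; (no x≢c)   → b-suppE u u∈τ x λ x∈E → x∉E∖c (x∈p∧x≢y⇒x∈p-y x∈E x≢c) }

    Restriction-dimension : ∀ {E τ} → E ⊆ F → Restriction E τ → card τ ℕ.≤ card E
    Restriction-dimension {E} {τ} E⊆F rE =
      let cτ , b-supp = Cone.restriction⁻ {E} {τ} E⊆F rE in HalfOpen.dimension {τ} {E} cτ b-supp

    avoids⇒ : ∀ {S τ} → (∀ c → c ∈ S → ¬ Restriction (F ∖ c) τ) → Restriction F τ →
      ∀ c → c ∈ S → ¬ (∀ u → u ∈ τ → b u c ≈ 0ℝ)
    avoids⇒ {S} {τ} avoids cτ c c∈S b≈0 = avoids c c∈S (Cone.restriction⁺ {F ∖ c} {τ} cτ λ u u∈τ x x∉F∖c → case x ≟ c of λ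
      { (yes refl) → b≈0 u u∈τ
      ; (no x≢c)   → proj₁ (proj₂ (hb u)) x λ x∈F → x∉F∖c (x∈p∧x≢y⇒x∈p-y x∈F x≢c) })

    ⇒avoids : ∀ {S τ} → (∀ c → c ∈ S → ¬ (∀ u → u ∈ τ → b u c ≈ 0ℝ)) → ∀ c → c ∈ S → ¬ Restriction (F ∖ c) τ
    ⇒avoids {S} {τ} h c c∈S rF∖c = h c c∈S λ u u∈τ →
      proj₂ (Cone.restriction⁻ {F ∖ c} {τ} (∖-⊆ F c) rF∖c) u u∈τ c (x∉p∖x F c)

  -- The order on the integers is decidable, hence stable. So the coordinates, the decisions about
  -- restrictions and the map `R` may all be chosen under a double negation.
  entries-nonneg : ∀ {𝓕} → 1 ℕ.≤ card F → IsUniform (card F) 𝓕 T → ∀ i k → 0ℤ ℤ.≤ transformationMatrix (card F) 𝓕 i k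
  entries-nonneg {𝓕} 1≤∣F∣ uniform i k = decidable-stable (0ℤ ℤ.≤? transformationMatrix (card F) 𝓕 i k) do
    b , hb ← Subdivided.coordinates
    Restriction? ← ¬¬-Subset {P = λ E → ∀ τ → Dec (Restriction E τ)} λ E → ¬¬-Subset λ τ → ¬¬-excluded-middle
    R , R⊆ , covered , full , disjoint ← HalfOpen.half-open-interval-partition b hb (proj₂ (card>0⇒∃∈ F 1≤∣F∣)) S′ S′⊆F
    return (subst (0ℤ ℤ.≤_) (sym (trans (transformationMatrix-entry (card F) 𝓕 i k)
        (cong (λ k → ∑< (suc (card F)) (λ l → f→h-entry (card F) (toℕ i) l ℤ.* diff^ k (λ j → + extend 𝓕 l j) (card F ∸ k))) (sym ∣S′∣≡k))))
      (HalfOpenCount.entry-nonneg 𝓕 Restriction Restriction?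
        (λ {E} {E′} {τ} → Restriction-mono b hb {E} {E′} {τ})
        (λ {E} {c} {τ} → Restriction-∖ b hb {E} {c} {τ})
        (λ {E} {τ} → Restriction-dimension b hb {E} {τ})
        (λ i j i≤j E E⊆F ∣E∣≡j → uniform i j i≤j (subst (ℕ._≤ card F) ∣E∣≡j (p⊆q⇒∣p∣≤∣q∣ E⊆F)) E
          (SimplicialComplex.down-closed Δ E⊆F F-face) ∣E∣≡j)
        R S′ S′⊆F R⊆
        (λ τ rτ avoids → covered τ rτ (avoids⇒ b hb {S′} {τ} avoids rτ))
        (λ σ τ fσ R⊆τ τ⊆σ → ConeGeometry.ConeComplex.down-closed (Subdivided.Cone.coneComplex b hb) τ⊆σ (proj₁ fσ)
          , ⇒avoids b hb {S′} {τ} (full σ τ fσ R⊆τ τ⊆σ))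
        disjoint (toℕ i)))
    where
    S-data : ∃[ S′ ] S′ ⊆ F × card S′ ≡ toℕ k
    S-data = subset-of-size F (toℕ k) (ℕ.s≤s⁻¹ (toℕ<n k))
    S′ : Subset n
    S′ = proj₁ S-data
    S′⊆F : S′ ⊆ F
    S′⊆F = proj₁ (proj₂ S-data)
    ∣S′∣≡k : card S′ ≡ toℕ k
    ∣S′∣≡k = proj₂ (proj₂ S-data)

-- Integers among the reals

integer : ℤ → ℚ
integer z = ℚ.mkℚ z 0 (Coprimality.sym (Coprimality.1-coprimeTo ℤ.∣ z ∣))

/1≡integer : ∀ z → z ℚ./ 1 ≡ integer z
/1≡integer z = ℚ.↥p/↧p≡p (integer z)

integer-mono : ∀ {x y} → x ℤ.≤ y → integer x ℚ.≤ integer y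
integer-mono x≤y = ℚ.*≤* (ℤ.*-monoʳ-≤-nonNeg (+ 1) x≤y)

integer-reflect : ∀ {x y} → integer x ℚ.≤ integer y → x ℤ.≤ y
integer-reflect {x} {y} (ℚ.*≤* h) = ℤ.*-cancelʳ-≤-pos x y (+ 1) h

fromℤ-mono : ∀ {x y} → x ℤ.≤ y → fromℤ x ≤ fromℤ y
fromℤ-mono {x} {y} x≤y = ≤-pointwise {fromℤ x} {fromℤ y} λ _ →
  subst₂ ℚ._≤_ (sym (/1≡integer x)) (sym (/1≡integer y)) (integer-mono x≤y)

fromℤ-reflect : ∀ {x y} → fromℤ x ≤ fromℤ y → x ℤ.≤ y
fromℤ-reflect {x} {y} h = integer-reflect (subst₂ ℚ._≤_ (/1≡integer x) (/1≡integer y)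
  (ArchimedeanRing.ι-reflect ℝ-archimedean h))

/1-* : ∀ x y → (x ℚ./ 1) ℚ.* (y ℚ./ 1) ≡ (x ℤ.* y) ℚ./ 1
/1-* x y = cong₂ ℚ._*_ (/1≡integer x) (/1≡integer y)

fromℤ-*-reflect : ∀ {x y z w} → fromℤ x * fromℤ y ≤ fromℤ z * fromℤ w → x ℤ.* y ℤ.≤ z ℤ.* w
fromℤ-*-reflect {x} {y} {z} {w} h = fromℤ-reflect {x ℤ.* y} {z ℤ.* w} (≤-trans {fromℤ (x ℤ.* y)} {fromℤ x * fromℤ y} {fromℤ (z ℤ.* w)}
  (≤-pointwise {fromℤ (x ℤ.* y)} {fromℤ x * fromℤ y} (λ _ → ℚ.≤-reflexive (sym (/1-* x y))))
  (≤-trans {fromℤ x * fromℤ y} {fromℤ z * fromℤ w} {fromℤ (z ℤ.* w)} h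
    (≤-pointwise {fromℤ z * fromℤ w} {fromℤ (z ℤ.* w)} (λ _ → ℚ.≤-reflexive (/1-* z w)))))

fromℤ≈0⇒≡0 : ∀ {z} → fromℤ z ≈ 0ℝ → z ≡ 0ℤ
fromℤ≈0⇒≡0 {z} (z≤0 , 0≤z) = ℤ.≤-antisym (fromℤ-reflect {z} {0ℤ} z≤0) (fromℤ-reflect {0ℤ} {z} 0≤z)

-- Minors of pairs of columns

polynomial-coefficient : ∀ {n} (a : Fin n → ℝ) i → polynomial a (toℕ i) ≡ a i
polynomial-coefficient a zero    = refl
polynomial-coefficient a (suc i) = polynomial-coefficient (a ∘ suc) i

polynomial-nonneg : ∀ {n} (a : Fin n → ℝ) → (∀ i → 0ℝ ≤ a i) → ∀ k → 0ℝ ≤ polynomial a k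
polynomial-nonneg {zero}  a h k       = ≤-refl {0ℝ}
polynomial-nonneg {suc n} a h zero    = h zero
polynomial-nonneg {suc n} a h (suc k) = polynomial-nonneg (a ∘ suc) (h ∘ suc) k

module Minors = RealRootedPolynomials ℝ-archimedean

∏-isProduct : ∀ {m} (r : Fin m → ℝ) → Minors.IsProduct r ∏[X- r ]
∏-isProduct {zero}  r = ≈-refl {1ℝ} , λ _ → ≈-refl {0ℝ}
∏-isProduct {suc m} r = ∏[X- r ∘ suc ] , ∏-isProduct (r ∘ suc)
  , Minors.linearMultiple (≈-refl { - (r zero * ∏[X- r ∘ suc ] 0)})
      (λ k → ≈-refl {∏[X- r ∘ suc ] k + - (r zero * ∏[X- r ∘ suc ] (suc k))})

module _ {d} (H : Matrix d) (H≥0 : ∀ i j → 0ℤ ℤ.≤ H i j) where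

  column-nonneg : ∀ j k → 0ℝ ≤ columnPolynomial H j k
  column-nonneg j = polynomial-nonneg (λ i → fromℤ (H i j)) (λ i → fromℤ-mono (H≥0 i j))

  zero-column : ∀ {j} → IsZero (columnPolynomial H j) → ∀ i → H i j ≡ 0ℤ
  zero-column {j} h i = fromℤ≈0⇒≡0 (subst (_≈ 0ℝ) (polynomial-coefficient (λ i → fromℤ (H i j)) i) (h (toℕ i)))

  -- A zero column makes the minor vanish. Otherwise the real inequality between coefficients is a
  -- comparison of products of integers and can be reflected to `ℤ`.
  minor-nonneg : ∀ {i i′ j j′} → toℕ i ℕ.< toℕ i′ → columnPolynomial H j ⪯ columnPolynomial H j′ →
    0ℤ ℤ.≤ H i j ℤ.* H i′ j′ ℤ.- H i j′ ℤ.* H i′ j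
  minor-nonneg {i} {i′} {j} {j′} i<i′ (zeroˡ f≈0 _) =
    ℤ.≤-reflexive (sym (trans (cong₂ (λ x y → x ℤ.* H i′ j′ ℤ.- H i j′ ℤ.* y) (zero-column f≈0 i) (zero-column f≈0 i′))
      (cong (λ z → 0ℤ ℤ.- z) (ℤ.*-zeroʳ (H i j′)))))
  minor-nonneg {i} {i′} {j} {j′} i<i′ (zeroʳ _ g≈0) =
    ℤ.≤-reflexive (sym (trans (cong₂ (λ x y → H i j ℤ.* x ℤ.- y ℤ.* H i′ j) (zero-column g≈0 i′) (zero-column g≈0 i))
      (cong (λ z → z ℤ.- 0ℤ) (ℤ.*-zeroʳ (H i j)))))
  minor-nonneg {i} {i′} {j} {j′} i<i′ (interlace f g (n≡m⊎1+m , r≤s , _)) =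
    ℤ.i≤j⇒0≤j-i (subst (ℤ._≤ H i j ℤ.* H i′ j′) (ℤ.*-comm (H i′ j) (H i j′)) (fromℤ-*-reflect {H i′ j} {H i j′} {H i j} {H i′ j′}
      (subst₂ _≤_
        (cong₂ _*_ (polynomial-coefficient (λ i → fromℤ (H i j)) i′) (polynomial-coefficient (λ i → fromℤ (H i j′)) i))
        (cong₂ _*_ (polynomial-coefficient (λ i → fromℤ (H i j)) i) (polynomial-coefficient (λ i → fromℤ (H i j′)) i′))
        (subst (λ k → columnPolynomial H j k * columnPolynomial H j′ (toℕ i) ≤ columnPolynomial H j (toℕ i) * columnPolynomial H j′ k)
          (ℕ.m+[n∸m]≡n (ℕ.<⇒≤ i<i′)) minor))))
    where
    module f = RealRooted⁺ f
    module g = RealRooted⁺ g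
    m≤n : f.degree ℕ.≤ g.degree
    m≤n = case n≡m⊎1+m of λ
      { (inj₁ n≡m)   → ℕ.≤-reflexive (sym n≡m)
      ; (inj₂ n≡1+m) → subst (f.degree ℕ.≤_) (sym n≡1+m) (ℕ.n≤1+n f.degree) }
    minor : columnPolynomial H j (toℕ i ℕ.+ (toℕ i′ ∸ toℕ i)) * columnPolynomial H j′ (toℕ i)
          ≤ columnPolynomial H j (toℕ i) * columnPolynomial H j′ (toℕ i ℕ.+ (toℕ i′ ∸ toℕ i))
    minor = Minors.interlacing-minor {r = f.zeros} {g.zeros} {f.leading} {g.leading} {∏[X- f.zeros ]} {∏[X- g.zeros ]}
      {columnPolynomial H j} {columnPolynomial H j′}
      (<⇒≱ {0ℝ} {f.leading} f.leading>0) (<⇒≱ {0ℝ} {g.leading} g.leading>0) (∏-isProduct f.zeros) (∏-isProduct g.zeros)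
      f.factorization g.factorization (column-nonneg j) (column-nonneg j′)
      f.non-increasing g.non-increasing m≤n r≤s (toℕ i) (toℕ i′ ∸ toℕ i)

theorem5p1 : (d : ℕ) → 1 ℕ.≤ d → (𝓕 : ℕ → ℕ → ℕ) → IsUniformSubdivision d 𝓕 → HasInterlacingProperty d 𝓕 → IsTP₂ (transformationMatrix d 𝓕)
-- The dimension hypothesis supplies the one face `F` needed; matching on `refl` replaces `d` by
-- `card F`.
theorem5p1 d 1≤d 𝓕 (n , Δ , ((F , F-face , refl) , _) , T , uniform) (_ , interlacing) =
    H≥0
  , λ i i′ j j′ i<i′ j<j′ → minor-nonneg (transformationMatrix d 𝓕) H≥0 {i} {i′} {j} {j′} i<i′ (interlacing j j′ j<j′)
  where
  H≥0 : ∀ i j → 0ℤ ℤ.≤ transformationMatrix d 𝓕 i j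
  H≥0 = UniformTriangulation.entries-nonneg T F-face 1≤d uniform
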